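{- Let $d>2$ be an integer and let $p$ be a prime. For all $\vec{t}=(t_1,\dots,t_{d-1},1)\in\mathbb{Z}_p^d$ we have $$h_p(\vec{t})\ \le\ e(d-1)\,\frac{p\,\lceil\log p\rceil}{2\,h_p^*(\vec{t})},$$ where $e$ is the base of the natural logarithm; in particular $h_p(\vec t)\ll \dfrac{p\log p}{h_p^*(\vec t)}$, with an implied constant depending only on $d$.
   Context: $\mathbb{Z}_p=\mathbb{Z}/p\mathbb{Z}$ and $\log$ is the natural logarithm. For $\vec t=(t_1,\dots,t_{d-1},1)\in\mathbb{Z}_p^d$ define $$h_p(\vec{t}):=\min_{0<a<p}\ \max\big((at_1)\bmod p,\dots,(at_{d-1})\bmod p,\ a\big),$$ where $a$ ranges over integers and $m\bmod p$ denotes the representative in $\{0,1,\dots,p-1\}$. The dual height is $$h_p^*(\vec{t}):=\min_{\substack{\vec\alpha\in\mathbb{Z}_p^d,\ \vec\alpha\neq\vec 0\\ \vec\alpha\cdot\vec t\equiv 0 \ (\mathrm{mod}\ p)}}\ \max_{1\le i\le d}|\alpha_i|,$$ where for $x\in\mathbb{Z}_p$, $|x|$ denotes the smallest absolute value of an integer representing $x$. -}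

module Defs where

open import Data.Empty using (⊥-elim)
open import Data.Fin.Base using (Fin; toℕ)
open import Data.Fin.Properties using (toℕ<n)
open import Data.Integer.Base as ℤ using (ℤ; +_; -[1+_]; +[1+_]; +0; +≤+; +<+)
import Data.Integer.Properties as ℤ
open import Data.List.Base as List using (List)
import Data.List.Extrema.Nat as Extrema
import Data.List.Relation.Unary.All as ListAll
import Data.List.Relation.Unary.All.Properties as ListAll
open import Data.Nat.Base hiding (_/_; _%_; ∣_-_∣)
open import Data.Nat.Divisibility using (_∣_; _∣?_)
open import Data.Nat.DivMod using (_%_; _mod_)
open import Data.Nat.Properties
open import Data.Product.Base using (∃-syntax; _×_; _,_; proj₁; proj₂)
open import Data.Rational.Unnormalised.Base as ℚ
  using (ℚᵘ; mkℚᵘ; 0ℚᵘ; _/_; ∣_∣; *≤*; *<*; *≡*)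
import Data.Rational.Unnormalised.Properties as ℚ
open import Data.Sum.Base using (inj₁; inj₂)
open import Data.Vec.Base as Vec using (Vec; []; _∷_; _∷ʳ_; toList)
open import Data.Vec.Relation.Unary.All using (All; []; _∷_; all?)
open import Relation.Binary.PropositionalEquality
open import Relation.Nullary.Decidable using (Dec; yes; no; ¬?; _×-dec_)
open import Relation.Nullary.Negation using (¬_)

------------------------------------------------------------------------
-- Real numbers, as Cauchy sequences of rationals.  Real numbers are only
-- ever compared through _≤ᵣ_, which respects equality of limits.

Cauchy : (ℕ → ℚᵘ) → Set
Cauchy x = ∀ ε → 0ℚᵘ ℚ.< ε →
  ∃[ N ] (∀ m n → N ≤ m → N ≤ n → ∣ x m ℚ.- x n ∣ ℚ.≤ ε)

record ℝ : Set where
  constructor mkℝ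
  field
    seq    : ℕ → ℚᵘ
    cauchy : Cauchy seq

open ℝ public

infix 4 _≤ᵣ_
_≤ᵣ_ : ℝ → ℝ → Set
x ≤ᵣ y = ∀ ε → 0ℚᵘ ℚ.< ε →
  ∃[ N ] (∀ n → N ≤ n → seq x n ℚ.≤ seq y n ℚ.+ ε)

fromℚ : ℚᵘ → ℝ
fromℚ q = mkℝ (λ _ → q) λ ε 0<ε → 0 , λ _ _ _ _ → begin
  ∣ q ℚ.- q ∣  ≃⟨ ℚ.∣-∣-cong (ℚ.+-inverseʳ q) ⟩
  0ℚᵘ          ≤⟨ ℚ.<⇒≤ 0<ε ⟩
  ε            ∎
  where open ℚ.≤-Reasoning

fromℤ : ℤ → ℝ
fromℤ k = fromℚ (k / 1)

scale-cauchy : ∀ q x → Cauchy x → Cauchy (λ n → q ℚ.* x n)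
scale-cauchy q x cx ε 0<ε = proj₁ (cx δ 0<δ) , λ m n N≤m N≤n → begin
  ∣ q ℚ.* x m ℚ.- q ℚ.* x n ∣        ≃⟨ ℚ.∣-∣-cong (ℚ.+-congʳ (q ℚ.* x m) (ℚ.neg-distribʳ-* q (x n))) ⟩
  ∣ q ℚ.* x m ℚ.+ q ℚ.* ℚ.- x n ∣    ≃⟨ ℚ.∣-∣-cong (ℚ.*-distribˡ-+ q (x m) (ℚ.- x n)) ⟨
  ∣ q ℚ.* (x m ℚ.- x n) ∣            ≃⟨ ℚ.∣p*q∣≃∣p∣*∣q∣ q (x m ℚ.- x n) ⟩
  ∣ q ∣ ℚ.* ∣ x m ℚ.- x n ∣          ≤⟨ ℚ.*-monoʳ-≤-nonNeg ∣ q ∣ {{ℚ.∣-∣-nonNeg q}} (proj₂ (cx δ 0<δ) m n N≤m N≤n) ⟩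
  ∣ q ∣ ℚ.* δ                        ≤⟨ ℚ.*-monoˡ-≤-nonNeg δ {{ℚ.nonNegative (ℚ.<⇒≤ 0<δ)}} (∣q∣≤M q) ⟩
  M ℚ.* (ℚ.1/ M ℚ.* ε)               ≃⟨ ℚ.*-assoc M (ℚ.1/ M) ε ⟨
  M ℚ.* ℚ.1/ M ℚ.* ε                 ≃⟨ ℚ.*-congʳ {ε} (ℚ.*-inverseʳ M) ⟩
  ℚ.1ℚᵘ ℚ.* ε                        ≃⟨ ℚ.*-identityˡ ε ⟩
  ε                                  ∎
  where
  open ℚ.≤-Reasoning
  bound : ℚᵘ → ℚᵘ
  bound q = mkℚᵘ (+ suc (ℤ.∣ ℚ.↥ q ∣)) 0
  M = bound q
  δ = ℚ.1/ M ℚ.* ε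
  0<δ : 0ℚᵘ ℚ.< δ
  0<δ = ℚ.positive⁻¹ δ {{ℚ.pos*pos⇒pos (ℚ.1/ M) ε {{ℚ.positive 0<ε}}}}
  ∣q∣≤M : ∀ q → ∣ q ∣ ℚ.≤ bound q
  ∣q∣≤M (mkℚᵘ k d) = *≤* (subst₂ ℤ._≤_ (ℤ.pos-* ℤ.∣ k ∣ 1) (ℤ.pos-* (suc ℤ.∣ k ∣) (suc d))
    (+≤+ (*-mono-≤ (n≤1+n ℤ.∣ k ∣) (s≤s (z≤n {d})))))

infixr 8 _·_
_·_ : ℚᵘ → ℝ → ℝ
q · x = mkℝ (λ n → q ℚ.* seq x n) (scale-cauchy q (seq x) (cauchy x))

-- A relation, because the ceiling is not computable as a function on ℝ.
IsCeiling : ℝ → ℤ → Set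
IsCeiling x k = x ≤ᵣ fromℤ k × (∀ j → x ≤ᵣ fromℤ j → k ℤ.≤ j)

------------------------------------------------------------------------
-- The constants e and log n

sum : (ℕ → ℚᵘ) → ℕ → ℚᵘ
sum f zero    = 0ℚᵘ
sum f (suc n) = sum f n ℚ.+ f n

/-≤ : ∀ a b c d .{{_ : NonZero b}} .{{_ : NonZero d}} →
      a * d ≤ c * b → + a / b ℚ.≤ + c / d
/-≤ a (suc b) c (suc d) le =
  *≤* (subst₂ ℤ._≤_ (ℤ.pos-* a (suc d)) (ℤ.pos-* c (suc b)) (+≤+ le))

∸-≤ : ∀ {p q r s} → p ℚ.≤ r ℚ.+ s → r ℚ.≤ q → p ℚ.- q ℚ.≤ s
∸-≤ {p} {q} {r} {s} p≤r+s r≤q = begin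
  p ℚ.- q              ≤⟨ ℚ.+-mono-≤ p≤r+s (ℚ.neg-mono-≤ r≤q) ⟩
  r ℚ.+ s ℚ.- r        ≃⟨ ℚ.+-congˡ (ℚ.- r) (ℚ.+-comm r s) ⟩
  s ℚ.+ r ℚ.- r        ≃⟨ ℚ.+-assoc s r (ℚ.- r) ⟩
  s ℚ.+ (r ℚ.- r)      ≃⟨ ℚ.+-congʳ s (ℚ.+-inverseʳ r) ⟩
  s ℚ.+ 0ℚᵘ            ≃⟨ ℚ.+-identityʳ s ⟩
  s                    ∎
  where open ℚ.≤-Reasoning

abs≤ : ∀ p q {s} → p ℚ.- q ℚ.≤ s → q ℚ.- p ℚ.≤ s → ∣ p ℚ.- q ∣ ℚ.≤ s
abs≤ p q {s} u v with ℚ.∣p∣≡p∨∣p∣≡-p (p ℚ.- q)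
... | inj₁ eq = subst (ℚ._≤ s) (sym eq) u
... | inj₂ eq = subst (ℚ._≤ s) (sym eq) (begin
  ℚ.- (p ℚ.- q)          ≡⟨ ℚ.neg-distrib-+ p (ℚ.- q) ⟩
  ℚ.- p ℚ.+ ℚ.- ℚ.- q    ≃⟨ ℚ.+-congʳ (ℚ.- p) (ℚ.neg-involutive q) ⟩
  ℚ.- p ℚ.+ q            ≃⟨ ℚ.+-comm (ℚ.- p) q ⟩
  q ℚ.- p                ≤⟨ v ⟩
  s                      ∎)
  where open ℚ.≤-Reasoning

module _ (x : ℕ → ℚᵘ) (c : ℕ)
         (up   : ∀ n → x n ℚ.≤ x (suc n))
         (down : ∀ n → x (suc n) ℚ.+ + c / suc (suc n) ℚ.≤ x n ℚ.+ + c / suc n)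
  where

  private
    up* : ∀ {m n} → m ≤′ n → x m ℚ.≤ x n
    up* ≤′-refl       = ℚ.≤-refl
    up* (≤′-step m≤n) = ℚ.≤-trans (up* m≤n) (up _)

    down* : ∀ {m n} → m ≤′ n → x n ℚ.+ + c / suc n ℚ.≤ x m ℚ.+ + c / suc m
    down* ≤′-refl       = ℚ.≤-refl
    down* (≤′-step m≤n) = ℚ.≤-trans (down _) (down* m≤n)

  squeeze : Cauchy x
  squeeze (mkℚᵘ +0       b) (*<* (+<+ ()))
  squeeze (mkℚᵘ -[1+ a ] b) (*<* ())
  squeeze ε@(mkℚᵘ +[1+ a ] b) _ = N , λ m n N≤m N≤n →
    abs≤ (x m) (x n) (close m n N≤m N≤n) (close n m N≤n N≤m)
    where
    N = c * suc b
    small : + c / suc N ℚ.≤ ε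
    small = /-≤ c (suc N) (suc a) (suc b) (≤-trans (n≤1+n N) (m≤n*m (suc N) (suc a)))
    close : ∀ m n → N ≤ m → N ≤ n → x m ℚ.- x n ℚ.≤ ε
    close m n N≤m N≤n = ℚ.≤-trans
      (∸-≤ (ℚ.≤-trans (ℚ.p≤p+q (x m) (+ c / suc m)) (down* (≤⇒≤′ N≤m))) (up* (≤⇒≤′ N≤n)))
      small

0≤/ : ∀ a b .{{_ : NonZero b}} → 0ℚᵘ ℚ.≤ + a / b
0≤/ a b = /-≤ 0 1 a b z≤n

/-+ : ∀ a b d .{{_ : NonZero d}} → + a / d ℚ.+ + b / d ℚ.≃ + (a + b) / d
/-+ a b (suc d) = *≡* (begin
  (+ a ℤ.* D ℤ.+ + b ℤ.* D) ℤ.* D   ≡⟨ cong (ℤ._* D) (ℤ.*-distribʳ-+ D (+ a) (+ b)) ⟨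
  + (a + b) ℤ.* D ℤ.* D             ≡⟨ ℤ.*-assoc (+ (a + b)) D D ⟩
  + (a + b) ℤ.* (D ℤ.* D)           ≡⟨ cong (+ (a + b) ℤ.*_) (ℤ.pos-* (suc d) (suc d)) ⟨
  + (a + b) ℤ.* + (suc d * suc d)   ∎)
  where
  open ≡-Reasoning
  D = + suc d

eSeq : ℕ → ℚᵘ
eSeq n = sum (λ i → (+ 1 / (i !)) {{i !≢0}}) (suc n)

eSeq-up : ∀ n → eSeq n ℚ.≤ eSeq (suc n)
eSeq-up n = begin
  eSeq n            ≃⟨ ℚ.+-identityʳ (eSeq n) ⟨
  eSeq n ℚ.+ 0ℚᵘ    ≤⟨ ℚ.+-monoʳ-≤ (eSeq n) (0≤/ 1 (suc n !) {{suc n !≢0}}) ⟩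
  eSeq (suc n)      ∎
  where open ℚ.≤-Reasoning

fact-bound : ∀ n → 2 + n ≤ 3 * n !
fact-bound 0 = s≤s (s≤s z≤n)
fact-bound 1 = ≤-refl
fact-bound (suc (suc n)) = begin
  4 + n                      ≤⟨ +-monoˡ-≤ n (s≤s (s≤s (s≤s (s≤s (z≤n {2}))))) ⟩
  6 + n                      ≤⟨ +-monoʳ-≤ 6 (m≤n*m n 3) ⟩
  6 + 3 * n                  ≡⟨ *-distribˡ-+ 3 2 n ⟨
  3 * (2 + n)                ≤⟨ *-monoʳ-≤ 3 (m≤m*n (2 + n) (suc n !) {{suc n !≢0}}) ⟩
  3 * ((2 + n) * suc n !)    ∎
  where open ≤-Reasoning

-- 1 / (n + 1)! ≤ 3 / (n + 1) - 3 / (n + 2)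
e-step : ∀ n → (+ 1 / (suc n !)) {{suc n !≢0}} ℚ.+ + 3 / suc (suc n) ℚ.≤ + 3 / suc n
e-step n = begin
  (+ 1 / (suc n !)) {{suc n !≢0}} ℚ.+ + 3 / suc (suc n)
    ≤⟨ ℚ.+-monoˡ-≤ (+ 3 / suc (suc n)) (/-≤ 1 (suc n !) 3 (suc n * suc (suc n)) {{suc n !≢0}} le) ⟩
  + 3 / (suc n * suc (suc n)) ℚ.+ + 3 / suc (suc n)
    ≤⟨ ℚ.+-monoʳ-≤ (+ 3 / (suc n * suc (suc n)))
         (/-≤ 3 (suc (suc n)) (3 * suc n) (suc n * suc (suc n))
           (≤-reflexive (sym (*-assoc 3 (suc n) (suc (suc n)))))) ⟩
  + 3 / (suc n * suc (suc n)) ℚ.+ + (3 * suc n) / (suc n * suc (suc n))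
    ≃⟨ /-+ 3 (3 * suc n) (suc n * suc (suc n)) ⟩
  + (3 + 3 * suc n) / (suc n * suc (suc n))
    ≤⟨ /-≤ (3 + 3 * suc n) (suc n * suc (suc n)) 3 (suc n) (≤-reflexive (eq n)) ⟩
  + 3 / suc n ∎
  where
  open ℚ.≤-Reasoning
  eq : ∀ n → (3 + 3 * suc n) * suc n ≡ 3 * (suc n * suc (suc n))
  eq n = trans (cong (_* suc n) (sym (*-suc 3 (suc n)))) (trans
    (*-assoc 3 (suc (suc n)) (suc n)) (cong (3 *_) (*-comm (suc (suc n)) (suc n))))
  le : 1 * (suc n * suc (suc n)) ≤ 3 * suc n !
  le = ≤-trans (≤-reflexive (*-identityˡ _)) (≤-trans (*-monoʳ-≤ (suc n) (fact-bound n))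
    (≤-reflexive (trans (sym (*-assoc (suc n) 3 (n !)))
      (trans (cong (_* n !) (*-comm (suc n) 3)) (*-assoc 3 (suc n) (n !))))))

eSeq-down : ∀ n → eSeq (suc n) ℚ.+ + 3 / suc (suc n) ℚ.≤ eSeq n ℚ.+ + 3 / suc n
eSeq-down n = ℚ.≤-trans (ℚ.≤-reflexive (ℚ.+-assoc (eSeq n) _ (+ 3 / suc (suc n))))
  (ℚ.+-monoʳ-≤ (eSeq n) (e-step n))

e : ℝ
e = mkℝ eSeq (squeeze eSeq 3 eSeq-up eSeq-down)

-- With N = n + 1, this is the right-endpoint Riemann sum of mesh 1/N for
-- ∫₁ᵐ dx/x: its terms are (1/N) · 1/(1 + i/N) = 1/(N + i), 1 ≤ i ≤ (m - 1)N.
logSeq : ℕ → ℕ → ℚᵘ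
logSeq m n = sum (λ i → + 1 / (suc n + suc i)) ((m ∸ 1) * suc n)

harm : ℕ → ℚᵘ
harm j = + 1 / suc j

sum-cong : ∀ {f g} → (∀ i → f i ≡ g i) → ∀ n → sum f n ≡ sum g n
sum-cong f≡g zero    = refl
sum-cong f≡g (suc n) = cong₂ ℚ._+_ (sum-cong f≡g n) (f≡g n)

sum-+ : ∀ f a b → sum f (a + b) ℚ.≃ sum f a ℚ.+ sum (λ i → f (a + i)) b
sum-+ f a zero rewrite +-identityʳ a = ℚ.≃-sym (ℚ.+-identityʳ (sum f a))
sum-+ f a (suc b) rewrite +-suc a b =
  ℚ.≃-trans (ℚ.+-congˡ (f (a + b)) (sum-+ f a b)) (ℚ.+-assoc (sum f a) _ _)

sum-≤ : ∀ f d .{{_ : NonZero d}} n → (∀ i → i < n → f i ℚ.≤ + 1 / d) → sum f n ℚ.≤ + n / d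
sum-≤ f d zero    f≤ = 0≤/ 0 d
sum-≤ f d (suc n) f≤ = begin
  sum f n ℚ.+ f n         ≤⟨ ℚ.+-mono-≤ (sum-≤ f d n (λ i i<n → f≤ i (m<n⇒m<1+n i<n))) (f≤ n ≤-refl) ⟩
  + n / d ℚ.+ + 1 / d     ≃⟨ /-+ n 1 d ⟩
  + (n + 1) / d           ≡⟨ cong (λ k → + k / d) (+-comm n 1) ⟩
  + suc n / d             ∎
  where open ℚ.≤-Reasoning

sum-≥ : ∀ f d .{{_ : NonZero d}} n → (∀ i → i < n → + 1 / d ℚ.≤ f i) → + n / d ℚ.≤ sum f n
sum-≥ f (suc d) zero ≤f = /-≤ 0 (suc d) 0 1 z≤n
sum-≥ f d (suc n) ≤f = begin
  + suc n / d             ≡⟨ cong (λ k → + k / d) (+-comm n 1) ⟨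
  + (n + 1) / d           ≃⟨ /-+ n 1 d ⟨
  + n / d ℚ.+ + 1 / d     ≤⟨ ℚ.+-mono-≤ (sum-≥ f d n (λ i i<n → ≤f i (m<n⇒m<1+n i<n))) (≤f n ≤-refl) ⟩
  sum f n ℚ.+ f n         ∎
  where open ℚ.≤-Reasoning

+-cancelˡ-≤ᵘ : ∀ r {p q} → r ℚ.+ p ℚ.≤ r ℚ.+ q → p ℚ.≤ q
+-cancelˡ-≤ᵘ r le = ℚ.≮⇒≥ (λ q<p → ℚ.<⇒≱ (ℚ.+-monoʳ-< r q<p) le)

module _ (q : ℕ) where
  private
    L : ℕ → ℚᵘ
    L = logSeq (suc q)

    block : ℕ → ℚᵘ
    block N = sum (λ i → harm (suc q * N + i)) (suc q)

  L-harm : ∀ n → sum harm (suc n) ℚ.+ L n ℚ.≃ sum harm (suc q * suc n)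
  L-harm n = ℚ.≃-trans
    (ℚ.+-congʳ (sum harm (suc n)) (ℚ.≃-reflexive
      (sum-cong (λ i → cong harm (+-suc n i)) (q * suc n))))
    (ℚ.≃-sym (sum-+ harm (suc n) (q * suc n)))

  L-step : ∀ n → harm (suc n) ℚ.+ L (suc n) ℚ.≃ L n ℚ.+ block (suc n)
  L-step n = ℚ.+-cancelˡ {H} (begin-equality
    H ℚ.+ (harm (suc n) ℚ.+ L (suc n))          ≃⟨ ℚ.+-assoc H (harm (suc n)) (L (suc n)) ⟨
    sum harm (suc (suc n)) ℚ.+ L (suc n)        ≃⟨ L-harm (suc n) ⟩
    sum harm (suc q * suc (suc n))              ≡⟨ cong (sum harm) (trans (*-suc (suc q) (suc n)) (+-comm (suc q) _)) ⟩
    sum harm (suc q * suc n + suc q)            ≃⟨ sum-+ harm (suc q * suc n) (suc q) ⟩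
    sum harm (suc q * suc n) ℚ.+ block (suc n)  ≃⟨ ℚ.+-congˡ (block (suc n)) (L-harm n) ⟨
    H ℚ.+ L n ℚ.+ block (suc n)                 ≃⟨ ℚ.+-assoc H (L n) (block (suc n)) ⟩
    H ℚ.+ (L n ℚ.+ block (suc n))               ∎)
    where
    open ℚ.≤-Reasoning
    H = sum harm (suc n)

  block-≤ : ∀ n → block (suc n) ℚ.≤ + 1 / suc n
  block-≤ n = ℚ.≤-trans
    (sum-≤ _ (suc q * suc n) (suc q) (λ i _ → /-≤ 1 (suc (suc q * suc n + i)) 1 (suc q * suc n)
      (*-monoʳ-≤ 1 (≤-trans (m≤m+n _ i) (n≤1+n _)))))
    (/-≤ (suc q) (suc q * suc n) 1 (suc n) (≤-reflexive (sym (*-identityˡ _))))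

  block-≥ : ∀ n → harm (suc n) ℚ.≤ block (suc n)
  block-≥ n = ℚ.≤-trans
    (/-≤ 1 (suc (suc n)) (suc q) (suc q * suc (suc n)) (≤-reflexive (*-identityˡ _)))
    (sum-≥ _ (suc q * suc (suc n)) (suc q) (λ i i≤q → /-≤ 1 (suc q * suc (suc n)) 1 (suc (suc q * suc n + i))
      (*-monoʳ-≤ 1 (begin
        suc (suc q * suc n + i)     ≡⟨ +-suc (suc q * suc n) i ⟨
        suc q * suc n + suc i       ≤⟨ +-monoʳ-≤ (suc q * suc n) i≤q ⟩
        suc q * suc n + suc q       ≡⟨ trans (+-comm _ (suc q)) (sym (*-suc (suc q) (suc n))) ⟩
        suc q * suc (suc n)         ∎))))
    where open ≤-Reasoning

  L-up : ∀ n → L n ℚ.≤ L (suc n)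
  L-up n = +-cancelˡ-≤ᵘ (harm (suc n)) (begin
    harm (suc n) ℚ.+ L n         ≤⟨ ℚ.+-monoˡ-≤ (L n) (block-≥ n) ⟩
    block (suc n) ℚ.+ L n        ≃⟨ ℚ.+-comm (block (suc n)) (L n) ⟩
    L n ℚ.+ block (suc n)        ≃⟨ L-step n ⟨
    harm (suc n) ℚ.+ L (suc n)   ∎)
    where open ℚ.≤-Reasoning

  L-down : ∀ n → L (suc n) ℚ.+ + 1 / suc (suc n) ℚ.≤ L n ℚ.+ + 1 / suc n
  L-down n = begin
    L (suc n) ℚ.+ harm (suc n)   ≃⟨ ℚ.+-comm (L (suc n)) (harm (suc n)) ⟩
    harm (suc n) ℚ.+ L (suc n)   ≃⟨ L-step n ⟩
    L n ℚ.+ block (suc n)        ≤⟨ ℚ.+-monoʳ-≤ (L n) (block-≤ n) ⟩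
    L n ℚ.+ + 1 / suc n          ∎
    where open ℚ.≤-Reasoning

logSeq-cauchy : ∀ m .{{_ : NonZero m}} → Cauchy (logSeq m)
logSeq-cauchy (suc q) = squeeze (logSeq (suc q)) 1 (L-up q) (L-down q)

log : (m : ℕ) .{{_ : NonZero m}} → ℝ
log m = mkℝ (logSeq m) (logSeq-cauchy m)

------------------------------------------------------------------------
-- Heights.  ℤ/pℤ is Fin p.

module _ {p : ℕ} .{{_ : NonZero p}} where

  ⟨_,1⟩ : ∀ {n} → Vec (Fin p) n → Vec (Fin p) (suc n)
  ⟨ t ,1⟩ = t ∷ʳ (1 mod p)

  maxResidue : ∀ {n} → Vec (Fin p) n → ℕ → ℕ
  maxResidue t a = Extrema.max a (toList (Vec.map (λ x → (a * toℕ x) % p) t))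

  -- The height h_p of ⟨ t ,1⟩, a minimum over 0 < a < p.  For such a every
  -- value is smaller than p, so the initial value p is not attained if p > 1.
  height : ∀ {n} → Vec (Fin p) n → ℕ
  height t = Extrema.min p (List.map (maxResidue t) (List.map suc (List.upTo (p ∸ 1))))

  infixl 7 _⊙_
  _⊙_ : ∀ {n} → Vec (Fin p) n → Vec (Fin p) n → ℕ
  α ⊙ t = Vec.sum (Vec.zipWith (λ x y → toℕ x * toℕ y) α t)

  IsZero : ∀ {n} → Vec (Fin p) n → Set
  IsZero = All (λ x → toℕ x ≡ 0)

  ∥_∥ : Fin p → ℕ
  ∥ x ∥ = toℕ x ⊓ (p ∸ toℕ x)

  -- ∥ x ∥ is the least absolute value of an integer representing x.
  ∥∥-attained : ∀ x → ∃[ k ] ℤ.∣ + toℕ x ℤ.+ k ℤ.* + p ∣ ≡ ∥ x ∥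
  ∥∥-attained x with ≤-total (toℕ x) (p ∸ toℕ x)
  ... | inj₁ le = + 0 , trans (cong ℤ.∣_∣ (ℤ.+-identityʳ (+ toℕ x))) (sym (m≤n⇒m⊓n≡m le))
  ... | inj₂ ge = ℤ.-1ℤ , (begin
    ℤ.∣ + toℕ x ℤ.+ ℤ.-1ℤ ℤ.* + p ∣   ≡⟨ cong (λ z → ℤ.∣ + toℕ x ℤ.+ z ∣) (ℤ.-1*i≡-i (+ p)) ⟩
    ℤ.∣ + toℕ x ℤ.- + p ∣             ≡⟨ cong ℤ.∣_∣ (ℤ.m-n≡m⊖n (toℕ x) p) ⟩
    ℤ.∣ toℕ x ℤ.⊖ p ∣                 ≡⟨ ℤ.∣⊖∣-≤ (<⇒≤ (toℕ<n x)) ⟩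
    p ∸ toℕ x                         ≡⟨ m≥n⇒m⊓n≡n ge ⟨
    ∥ x ∥                             ∎)
    where open ≡-Reasoning

  ∥∥-least : ∀ x k → ∥ x ∥ ≤ ℤ.∣ + toℕ x ℤ.+ k ℤ.* + p ∣
  ∥∥-least x (+ k) = begin
    ∥ x ∥                             ≤⟨ m⊓n≤m (toℕ x) (p ∸ toℕ x) ⟩
    toℕ x                             ≤⟨ m≤m+n (toℕ x) (k * p) ⟩
    ℤ.∣ + toℕ x ℤ.+ + (k * p) ∣       ≡⟨ cong (λ z → ℤ.∣ + toℕ x ℤ.+ z ∣) (ℤ.pos-* k p) ⟩
    ℤ.∣ + toℕ x ℤ.+ + k ℤ.* + p ∣     ∎
    where open ≤-Reasoning
  ∥∥-least x -[1+ k ] = begin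
    ∥ x ∥                             ≤⟨ m⊓n≤n (toℕ x) (p ∸ toℕ x) ⟩
    p ∸ toℕ x                         ≤⟨ ∸-monoˡ-≤ (toℕ x) (m≤m+n p (k * p)) ⟩
    suc k * p ∸ toℕ x                 ≡⟨ ℤ.∣⊖∣-≤ (≤-trans (<⇒≤ (toℕ<n x)) (m≤m+n p (k * p))) ⟨
    ℤ.∣ toℕ x ℤ.⊖ suc k * p ∣         ≡⟨ cong ℤ.∣_∣ (ℤ.m-n≡m⊖n (toℕ x) (suc k * p)) ⟨
    ℤ.∣ + toℕ x ℤ.- + (suc k * p) ∣   ≡⟨ cong (λ z → ℤ.∣ + toℕ x ℤ.- z ∣) (ℤ.pos-* (suc k) p) ⟩
    ℤ.∣ + toℕ x ℤ.- + suc k ℤ.* + p ∣ ≡⟨ cong (λ z → ℤ.∣ + toℕ x ℤ.+ z ∣) (ℤ.neg-distribˡ-* (+ suc k) (+ p)) ⟩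
    ℤ.∣ + toℕ x ℤ.+ -[1+ k ] ℤ.* + p ∣ ∎
    where open ≤-Reasoning

  ∥_∥∞ : ∀ {n} → Vec (Fin p) n → ℕ
  ∥ α ∥∞ = Extrema.max 0 (toList (Vec.map ∥_∥ α))

  allVecs : ∀ n → List (Vec (Fin p) n)
  allVecs zero    = List.[ [] ]
  allVecs (suc n) = List.cartesianProductWith _∷_ (List.allFin p) (allVecs n)

  IsRelation : ∀ {n} → Vec (Fin p) n → Vec (Fin p) n → Set
  IsRelation t α = ¬ IsZero α × p ∣ α ⊙ t

  isRelation? : ∀ {n} (t α : Vec (Fin p) n) → Dec (IsRelation t α)
  isRelation? t α = ¬? (all? (λ x → toℕ x ≟ 0) α) ×-dec (p ∣? α ⊙ t)

  -- The dual height h_p* of t.  Every ∥ x ∥ is smaller than p, so the initial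
  -- value p of the minimum is not attained if t admits a nonzero relation;
  -- any t of length at least two does.
  dualHeight : ∀ {n} → Vec (Fin p) n → ℕ
  dualHeight {n} t = Extrema.min p (List.map ∥_∥∞ (List.filter (isRelation? t) (allVecs n)))

  ∥∥-pos : ∀ x → toℕ x ≢ 0 → 0 < ∥ x ∥
  ∥∥-pos x x≢0 = ⊓-glb (n≢0⇒n>0 x≢0) (m<n⇒0<n∸m (toℕ<n x))

  ∥∥∞-pos : ∀ {n} (α : Vec (Fin p) n) → ¬ IsZero α → 0 < ∥ α ∥∞
  ∥∥∞-pos α α≢0 with ∥ α ∥∞ in eq
  ... | suc _ = s≤s z≤n
  ... | zero  = ⊥-elim (α≢0 (go α (subst (λ m → ListAll.All (_≤ m) (toList (Vec.map ∥_∥ α))) eq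
                  (Extrema.xs≤max 0 _))))
    where
    go : ∀ {n} (β : Vec (Fin p) n) → ListAll.All (_≤ 0) (toList (Vec.map ∥_∥ β)) → IsZero β
    go []      _                 = []
    go (x ∷ β) (le ListAll.∷ les) with toℕ x ≟ 0
    ... | yes x≡0 = x≡0 ∷ go β les
    ... | no  x≢0 = ⊥-elim (<⇒≱ (∥∥-pos x x≢0) le)

  dualHeight-nonZero : ∀ {n} (t : Vec (Fin p) n) → NonZero (dualHeight t)
  dualHeight-nonZero {n} t = >-nonZero (Extrema.v<min⁺ (>-nonZero⁻¹ p)
    (ListAll.map⁺ (ListAll.map (λ {α} rel → ∥∥∞-pos α (proj₁ rel))
      (ListAll.all-filter (isRelation? t) (allVecs n)))))

  2*dualHeight-nonZero : ∀ {n} (t : Vec (Fin p) n) → NonZero (2 * dualHeight t)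
  2*dualHeight-nonZero t = m*n≢0 2 (dualHeight t) {{_}} {{dualHeight-nonZero t}}

{-# OPTIONS --safe #-}
module Submission where

-- Count, with multiplicity, the vectors x ≡ a ⟨ t ,1⟩ (mod p) that are sums of
-- k n elements of {0, …, M}ᵈ, where d = n + 1.  By Poisson summation pⁿ times
-- this number is the sum over all relations α of the products of the
-- D(αᵢ)ᵏⁿ, where D(α) = Σ_{j ≤ M} exp(2πi α j / p).  With X = (M + 1)ᵏⁿ the
-- zero relation contributes Xᵈ.  Any other one has a coordinate with
-- |αᵢ| ≥ h*, for which |D(αᵢ)| ≤ 1 / |sin(π αᵢ / p)| ≤ p / 2h*, so it
-- contributes at most Xⁿ (p / 2h*)ᵏⁿ, and this is at most Xᵈ / pⁿ as soon as
-- (2h* (M + 1) / p)ᵏ ≥ p.  There are pⁿ - 1 of these, so the number is at least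
-- Xᵈ / p²ⁿ, which exceeds the contribution 1 of the origin.  Hence some
-- 0 < a ≤ k n M has all its residues bounded by k n M.
-- For k = ⌈log p⌉ the least such M satisfies (2h* M / p)ᵏ < p ≤ eᵏ, thus
-- M < e p / 2h*; the second bound comes from k = ⌈log₂ p⌉ and M = ⌊p / h*⌋.
--
-- To stay within the rationals, exp(iπ / p) is replaced by a Gaussian rational
-- v of modulus one with vᵖ very close to -1, a power of a tiny rotation.

-- Because `v ^ p` is not exactly -1, characters are neither periodic nor orthogonal: a full sum
-- over a nontrivial character is small instead of zero, and dropping a multiple of `p` from an
-- index costs an error proportional to that multiple. All errors are charged to `∣ s p ∣ ≤ 1 / D`,
-- where `D` is fixed from the sizes of the whole counting problem before `v` is built; the count
-- then loses only the replacement of `pⁿ` by `(p + 1)ⁿ + 1`. The sine bound has to survive these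
-- errors with its sharp constant 2, which is where the factor 1 / 2 beside e comes from. It does
-- because for odd `p = 2 q + 1` a distance to a multiple of `p` is at most `q < p / 2`, where the
-- inequality is strict. The prime 2 is treated apart. In the same way e and log enter only through
-- their rational approximants: `p ≤ eᵏ` becomes a comparison of harmonic products, powers of
-- `1 + 1 / T` and partial sums of e, with all denominators cleared.

module CharacterSums where

  open import Algebra.Bundles using (CommutativeRing)
  open import Algebra.Structures using (IsCommutativeRing)
  open import Data.Fin.Base as Fin using (Fin; toℕ)
  import Data.Fin.Properties as Fin
  import Data.Integer.Base as ℤ
  open import Data.Nat.Base as ℕ using (ℕ; zero; suc; s≤s; z≤n; _≤′_; ≤′-refl; ≤′-step)
  open import Data.Nat.DivMod as ℕ using (_/_; _%_; m≡m%n+[m/n]*n; m%n<n; m/n*n≤m)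
  import Data.Nat.Properties as ℕ
  open import Data.Product.Base using (_×_; _,_; ∃-syntax)
  open import Data.Rational.Base as ℚ′ using (ℚ; 0ℚ; 1ℚ; _+_; _*_; -_; _-_; _≤_; _<_; nonNegative; positive; ∣_∣; 1/_)
  import Data.Rational.Properties as ℚ
  open import Data.Sum.Base using (_⊎_; inj₁; inj₂)
  open import Data.Vec.Base as Vec using (Vec; []; _∷_)
  open import Data.Vec.Relation.Unary.All using (All; []; _∷_)
  open import Data.Vec.Relation.Unary.Any as Any using (Any; here; there)
  open import Level using (0ℓ)
  open import Relation.Binary.PropositionalEquality
  open import Relation.Nullary.Decidable using (dec⇒maybe; yes; no)
  open import Relation.Nullary.Negation using (¬_; contradiction)
  open import Relation.Unary using (Decidable)
  open import Tactic.RingSolver using (solve-∀)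
  open import Tactic.RingSolver.Core.AlmostCommutativeRing using (AlmostCommutativeRing; fromCommutativeRing)

  -- Ordered arithmetic in ℚ and the embedding of ℕ

  ℚ-ring : AlmostCommutativeRing 0ℓ 0ℓ
  ℚ-ring = fromCommutativeRing ℚ.+-*-commutativeRing (λ x → dec⇒maybe (0ℚ ℚ.≟ x))

  0≤-+ : ∀ {x y} → 0ℚ ≤ x → 0ℚ ≤ y → 0ℚ ≤ x + y
  0≤-+ = ℚ.+-mono-≤

  0≤-* : ∀ {x y} → 0ℚ ≤ x → 0ℚ ≤ y → 0ℚ ≤ x * y
  0≤-* {x} {y} 0≤x 0≤y = subst (_≤ x * y) (ℚ.*-zeroʳ x) (ℚ.*-monoˡ-≤-nonNeg x {{nonNegative 0≤x}} 0≤y)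

  0<-* : ∀ {x y} → 0ℚ < x → 0ℚ < y → 0ℚ < x * y
  0<-* {x} {y} 0<x 0<y = subst (_< x * y) (ℚ.*-zeroʳ x) (ℚ.*-monoʳ-<-pos x {{positive 0<x}} 0<y)

  -- Most inequalities below are shown by writing the difference of the two
  -- sides as a combination of nonnegative terms.
  ≤-by : ∀ {x y} z → 0ℚ ≤ z → x + z ≡ y → x ≤ y
  ≤-by {x} z 0≤z eq = subst₂ _≤_ (ℚ.+-identityʳ x) eq (ℚ.+-monoʳ-≤ x 0≤z)

  gap : ∀ {x y} → x ≤ y → 0ℚ ≤ y - x
  gap {x} {y} x≤y = subst (_≤ y - x) (ℚ.+-inverseʳ x) (ℚ.+-monoˡ-≤ (- x) x≤y)

  0≤-² : ∀ x → 0ℚ ≤ x * x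
  0≤-² x with ℚ.≤-total 0ℚ x
  ... | inj₁ 0≤x = 0≤-* 0≤x 0≤x
  ... | inj₂ x≤0 = subst (0ℚ ≤_) (eq x) (0≤-* (gap x≤0) (gap x≤0))
    where
    eq : ∀ x → (0ℚ - x) * (0ℚ - x) ≡ x * x
    eq = solve-∀ ℚ-ring

  *-monoʳ : ∀ {x y} z → 0ℚ ≤ z → x ≤ y → z * x ≤ z * y
  *-monoʳ z 0≤z = ℚ.*-monoˡ-≤-nonNeg z {{nonNegative 0≤z}}

  *-monoˡ : ∀ {x y} z → 0ℚ ≤ z → x ≤ y → x * z ≤ y * z
  *-monoˡ z 0≤z = ℚ.*-monoʳ-≤-nonNeg z {{nonNegative 0≤z}}

  *-cancelˡ : ∀ z {x y} → 0ℚ < z → z * x ≤ z * y → x ≤ y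
  *-cancelˡ z 0<z = ℚ.*-cancelˡ-≤-pos z {{positive 0<z}}

  *-mono : ∀ {x y z w} → 0ℚ ≤ z → 0ℚ ≤ y → x ≤ y → z ≤ w → x * z ≤ y * w
  *-mono {x} {y} {z} 0≤z 0≤y x≤y z≤w = ℚ.≤-trans (*-monoˡ z 0≤z x≤y) (*-monoʳ y 0≤y z≤w)

  <⇒≱ : ∀ {x y} → x < y → ¬ (y ≤ x)
  <⇒≱ x<y y≤x = ℚ.<-irrefl refl (ℚ.<-≤-trans x<y y≤x)

  ²-mono-< : ∀ {x y} → 0ℚ ≤ x → x < y → x * x < y * y
  ²-mono-< {x} {y} 0≤x x<y = ℚ.≤-<-trans (*-monoʳ x 0≤x (ℚ.<⇒≤ x<y))
    (ℚ.*-monoˡ-<-pos y {{positive (ℚ.≤-<-trans 0≤x x<y)}} x<y)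

  ²-cancel-≤ : ∀ {x y} → 0ℚ ≤ y → x * x ≤ y * y → x ≤ y
  ²-cancel-≤ 0≤y le = ℚ.≮⇒≥ λ y<x → <⇒≱ (²-mono-< 0≤y y<x) le

  ι : ℕ → ℚ
  ι zero    = 0ℚ
  ι (suc n) = 1ℚ + ι n

  0≤ι : ∀ n → 0ℚ ≤ ι n
  0<1 : 0ℚ < 1ℚ
  0<1 = ℚ.positive⁻¹ 1ℚ

  0≤ι zero    = ℚ.≤-refl
  0≤ι (suc n) = 0≤-+ (ℚ.<⇒≤ 0<1) (0≤ι n)

  0<ι : ∀ n .{{_ : ℕ.NonZero n}} → 0ℚ < ι n
  0<ι (suc n) = ℚ.+-mono-<-≤ 0<1 (0≤ι n)

  ι-+ : ∀ m n → ι (m ℕ.+ n) ≡ ι m + ι n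
  ι-+ zero    n = sym (ℚ.+-identityˡ (ι n))
  ι-+ (suc m) n = trans (cong (1ℚ +_) (ι-+ m n)) (sym (ℚ.+-assoc 1ℚ (ι m) (ι n)))

  ι-* : ∀ m n → ι (m ℕ.* n) ≡ ι m * ι n
  ι-* zero    n = sym (ℚ.*-zeroˡ (ι n))
  ι-* (suc m) n = trans (ι-+ n (m ℕ.* n)) (trans (cong (ι n +_) (ι-* m n)) (eq (ι m) (ι n)))
    where
    eq : ∀ x y → y + x * y ≡ (1ℚ + x) * y
    eq = solve-∀ ℚ-ring

  ι-mono : ∀ {m n} → m ℕ.≤ n → ι m ≤ ι n
  ι-mono {n = n} z≤n = 0≤ι n
  ι-mono (s≤s m≤n)   = ℚ.+-monoʳ-≤ 1ℚ (ι-mono m≤n)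

  ι-mono-< : ∀ {m n} → m ℕ.< n → ι m < ι n
  ι-mono-< {m} {n} m<n = ℚ.<-≤-trans
    (subst (_< 1ℚ + ι m) (ℚ.+-identityˡ (ι m)) (ℚ.+-monoˡ-< (ι m) 0<1)) (ι-mono m<n)

  ι-cancel : ∀ {m n} → ι m ≤ ι n → m ℕ.≤ n
  ι-cancel le = ℕ.≮⇒≥ λ n<m → <⇒≱ (ι-mono-< n<m) le

  leastBelow : ∀ {P : ℕ → Set} → Decidable P → ∀ n →
               (∃[ m ] P m × (∀ k → k ℕ.< m → ¬ P k)) ⊎ (∀ k → k ℕ.< n → ¬ P k)
  leastBelow P? zero    = inj₂ λ _ ()
  leastBelow P? (suc n) with leastBelow P? n
  ... | inj₁ found = inj₁ found
  ... | inj₂ none with P? n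
  ...   | yes Pn = inj₁ (n , Pn , none)
  ...   | no ¬Pn = inj₂ λ k k<1+n Pk → case-≤ k (ℕ.m≤n⇒m<n∨m≡n (ℕ.≤-pred k<1+n)) Pk
    where
    case-≤ : ∀ k → k ℕ.< n ⊎ k ≡ n → ¬ _
    case-≤ k (inj₁ k<n)  = none k k<n
    case-≤ k (inj₂ refl) = ¬Pn

  -- Concave sequences

  module _ (f : ℕ → ℚ) (q : ℕ) (0≤f0 : 0ℚ ≤ f 0)
           (concave : ∀ j → suc j ℕ.< q → f (suc (suc j)) + f j ≤ ι 2 * f (suc j)) where

    private
      step : ∀ j → j ℕ.< q → ι j * f (suc j) ≤ ι (suc j) * f j
      step zero    _   = ≤-by (f 0) 0≤f0 (eq (f 0) (f 1))
        where
        eq : ∀ x y → 0ℚ * y + x ≡ (1ℚ + 0ℚ) * x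
        eq = solve-∀ ℚ-ring
      step (suc j) j<q = ≤-by _
        (0≤-+ (0≤-* (0≤ι (suc j)) (gap (concave j j<q))) (gap (step j (ℕ.<-trans (ℕ.n<1+n j) j<q))))
        (eq (ι j) (f j) (f (suc j)) (f (suc (suc j))))
        where
        eq : ∀ i x y z → (1ℚ + i) * z + ((1ℚ + i) * (ι 2 * y - (z + x)) + ((1ℚ + i) * x - i * y)) ≡ (1ℚ + (1ℚ + i)) * y
        eq = solve-∀ ℚ-ring

      chain : ∀ {r k} → r ≤′ k → k ℕ.≤ q → ι r * f k ≤ ι k * f r
      chain ≤′-refl _ = ℚ.≤-refl
      chain {r} {suc zero}    (≤′-step r≤k) k<q with refl ← ℕ.n≤0⇒n≡0 (ℕ.≤′⇒≤ r≤k) = step 0 k<q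
      chain {r} {suc (suc k)} (≤′-step r≤k) k<q = *-cancelˡ (ι (suc k)) (0<ι (suc k)) (≤-by _
        (0≤-+ (0≤-* (0≤ι r) (gap (step (suc k) k<q))) (0≤-* (0≤ι (2 ℕ.+ k)) (gap (chain r≤k (ℕ.<⇒≤ k<q)))))
        (eq (ι (suc k)) (ι r) (f r) (f (suc k)) (f (suc (suc k)))))
        where
        eq : ∀ k r x y z → k * (r * z) + (r * ((1ℚ + k) * y - k * z) + (1ℚ + k) * (k * x - r * y)) ≡ k * ((1ℚ + k) * x)
        eq = solve-∀ ℚ-ring

    -- Concavity and `f 0 ≥ 0` make `f j / j` nonincreasing. For `f = s` this replaces Jordan's
    -- inequality for the sine; for `f j = c j - 1` it yields `chord-bound`.
    concave⇒slope-decreasing : ∀ r → r ℕ.≤ q → ι r * f q ≤ ι q * f r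
    concave⇒slope-decreasing r r≤q = chain (ℕ.≤⇒≤′ r≤q) ℕ.≤-refl

  -- Gaussian rationals

  infix 8 _+i_
  record ℂ : Set where
    constructor _+i_
    field
      re im : ℚ
  open ℂ

  infixl 6 _⊕_
  infixl 7 _⊗_
  _⊕_ _⊗_ : ℂ → ℂ → ℂ
  (a +i b) ⊕ (c +i d) = (a + c) +i (b + d)
  (a +i b) ⊗ (c +i d) = (a * c - b * d) +i (a * d + b * c)

  neg : ℂ → ℂ
  neg (a +i b) = (- a) +i (- b)

  0ℂ 1ℂ : ℂ
  0ℂ = 0ℚ +i 0ℚ
  1ℂ = 1ℚ +i 0ℚ

  ℂ-isCommutativeRing : IsCommutativeRing _≡_ _⊕_ _⊗_ neg 0ℂ 1ℂ
  ℂ-isCommutativeRing = record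
    { isRing = record
      { +-isAbelianGroup = record
        { isGroup = record
          { isMonoid = record
            { isSemigroup = record
              { isMagma = record { isEquivalence = isEquivalence ; ∙-cong = cong₂ _⊕_ }
              ; assoc = λ x y z → cong₂ _+i_ (ℚ.+-assoc (re x) (re y) (re z)) (ℚ.+-assoc (im x) (im y) (im z))
              }
            ; identity = (λ x → cong₂ _+i_ (ℚ.+-identityˡ (re x)) (ℚ.+-identityˡ (im x)))
                       , (λ x → cong₂ _+i_ (ℚ.+-identityʳ (re x)) (ℚ.+-identityʳ (im x)))
            }
          ; inverse = (λ x → cong₂ _+i_ (ℚ.+-inverseˡ (re x)) (ℚ.+-inverseˡ (im x)))
                    , (λ x → cong₂ _+i_ (ℚ.+-inverseʳ (re x)) (ℚ.+-inverseʳ (im x)))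
          ; ⁻¹-cong = cong neg
          }
        ; comm = λ x y → cong₂ _+i_ (ℚ.+-comm (re x) (re y)) (ℚ.+-comm (im x) (im y))
        }
      ; *-cong = cong₂ _⊗_
      ; *-assoc = λ x y z → cong₂ _+i_
          (assoc-re (re x) (im x) (re y) (im y) (re z) (im z)) (assoc-im (re x) (im x) (re y) (im y) (re z) (im z))
      ; *-identity = (λ x → cong₂ _+i_ (idˡ-re (re x) (im x)) (idˡ-im (re x) (im x)))
                   , (λ x → cong₂ _+i_ (idʳ-re (re x) (im x)) (idʳ-im (re x) (im x)))
      ; distrib = (λ x y z → cong₂ _+i_
                    (distˡ-re (re x) (im x) (re y) (im y) (re z) (im z)) (distˡ-im (re x) (im x) (re y) (im y) (re z) (im z)))
                , (λ x y z → cong₂ _+i_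
                    (distʳ-re (re x) (im x) (re y) (im y) (re z) (im z)) (distʳ-im (re x) (im x) (re y) (im y) (re z) (im z)))
      }
    ; *-comm = λ x y → cong₂ _+i_ (comm-re (re x) (im x) (re y) (im y)) (comm-im (re x) (im x) (re y) (im y))
    }
    where
    assoc-re : ∀ a b c d e f → (a * c - b * d) * e - (a * d + b * c) * f ≡ a * (c * e - d * f) - b * (c * f + d * e)
    assoc-re = solve-∀ ℚ-ring
    assoc-im : ∀ a b c d e f → (a * c - b * d) * f + (a * d + b * c) * e ≡ a * (c * f + d * e) + b * (c * e - d * f)
    assoc-im = solve-∀ ℚ-ring
    idˡ-re : ∀ a b → 1ℚ * a - 0ℚ * b ≡ a
    idˡ-re = solve-∀ ℚ-ring
    idˡ-im : ∀ a b → 1ℚ * b + 0ℚ * a ≡ b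
    idˡ-im = solve-∀ ℚ-ring
    idʳ-re : ∀ a b → a * 1ℚ - b * 0ℚ ≡ a
    idʳ-re = solve-∀ ℚ-ring
    idʳ-im : ∀ a b → a * 0ℚ + b * 1ℚ ≡ b
    idʳ-im = solve-∀ ℚ-ring
    distˡ-re : ∀ a b c d e f → a * (c + e) - b * (d + f) ≡ (a * c - b * d) + (a * e - b * f)
    distˡ-re = solve-∀ ℚ-ring
    distˡ-im : ∀ a b c d e f → a * (d + f) + b * (c + e) ≡ (a * d + b * c) + (a * f + b * e)
    distˡ-im = solve-∀ ℚ-ring
    distʳ-re : ∀ a b c d e f → (c + e) * a - (d + f) * b ≡ (c * a - d * b) + (e * a - f * b)
    distʳ-re = solve-∀ ℚ-ring
    distʳ-im : ∀ a b c d e f → (c + e) * b + (d + f) * a ≡ (c * b + d * a) + (e * b + f * a)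
    distʳ-im = solve-∀ ℚ-ring
    comm-re : ∀ a b c d → a * c - b * d ≡ c * a - d * b
    comm-re = solve-∀ ℚ-ring
    comm-im : ∀ a b c d → a * d + b * c ≡ c * b + d * a
    comm-im = solve-∀ ℚ-ring

  ℂ-ring : CommutativeRing 0ℓ 0ℓ
  ℂ-ring = record { isCommutativeRing = ℂ-isCommutativeRing }

  open import Algebra.Properties.Semiring.Exp (CommutativeRing.semiring ℂ-ring) using (_^_; ^-homo-*; ^-assocʳ)

  nsq : ℂ → ℚ
  nsq w = re w * re w + im w * im w

  nsq-* : ∀ w z → nsq (w ⊗ z) ≡ nsq w * nsq z
  nsq-* w z = eq (re w) (im w) (re z) (im z)
    where
    eq : ∀ a b c d → (a * c - b * d) * (a * c - b * d) + (a * d + b * c) * (a * d + b * c) ≡ (a * a + b * b) * (c * c + d * d)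
    eq = solve-∀ ℚ-ring

  nsq-^ : ∀ w → nsq w ≡ 1ℚ → ∀ n → nsq (w ^ n) ≡ 1ℚ
  nsq-^ w eq zero    = refl
  nsq-^ w eq (suc n) = trans (nsq-* w (w ^ n)) (trans (cong₂ _*_ eq (nsq-^ w eq n)) (ℚ.*-identityˡ 1ℚ))

  -- Rational rotations

  module Powers (w : ℂ) (unit : nsq w ≡ 1ℚ) where

    c s : ℕ → ℚ
    c j = re (w ^ j)
    s j = im (w ^ j)

    c²+s²≡1 : ∀ j → c j * c j + s j * s j ≡ 1ℚ
    c²+s²≡1 = nsq-^ w unit

    c-+ : ∀ i j → c (i ℕ.+ j) ≡ c i * c j - s i * s j
    c-+ i j = cong re (^-homo-* w i j)

    s-+ : ∀ i j → s (i ℕ.+ j) ≡ c i * s j + s i * c j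
    s-+ i j = cong im (^-homo-* w i j)

    -- s i is the sine of the difference of the angles of w ^ (i + j) and w ^ j.
    s-back : ∀ i j → s i ≡ s (i ℕ.+ j) * c j - c (i ℕ.+ j) * s j
    s-back i j = sym (begin
      s (i ℕ.+ j) * c j - c (i ℕ.+ j) * s j
        ≡⟨ cong₂ (λ x y → x * c j - y * s j) (s-+ i j) (c-+ i j) ⟩
      (c i * s j + s i * c j) * c j - (c i * c j - s i * s j) * s j
        ≡⟨ eq (c i) (s i) (c j) (s j) ⟩
      s i * (c j * c j + s j * s j)
        ≡⟨ cong (s i *_) (c²+s²≡1 j) ⟩
      s i * 1ℚ
        ≡⟨ ℚ.*-identityʳ (s i) ⟩
      s i ∎)
      where
      open ≡-Reasoning
      eq : ∀ a b c d → (a * d + b * c) * c - (a * c - b * d) * d ≡ b * (c * c + d * d)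
      eq = solve-∀ ℚ-ring

    c≤1 : ∀ j → c j ≤ 1ℚ
    c≤1 j = ²-cancel-≤ (ℚ.<⇒≤ 0<1) (≤-by (s j * s j) (0≤-² (s j)) (c²+s²≡1 j))

    s≤1 : ∀ j → s j ≤ 1ℚ
    s≤1 j = ²-cancel-≤ (ℚ.<⇒≤ 0<1) (≤-by (c j * c j) (0≤-² (c j)) (trans (ℚ.+-comm _ (c j * c j)) (c²+s²≡1 j)))

    -1≤c : ∀ j → - 1ℚ ≤ c j
    -1≤c j = ≤-by _ (gap (²-cancel-≤ {x = - c j} (ℚ.<⇒≤ 0<1) (≤-by (s j * s j) (0≤-² (s j)) (trans (eq (c j) (s j)) (c²+s²≡1 j))))) (eq′ (c j))
      where
      eq : ∀ a b → - a * - a + b * b ≡ a * a + b * b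
      eq = solve-∀ ℚ-ring
      eq′ : ∀ a → - 1ℚ + (1ℚ - - a) ≡ a
      eq′ = solve-∀ ℚ-ring

    s-double : ∀ j → s (j ℕ.+ j) ≡ ι 2 * (s j * c j)
    s-double j = trans (s-+ j j) (eq (c j) (s j))
      where
      eq : ∀ a b → a * b + b * a ≡ ι 2 * (b * a)
      eq = solve-∀ ℚ-ring

    w^1 : w ^ 1 ≡ w
    w^1 = CommutativeRing.*-identityʳ ℂ-ring w

    re≤1 : re w ≤ 1ℚ
    re≤1 = subst (_≤ 1ℚ) (cong re w^1) (c≤1 1)

    -- `s (j + 2) + s j = 2 c 1 s (j + 1)`, and `c 1 ≤ 1`.
    s-concave : ∀ j → 0ℚ ≤ s (suc j) → s (suc (suc j)) + s j ≤ ι 2 * s (suc j)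
    s-concave j 0≤s = ≤-by _ (0≤-* (0≤-* (0≤ι 2) (gap (c≤1 1))) 0≤s) (begin
      s (2 ℕ.+ j) + s j + ι 2 * (1ℚ - c 1) * s (suc j)
        ≡⟨ cong₂ (λ x y → x + y + ι 2 * (1ℚ - c 1) * s (suc j)) (s-+ 1 (suc j))
             (trans (s-back j 1) (cong (λ k → s k * c 1 - c k * s 1) (ℕ.+-comm j 1))) ⟩
      c 1 * s (suc j) + s 1 * c (suc j) + (s (suc j) * c 1 - c (suc j) * s 1) + ι 2 * (1ℚ - c 1) * s (suc j)
        ≡⟨ eq (c 1) (s 1) (c (suc j)) (s (suc j)) ⟩
      ι 2 * s (suc j) ∎)
      where
      open ≡-Reasoning
      eq : ∀ a b c d → a * d + b * c + (d * a - c * b) + ι 2 * (1ℚ - a) * d ≡ ι 2 * d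
      eq = solve-∀ ℚ-ring

    c-back : ∀ i j → c i ≡ c (i ℕ.+ j) * c j + s (i ℕ.+ j) * s j
    c-back i j = sym (begin
      c (i ℕ.+ j) * c j + s (i ℕ.+ j) * s j
        ≡⟨ cong₂ (λ x y → y * c j + x * s j) (s-+ i j) (c-+ i j) ⟩
      (c i * c j - s i * s j) * c j + (c i * s j + s i * c j) * s j
        ≡⟨ eq (c i) (s i) (c j) (s j) ⟩
      c i * (c j * c j + s j * s j)
        ≡⟨ cong (c i *_) (c²+s²≡1 j) ⟩
      c i * 1ℚ
        ≡⟨ ℚ.*-identityʳ (c i) ⟩
      c i ∎)
      where
      open ≡-Reasoning
      eq : ∀ a b c d → (a * c - b * d) * c + (a * d + b * c) * d ≡ a * (c * c + d * d)
      eq = solve-∀ ℚ-ring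

    c-concave : ∀ j → 0ℚ ≤ c (suc j) → c (suc (suc j)) + c j ≤ ι 2 * c (suc j)
    c-concave j 0≤c = ≤-by _ (0≤-* (0≤-* (0≤ι 2) (gap (c≤1 1))) 0≤c) (begin
      c (2 ℕ.+ j) + c j + ι 2 * (1ℚ - c 1) * c (suc j)
        ≡⟨ cong₂ (λ x y → x + y + ι 2 * (1ℚ - c 1) * c (suc j)) (c-+ 1 (suc j))
             (trans (c-back j 1) (cong (λ k → c k * c 1 + s k * s 1) (ℕ.+-comm j 1))) ⟩
      c 1 * c (suc j) - s 1 * s (suc j) + (c (suc j) * c 1 + s (suc j) * s 1) + ι 2 * (1ℚ - c 1) * c (suc j)
        ≡⟨ eq (c 1) (s 1) (c (suc j)) (s (suc j)) ⟩
      ι 2 * c (suc j) ∎)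
      where
      open ≡-Reasoning
      eq : ∀ a b c d → a * c - b * d + (c * a + d * b) + ι 2 * (1ℚ - a) * c ≡ ι 2 * c
      eq = solve-∀ ℚ-ring

    -- No angles are available, so acuteness is read off from the doubled angle:
    -- `s (2 j) = 2 s j c j`.
    0<s2j⇒0<c : ∀ j → 0ℚ < s j → 0ℚ < s (j ℕ.+ j) → 0ℚ < c j
    0<s2j⇒0<c j 0<s 0<s2 = ℚ.≰⇒> λ c≤0 → <⇒≱ 0<s2 (≤-by _ (0≤-* (0≤-* (0≤ι 2) (ℚ.<⇒≤ 0<s)) (gap c≤0))
      (trans (cong (_+ ι 2 * s j * (0ℚ - c j)) (s-double j)) (eq (s j) (c j))))
      where
      eq : ∀ a b → ι 2 * (a * b) + ι 2 * a * (0ℚ - b) ≡ 0ℚ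
      eq = solve-∀ ℚ-ring

    -- The cosines decrease concavely as long as the angle is acute.
    chord-bound : ∀ q → (∀ j → 0 ℕ.< j → j ℕ.≤ q ℕ.+ q → 0ℚ < s j) → ι q * (1ℚ - c 1) ≤ 1ℚ
    chord-bound zero    0<s = ≤-by 1ℚ (ℚ.<⇒≤ 0<1) (eq (c 1))
      where
      eq : ∀ a → 0ℚ * (1ℚ - a) + 1ℚ ≡ 1ℚ
      eq = solve-∀ ℚ-ring
    chord-bound q@(suc _) 0<s = ≤-by _ (0≤-+ (gap slope) (ℚ.<⇒≤ (0<c q (s≤s z≤n) ℕ.≤-refl))) (eq (ι q) (c 1) (c q))
      where
      0<c : ∀ j → 0 ℕ.< j → j ℕ.≤ q → 0ℚ < c j
      0<c j 0<j j≤q = 0<s2j⇒0<c j (0<s j 0<j (ℕ.≤-trans j≤q (ℕ.m≤m+n q q)))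
        (0<s (j ℕ.+ j) (ℕ.≤-trans 0<j (ℕ.m≤m+n j j)) (ℕ.+-mono-≤ j≤q j≤q))
      slope : ι 1 * (c q - 1ℚ) ≤ ι q * (c 1 - 1ℚ)
      slope = concave⇒slope-decreasing (λ j → c j - 1ℚ) q (ℚ.≤-reflexive (sym (ℚ.+-inverseʳ 1ℚ)))
        (λ j j<q → ≤-by _ (gap (c-concave j (ℚ.<⇒≤ (0<c (suc j) (s≤s z≤n) (ℕ.<⇒≤ j<q)))))
          (eq₁ (c j) (c (suc j)) (c (suc (suc j))))) 1 (s≤s z≤n)
        where
        eq₁ : ∀ x y z → z - 1ℚ + (x - 1ℚ) + (ι 2 * y - (z + x)) ≡ ι 2 * (y - 1ℚ)
        eq₁ = solve-∀ ℚ-ring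
      eq : ∀ q c d → q * (1ℚ - c) + (q * (c - 1ℚ) - ι 1 * (d - 1ℚ) + d) ≡ 1ℚ
      eq = solve-∀ ℚ-ring

    ∣c∣≤1 : ∀ j → ∣ c j ∣ ≤ 1ℚ
    ∣c∣≤1 j with ℚ.∣p∣≡p∨∣p∣≡-p (c j)
    ... | inj₁ eq = subst (_≤ 1ℚ) (sym eq) (c≤1 j)
    ... | inj₂ eq = subst (_≤ 1ℚ) (sym eq) (≤-by _ (gap (-1≤c j)) (eq′ (c j)))
      where
      eq′ : ∀ x → - x + (x - - 1ℚ) ≡ 1ℚ
      eq′ = solve-∀ ℚ-ring

    private
      ∣xc∣≤∣x∣ : ∀ x j → ∣ x * c j ∣ ≤ ∣ x ∣
      ∣xc∣≤∣x∣ x j = subst₂ _≤_ (sym (ℚ.∣p*q∣≡∣p∣*∣q∣ x (c j))) (ℚ.*-identityʳ ∣ x ∣) (*-monoʳ ∣ x ∣ (ℚ.0≤∣p∣ x) (∣c∣≤1 j))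

    -- This and the next two bounds replace the periodicity of the absolute sine: translating an
    -- index by `m * p` changes `∣ s ∣` by at most `m ∣ s p ∣`.
    ∣s∣-+ : ∀ i j → ∣ s (i ℕ.+ j) ∣ ≤ ∣ s i ∣ + ∣ s j ∣
    ∣s∣-+ i j = begin
      ∣ s (i ℕ.+ j) ∣
        ≡⟨ cong ∣_∣ (trans (s-+ i j) (trans (ℚ.+-comm (c i * s j) (s i * c j)) (cong (s i * c j +_) (ℚ.*-comm (c i) (s j))))) ⟩
      ∣ s i * c j + s j * c i ∣         ≤⟨ ℚ.∣p+q∣≤∣p∣+∣q∣ (s i * c j) (s j * c i) ⟩
      ∣ s i * c j ∣ + ∣ s j * c i ∣     ≤⟨ ℚ.+-mono-≤ (∣xc∣≤∣x∣ (s i) j) (∣xc∣≤∣x∣ (s j) i) ⟩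
      ∣ s i ∣ + ∣ s j ∣                 ∎
      where open ℚ.≤-Reasoning

    ∣s∣-back : ∀ i j → ∣ s i ∣ ≤ ∣ s (i ℕ.+ j) ∣ + ∣ s j ∣
    ∣s∣-back i j = begin
      ∣ s i ∣
        ≡⟨ cong ∣_∣ (trans (s-back i j) (cong (λ x → s (i ℕ.+ j) * c j - x) (ℚ.*-comm (c (i ℕ.+ j)) (s j)))) ⟩
      ∣ s (i ℕ.+ j) * c j - s j * c (i ℕ.+ j) ∣           ≤⟨ ℚ.∣p-q∣≤∣p∣+∣q∣ (s (i ℕ.+ j) * c j) (s j * c (i ℕ.+ j)) ⟩
      ∣ s (i ℕ.+ j) * c j ∣ + ∣ s j * c (i ℕ.+ j) ∣       ≤⟨ ℚ.+-mono-≤ (∣xc∣≤∣x∣ (s (i ℕ.+ j)) j) (∣xc∣≤∣x∣ (s j) (i ℕ.+ j)) ⟩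
      ∣ s (i ℕ.+ j) ∣ + ∣ s j ∣                           ∎
      where open ℚ.≤-Reasoning

    ∣s∣-* : ∀ m n → ∣ s (m ℕ.* n) ∣ ≤ ι m * ∣ s n ∣
    ∣s∣-* zero    n = ℚ.≤-reflexive (sym (ℚ.*-zeroˡ ∣ s n ∣))
    ∣s∣-* (suc m) n = begin
      ∣ s (n ℕ.+ m ℕ.* n) ∣             ≤⟨ ∣s∣-+ n (m ℕ.* n) ⟩
      ∣ s n ∣ + ∣ s (m ℕ.* n) ∣         ≤⟨ ℚ.+-monoʳ-≤ ∣ s n ∣ (∣s∣-* m n) ⟩
      ∣ s n ∣ + ι m * ∣ s n ∣           ≡⟨ eq (ι m) ∣ s n ∣ ⟩
      (1ℚ + ι m) * ∣ s n ∣              ∎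
      where
      open ℚ.≤-Reasoning
      eq : ∀ x y → y + x * y ≡ (1ℚ + x) * y
      eq = solve-∀ ℚ-ring

  -- Approximate half turns over the Gaussian rationals

  record TinyRotation (N : ℕ) : Set where
    field
      u       : ℂ
      unit    : nsq u ≡ 1ℚ
      0<im    : 0ℚ < im u
      0≤re    : 0ℚ ≤ re u
      im-tiny : ι N * im u ≤ ι 2
      1-re≤im : 1ℚ - re u ≤ im u
      steps   : ℕ
      1<steps : 1ℚ < ι steps * (1ℚ - re u)

  -- `u = (N + i)² / (N² + 1)`, from the rational parametrisation of the circle, with
  -- `τ = 1 / (N² + 1)`. As `1 - re u = 2 τ`, the choice `steps = 1 + N²` makes the product in
  -- `1<steps` equal to 2.
  tinyRotation : ∀ N .{{_ : ℕ.NonZero N}} → TinyRotation N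
  tinyRotation N@(suc N-1) = record
    { u       = (1ℚ - ι 2 * τ) +i (ι 2 * (ι N * τ))
    ; unit    = trans (eq₁ (ι N) τ) (trans (cong (λ x → 1ℚ + ι 4 * τ * (x - 1ℚ)) D*τ) (eq₂ τ))
    ; 0<im    = 0<-* (0<ι 2) (0<-* (0<ι N) 0<τ)
    ; 0≤re    = subst (0ℚ ≤_) (trans (eq₃ (ι N-1) τ) (cong (_- ι 2 * τ) D*τ)) (0≤-* (0≤-+ (0≤-* (0≤ι 2) (0≤ι N-1)) (0≤-² (ι N-1))) (ℚ.<⇒≤ 0<τ))
    ; im-tiny = ≤-by (ι 2 * τ) (0≤-* (0≤ι 2) (ℚ.<⇒≤ 0<τ)) (trans (eq₄ (ι N) τ) (trans (cong (ι 2 *_) D*τ) (ℚ.*-identityʳ (ι 2))))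
    ; 1-re≤im = ≤-by _ (0≤-* (0≤-* (0≤ι 2) (0≤ι N-1)) (ℚ.<⇒≤ 0<τ)) (eq₅ (ι N-1) τ)
    ; steps   = 1 ℕ.+ N ℕ.* N
    ; 1<steps = subst (1ℚ <_) (sym (trans (cong (λ x → (1ℚ + x) * (1ℚ - (1ℚ - ι 2 * τ))) (ι-* N N))
                  (trans (eq₆ (ι N) τ) (trans (cong (ι 2 *_) D*τ) (ℚ.*-identityʳ (ι 2)))))) (ι-mono-< {1} {2} ℕ.≤-refl)
    }
    where
    D : ℚ
    D = 1ℚ + ι N * ι N
    0<D : 0ℚ < D
    0<D = ℚ.+-mono-<-≤ 0<1 (0≤-* (0≤ι N) (0≤ι N))
    instance
      D-pos = positive 0<D
      D-nz  = ℚ.pos⇒nonZero D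
    τ : ℚ
    τ = 1/ D
    0<τ : 0ℚ < τ
    0<τ = ℚ.positive⁻¹ τ {{ℚ.1/pos⇒pos D}}
    D*τ : D * τ ≡ 1ℚ
    D*τ = ℚ.*-inverseʳ D
    eq₁ : ∀ n t → (1ℚ - ι 2 * t) * (1ℚ - ι 2 * t) + ι 2 * (n * t) * (ι 2 * (n * t)) ≡ 1ℚ + ι 4 * t * ((1ℚ + n * n) * t - 1ℚ)
    eq₁ = solve-∀ ℚ-ring
    eq₂ : ∀ t → 1ℚ + ι 4 * t * (1ℚ - 1ℚ) ≡ 1ℚ
    eq₂ = solve-∀ ℚ-ring
    eq₃ : ∀ n t → (ι 2 * n + n * n) * t ≡ (1ℚ + (1ℚ + n) * (1ℚ + n)) * t - ι 2 * t
    eq₃ = solve-∀ ℚ-ring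
    eq₄ : ∀ n t → n * (ι 2 * (n * t)) + ι 2 * t ≡ ι 2 * ((1ℚ + n * n) * t)
    eq₄ = solve-∀ ℚ-ring
    eq₅ : ∀ n t → 1ℚ - (1ℚ - ι 2 * t) + ι 2 * n * t ≡ ι 2 * ((1ℚ + n) * t)
    eq₅ = solve-∀ ℚ-ring
    eq₆ : ∀ n t → (1ℚ + n * n) * (1ℚ - (1ℚ - ι 2 * t)) ≡ ι 2 * ((1ℚ + n * n) * t)
    eq₆ = solve-∀ ℚ-ring

  module SmallSteps {N : ℕ} (R : TinyRotation N) (B : ℕ)
                    (small : ι 2 * ι B * im (TinyRotation.u R) < 1ℚ) where

    open TinyRotation R
    open Powers u unit

    private
      0≤im : 0ℚ ≤ im u
      0≤im = ℚ.<⇒≤ 0<im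

    -- One multiplication by `u` lowers the real part by at most `(1 - re u) + im u`, which is at
    -- most `2 im u`.
    c-slow : ∀ j → 1ℚ - ι 2 * ι j * im u ≤ c j
    c-slow zero    = ℚ.≤-reflexive (eq (im u))
      where
      eq : ∀ x → 1ℚ - ι 2 * 0ℚ * x ≡ 1ℚ
      eq = solve-∀ ℚ-ring
    c-slow (suc j) = ≤-by _
      (0≤-+ (gap (c-slow j)) (0≤-+ (0≤-* (gap re≤1) (gap (c≤1 j)))
        (0≤-+ (0≤-* 0≤im (gap (s≤1 j))) (gap 1-re≤im))))
      (eq (re u) (im u) (ι j) (c j) (s j))
      where
      eq : ∀ r m i c s → 1ℚ - ι 2 * (1ℚ + i) * m +
             ((c - (1ℚ - ι 2 * i * m)) + ((1ℚ - r) * (1ℚ - c) + (m * (1ℚ - s) + (m - (1ℚ - r))))) ≡ r * c - m * s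
      eq = solve-∀ ℚ-ring

    0<c : ∀ j → j ℕ.≤ B → 0ℚ < c j
    0<c j j≤B = ℚ.<-≤-trans
      (subst (_< 1ℚ - ι 2 * ι j * im u) (ℚ.+-inverseʳ (ι 2 * ι j * im u))
        (ℚ.+-monoˡ-< (- (ι 2 * ι j * im u))
          (ℚ.≤-<-trans (*-monoˡ (im u) 0≤im (*-monoʳ (ι 2) (0≤ι 2) (ι-mono j≤B))) small)))
      (c-slow j)

    0≤s : ∀ j → j ℕ.≤ B → 0ℚ ≤ s j
    0≤s zero    _   = ℚ.≤-refl
    0≤s (suc j) j<B = 0≤-+ (0≤-* 0≤re (0≤s j (ℕ.<⇒≤ j<B))) (0≤-* 0≤im (ℚ.<⇒≤ (0<c j (ℕ.<⇒≤ j<B))))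

    0<s : ∀ j → 0 ℕ.< j → j ℕ.≤ B → 0ℚ < s j
    0<s (suc j) _ j<B = ℚ.+-mono-≤-< (0≤-* 0≤re (0≤s j (ℕ.<⇒≤ j<B))) (0<-* 0<im (0<c j (ℕ.<⇒≤ j<B)))

    s≤j*im : ∀ j → j ℕ.≤ B → s j ≤ ι j * im u
    s≤j*im zero    _   = ℚ.≤-reflexive (sym (ℚ.*-zeroˡ (im u)))
    s≤j*im (suc j) j<B = ≤-by _
      (0≤-+ (gap (s≤j*im j (ℕ.<⇒≤ j<B))) (0≤-+ (0≤-* (gap re≤1) (0≤s j (ℕ.<⇒≤ j<B))) (0≤-* 0≤im (gap (c≤1 j)))))
      (eq (re u) (im u) (ι j) (c j) (s j))
      where
      eq : ∀ r m i c s → r * s + m * c + ((i * m - s) + ((1ℚ - r) * s + m * (1ℚ - c))) ≡ (1ℚ + i) * m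
      eq = solve-∀ ℚ-ring

    -- `suc T` stands for π divided by the angle of `u`: it is the exponent of the first positive
    -- power on or below the real axis.
    record FirstReturn : Set where
      field
        T      : ℕ
        before : ∀ j → 0 ℕ.< j → j ℕ.≤ T → 0ℚ < s j
        return : s (suc T) ≤ 0ℚ

    -- If all sines up to index `2 * steps` were positive, `chord-bound` would give
    -- `steps * (1 - re u) ≤ 1`, against `1<steps`.
    firstReturn : FirstReturn
    firstReturn with leastBelow (λ j → s (suc j) ℚ.≤? 0ℚ) (steps ℕ.+ steps)
    ... | inj₁ (T , return , least) = record
      { T      = T
      ; before = λ { (suc j) _ j<T → ℚ.≰⇒> (least j j<T) }
      ; return = return
      }
    ... | inj₂ none = contradiction
      (subst (λ x → ι steps * (1ℚ - x) ≤ 1ℚ) (cong re w^1)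
        (chord-bound steps λ { (suc j) _ j<2J → ℚ.≰⇒> (none j j<2J) }))
      (<⇒≱ 1<steps)

    open FirstReturn firstReturn public

    B≤T : B ℕ.≤ T
    B≤T = ℕ.≮⇒≥ λ T<B → <⇒≱ (0<s (suc T) (s≤s z≤n) T<B) return

    private
      0≤sT : 0ℚ ≤ s T
      0≤sT = from-before T ℕ.≤-refl
        where
        from-before : ∀ j → j ℕ.≤ T → 0ℚ ≤ s j
        from-before zero    _   = ℚ.≤-refl
        from-before (suc j) j≤T = ℚ.<⇒≤ (before (suc j) (s≤s z≤n) j≤T)

      -im≤s : - im u ≤ s (suc T)
      -im≤s = ≤-by _ (0≤-+ (0≤-* 0≤re 0≤sT) (0≤-* 0≤im (gap (-1≤c T)))) (eq (re u) (im u) (c T) (s T))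
        where
        eq : ∀ r m c s → - m + (r * s + m * (c - - 1ℚ)) ≡ r * s + m * c
        eq = solve-∀ ℚ-ring

      -- Otherwise `s T = s (suc T) re u - c (suc T) im u` would be negative.
      c≤0 : c (suc T) ≤ 0ℚ
      c≤0 = ℚ.≮⇒≥ λ 0<c → <⇒≱ (0<-* 0<c 0<im) (≤-by _ (0≤-+ 0≤sT (0≤-* 0≤re (gap return)))
        (trans (cong (λ x → c (suc T) * im u + (x + re u * (0ℚ - s (suc T)))) back) (eq (c (suc T)) (s (suc T)) (re u) (im u))))
        where
        back : s T ≡ s (suc T) * re u - c (suc T) * im u
        back = trans (s-back T 1) (trans (cong (λ k → s k * c 1 - c k * s 1) (ℕ.+-comm T 1))
          (cong (λ z → s (suc T) * re z - c (suc T) * im z) w^1))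
        eq : ∀ c s r m → c * m + ((s * r - c * m) + r * (0ℚ - s)) ≡ 0ℚ
        eq = solve-∀ ℚ-ring

    -- The exponent `m * p` of the half turn overshoots `suc T` by fewer than `p` steps, so sign and
    -- size of the sine are needed on a window after the first return.
    after≤0 : ∀ i → i ℕ.≤ B → s (suc T ℕ.+ i) ≤ 0ℚ
    after≤0 i i≤B = ≤-by _ (0≤-+ (0≤-* (gap c≤0) (0≤s i i≤B)) (0≤-* (gap return) (ℚ.<⇒≤ (0<c i i≤B))))
      (trans (cong (_+ ((0ℚ - c (suc T)) * s i + (0ℚ - s (suc T)) * c i)) (s-+ (suc T) i)) (eq (c (suc T)) (s (suc T)) (c i) (s i)))
      where
      eq : ∀ a b c d → a * d + b * c + ((0ℚ - a) * d + (0ℚ - b) * c) ≡ 0ℚ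
      eq = solve-∀ ℚ-ring

    after≥ : ∀ i → i ℕ.≤ B → - (ι (suc i) * im u) ≤ s (suc T ℕ.+ i)
    after≥ i i≤B = ≤-by _
      (0≤-+ (0≤-+ (0≤-* (gap -im≤s) (ℚ.<⇒≤ (0<c i i≤B))) (0≤-* 0≤im (gap (c≤1 i))))
            (0≤-+ (0≤-* (gap (-1≤c (suc T))) (0≤s i i≤B)) (gap (s≤j*im i i≤B))))
      (trans (eq (c (suc T)) (s (suc T)) (c i) (s i) (im u) (ι i)) (sym (s-+ (suc T) i)))
      where
      eq : ∀ a b c d m i → - ((1ℚ + i) * m) + ((b - - m) * c + m * (1ℚ - c) + ((a - - 1ℚ) * d + (i * m - d))) ≡ a * d + b * c
      eq = solve-∀ ℚ-ring

  -- A rotation by π / p or slightly more.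
  record HalfTurn (p D : ℕ) : Set where
    field
      v    : ℂ
      unit : nsq v ≡ 1ℚ
    open Powers v unit public
    field
      0<s  : ∀ j → 0 ℕ.< j → j ℕ.< p → 0ℚ < s j
      sp≤0 : s p ≤ 0ℚ
      -1≤Dsp : - 1ℚ ≤ ι D * s p

  -- `m` is least with `T < m * p`; hence `v = u ^ m` turns by a p-th part of a half turn or
  -- slightly more.
  halfTurn : ∀ p D .{{_ : ℕ.NonZero p}} → HalfTurn p D
  halfTurn p@(suc p-1) D = record
    { v      = u ^ m
    ; unit   = nsq-^ u unit m
    ; 0<s    = λ j 0<j j<p → subst (λ z → 0ℚ < im z) (sym (^-assocʳ u m j))
                 (before (m ℕ.* j) (ℕ.*-mono-≤ (s≤s (z≤n {T ℕ./ p})) 0<j) (mj≤T j j<p))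
    ; sp≤0   = subst (λ z → im z ≤ 0ℚ) (sym end) (after≤0 i i≤B)
    ; -1≤Dsp = subst (λ z → - 1ℚ ≤ ι D * im z) (sym end) (ℚ.≤-trans -1≤ (*-monoʳ (ι D) (0≤ι D) (after≥ i i≤B)))
    }
    where
    -- For this `N`, `im-tiny` says `E * p * im u ≤ 1`. The summand `3 * p` yields `2 p² im u < 1`,
    -- as `SmallSteps` requires for a window of `p²` steps; the summand `D` turns an overshoot of at
    -- most `p` steps into an error of at most `1 / D`.
    E = D ℕ.+ 3 ℕ.* p
    N = 2 ℕ.* (E ℕ.* p)
    instance
      E-nz : ℕ.NonZero E
      E-nz = ℕ.>-nonZero (ℕ.≤-trans (s≤s z≤n) (ℕ.m≤n+m (3 ℕ.* p) D))
      N-nz : ℕ.NonZero N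
      N-nz = ℕ.m*n≢0 2 (E ℕ.* p) {{_}} {{ℕ.m*n≢0 E p}}
    R = tinyRotation N
    open TinyRotation R
    Ep*im≤1 : ι E * ι p * im u ≤ 1ℚ
    Ep*im≤1 = *-cancelˡ (ι 2) (0<ι 2) (subst (_≤ ι 2 * 1ℚ)
      (trans (cong (_* im u) (trans (ι-* 2 (E ℕ.* p)) (cong (ι 2 *_) (ι-* E p)))) (ℚ.*-assoc (ι 2) (ι E * ι p) (im u)))
      (ℚ.≤-trans im-tiny (ℚ.≤-reflexive (sym (ℚ.*-identityʳ (ι 2))))))
    pp*im>0 : 0ℚ < ι p * ι p * im u
    pp*im>0 = 0<-* (0<-* (0<ι p) (0<ι p)) 0<im
    E≡ : ι E ≡ ι D + ι 3 * ι p
    E≡ = trans (ι-+ D (3 ℕ.* p)) (cong (ι D +_) (ι-* 3 p))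
    small : ι 2 * ι (p ℕ.* p) * im u < 1ℚ
    small = ℚ.<-≤-trans
      (subst₂ _<_ (trans (ℚ.+-identityˡ _) (cong (λ x → ι 2 * x * im u) (sym (ι-* p p)))) refl
        (ℚ.+-monoˡ-< (ι 2 * (ι p * ι p) * im u) pp*im>0))
      (ℚ.≤-trans (≤-by _ (0≤-* (0≤-* (0≤ι D) (0≤ι p)) (ℚ.<⇒≤ 0<im)) (trans (eq (ι D) (ι p) (im u)) (cong (λ x → x * ι p * im u) (sym E≡)))) Ep*im≤1)
      where
      eq : ∀ d p m → p * p * m + ι 2 * (p * p) * m + d * p * m ≡ (d + ι 3 * p) * p * m
      eq = solve-∀ ℚ-ring
    open SmallSteps R (p ℕ.* p) small
    m = suc (T ℕ./ p)
    r = T ℕ.% p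
    T≡ : T ≡ r ℕ.+ T ℕ./ p ℕ.* p
    T≡ = m≡m%n+[m/n]*n T p
    i = p ℕ.∸ suc r
    1+i≤p : suc i ℕ.≤ p
    1+i≤p = s≤s (ℕ.m∸n≤m p-1 r)
    i≤B : i ℕ.≤ p ℕ.* p
    i≤B = ℕ.≤-trans (ℕ.<⇒≤ 1+i≤p) (ℕ.m≤m*n p p)
    mp≡ : m ℕ.* p ≡ suc T ℕ.+ i
    mp≡ = begin
      p ℕ.+ T ℕ./ p ℕ.* p                   ≡⟨ cong (ℕ._+ T ℕ./ p ℕ.* p) (sym (ℕ.m+[n∸m]≡n (m%n<n T p))) ⟩
      suc r ℕ.+ i ℕ.+ T ℕ./ p ℕ.* p         ≡⟨ ℕ.+-assoc (suc r) i _ ⟩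
      suc r ℕ.+ (i ℕ.+ T ℕ./ p ℕ.* p)       ≡⟨ cong (suc r ℕ.+_) (ℕ.+-comm i _) ⟩
      suc r ℕ.+ (T ℕ./ p ℕ.* p ℕ.+ i)       ≡⟨ ℕ.+-assoc (suc r) _ i ⟨
      suc (r ℕ.+ T ℕ./ p ℕ.* p) ℕ.+ i       ≡⟨ cong (λ x → suc x ℕ.+ i) (sym T≡) ⟩
      suc T ℕ.+ i                           ∎
      where open ≡-Reasoning
    end : (u ^ m) ^ p ≡ u ^ (suc T ℕ.+ i)
    end = trans (^-assocʳ u m p) (cong (u ^_) mp≡)
    -- This is why the window has length `p²`: `m * p` exceeds `T` by at most `p`, and `p ≤ m`, so
    -- that `m * j ≤ T` for every `j < p`.
    p≤T/p : p ℕ.≤ T ℕ./ p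
    p≤T/p = subst (ℕ._≤ T ℕ./ p) (ℕ.m*n/n≡m p p) (ℕ./-monoˡ-≤ p B≤T)
    mj≤T : ∀ j → j ℕ.< p → m ℕ.* j ℕ.≤ T
    mj≤T j j<p = ℕ.+-cancelʳ-≤ m _ _ (begin
      m ℕ.* j ℕ.+ m            ≡⟨ trans (ℕ.+-comm _ m) (sym (ℕ.*-suc m j)) ⟩
      m ℕ.* suc j              ≤⟨ ℕ.*-monoʳ-≤ m j<p ⟩
      p ℕ.+ T ℕ./ p ℕ.* p      ≤⟨ ℕ.+-mono-≤ (ℕ.m≤n⇒m≤1+n p≤T/p) (m/n*n≤m T p) ⟩
      m ℕ.+ T                  ≡⟨ ℕ.+-comm m T ⟩
      T ℕ.+ m                  ∎)
      where open ℕ.≤-Reasoning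
    -1≤ : - 1ℚ ≤ ι D * - (ι (suc i) * im u)
    -1≤ = ≤-by _ (0≤-+ (gap Ep*im≤1) (0≤-+ (0≤-* (0≤-* (0≤-* (0≤ι 3) (0≤ι p)) (0≤ι p)) (ℚ.<⇒≤ 0<im))
        (0≤-* (0≤-* (0≤ι D) (gap (ι-mono 1+i≤p))) (ℚ.<⇒≤ 0<im))))
      (trans (cong (λ e → - 1ℚ + (1ℚ - e * ι p * im u + (ι 3 * ι p * ι p * im u + ι D * (ι p - ι (suc i)) * im u))) E≡)
        (eq (ι D) (ι p) (im u) (ι (suc i))))
      where
      eq : ∀ d p m i → - 1ℚ + (1ℚ - (d + ι 3 * p) * p * m + (ι 3 * p * p * m + d * (p - i) * m)) ≡ d * - (i * m)
      eq = solve-∀ ℚ-ring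

  -- The lower bound for sines, with room for errors

  module SineBound (q Y D : ℕ) (1≤q : 1 ℕ.≤ q) (H : HalfTurn (suc (q ℕ.+ q)) D)
                   (8pp≤D : 8 ℕ.* (suc (q ℕ.+ q) ℕ.* suc (q ℕ.+ q)) ℕ.≤ D)
                   (16qpY≤D : 16 ℕ.* (q ℕ.* (suc (q ℕ.+ q) ℕ.* Y)) ℕ.≤ D) where

    open HalfTurn H

    private
      p = suc (q ℕ.+ q)
      δ = - s p

      0≤δ : 0ℚ ≤ δ
      0≤δ = ℚ.neg-antimono-≤ sp≤0

      Dδ≤1 : ι D * δ ≤ 1ℚ
      Dδ≤1 = ≤-by _ (gap -1≤Dsp) (eq (ι D) (s p))
        where
        eq : ∀ d x → d * - x + (d * x - - 1ℚ) ≡ 1ℚ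
        eq = solve-∀ ℚ-ring

      ≤D⇒δ : ∀ k → k ℕ.≤ D → ι k * δ ≤ 1ℚ
      ≤D⇒δ k k≤D = ℚ.≤-trans (*-monoˡ δ 0≤δ (ι-mono k≤D)) Dδ≤1

      ιp : ι p ≡ 1ℚ + (ι q + ι q)
      ιp = cong (1ℚ +_) (ι-+ q q)

      8ppδ≤1 : ι 8 * (ι p * ι p) * δ ≤ 1ℚ
      8ppδ≤1 = subst (λ x → x * δ ≤ 1ℚ) (trans (ι-* 8 (p ℕ.* p)) (cong (ι 8 *_) (ι-* p p))) (≤D⇒δ _ 8pp≤D)

      16qpYδ≤1 : ι 16 * (ι q * (ι p * ι Y)) * δ ≤ 1ℚ
      16qpYδ≤1 = subst (λ x → x * δ ≤ 1ℚ)
        (trans (ι-* 16 (q ℕ.* (p ℕ.* Y))) (cong (ι 16 *_) (trans (ι-* q (p ℕ.* Y)) (cong (ι q *_) (ι-* p Y)))))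
        (≤D⇒δ _ 16qpY≤D)

      δ≤1 : δ ≤ 1ℚ
      δ≤1 = subst (_≤ 1ℚ) (trans (cong (_* δ) (ℚ.+-identityʳ 1ℚ)) (ℚ.*-identityˡ δ)) (≤D⇒δ 1 (ℕ.≤-trans (s≤s z≤n) 8pp≤D))

      0<c1 : 0ℚ < c 1
      0<c1 = 0<s2j⇒0<c 1 (0<s 1 (s≤s z≤n) (s≤s (ℕ.≤-trans 1≤q (ℕ.m≤m+n q q))))
        (0<s 2 (s≤s z≤n) (s≤s (ℕ.+-mono-≤ 1≤q 1≤q)))

      0<s1 : 0ℚ < s 1
      0<s1 = 0<s 1 (s≤s z≤n) (s≤s (ℕ.≤-trans 1≤q (ℕ.m≤m+n q q)))

      0≤-cp : 0ℚ ≤ - c p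
      0≤-cp = ℚ.neg-antimono-≤ (ℚ.≮⇒≥ λ 0<cp → <⇒≱ (0<s (q ℕ.+ q) (ℕ.≤-trans 1≤q (ℕ.m≤m+n q q)) ℕ.≤-refl)
        (≤-by _ (0≤-+ (0≤-* 0≤δ (ℚ.<⇒≤ 0<c1)) (0≤-* (ℚ.<⇒≤ 0<cp) (ℚ.<⇒≤ 0<s1)))
          (trans (cong (_+ (δ * c 1 + c p * s 1)) (trans (s-back (q ℕ.+ q) 1) (cong (λ k → s k * c 1 - c k * s 1) (ℕ.+-comm (q ℕ.+ q) 1))))
            (eq (c 1) (s 1) (c p) (s p)))))
        where
        eq : ∀ a b c d → d * a - c * b + (- d * a + c * b) ≡ 0ℚ
        eq = solve-∀ ℚ-ring

      1-δ≤-cp : 1ℚ - δ ≤ - c p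
      1-δ≤-cp = ²-cancel-≤ 0≤-cp (≤-by _ (0≤-* (0≤-* (0≤ι 2) 0≤δ) (gap δ≤1))
        (trans (eq₁ (s p)) (trans (cong (_- s p * s p) (sym (c²+s²≡1 p))) (eq₂ (c p) (s p)))))
        where
        eq₁ : ∀ s → (1ℚ - - s) * (1ℚ - - s) + ι 2 * - s * (1ℚ - - s) ≡ 1ℚ - s * s
        eq₁ = solve-∀ ℚ-ring
        eq₂ : ∀ c s → c * c + s * s - s * s ≡ - c * - c
        eq₂ = solve-∀ ℚ-ring

      -- `2 s(q)² = 1 - c(2 q)`, and since `2 q = p - 1`, `c(2 q) = c(p) c(1) + s(p) s(1)` is about
      -- `- c(1)`.
      1+c1-δ≤2s² : 1ℚ + c 1 - δ ≤ ι 2 * (s q * s q)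
      1+c1-δ≤2s² = ≤-by _
        (0≤-+ (0≤-* (gap 1-δ≤-cp) (ℚ.<⇒≤ 0<c1)) (0≤-+ (0≤-* 0≤δ (gap (c≤1 1))) (0≤-* 0≤δ (ℚ.<⇒≤ 0<s1))))
        (begin
          1ℚ + c 1 - δ + ((- c p - (1ℚ - δ)) * c 1 + (δ * (1ℚ - c 1) + δ * s 1))
            ≡⟨ eq₁ (c 1) (s 1) (c p) (s p) ⟩
          1ℚ - (c p * c 1 + s p * s 1)
            ≡⟨ cong (λ x → 1ℚ - x) (trans (cong (λ k → c k * c 1 + s k * s 1) (ℕ.+-comm 1 (q ℕ.+ q))) (sym (c-back (q ℕ.+ q) 1))) ⟩
          1ℚ - c (q ℕ.+ q)
            ≡⟨ cong₂ _-_ (sym (c²+s²≡1 q)) (c-+ q q) ⟩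
          (c q * c q + s q * s q) - (c q * c q - s q * s q)
            ≡⟨ eq₂ (c q) (s q) ⟩
          ι 2 * (s q * s q) ∎)
        where
        open ≡-Reasoning
        eq₁ : ∀ a b c d → 1ℚ + a - - d + ((- c - (1ℚ - - d)) * a + (- d * (1ℚ - a) + - d * b)) ≡ 1ℚ - (c * a + d * b)
        eq₁ = solve-∀ ℚ-ring
        eq₂ : ∀ a b → a * a + b * b - (a * a - b * b) ≡ ι 2 * (b * b)
        eq₂ = solve-∀ ℚ-ring

      -- Coefficients of `896 q² - 546 q - 256` in powers of `r = q - 1`, where all of them are
      -- positive. This polynomial is what remains of the squared inequality below, multiplied by
      -- `2 q`, once the bounds for `s q`, `c 1` and `δ` are used up.
      k₀ k₁ k₂ : ℚ
      k₀ = ℤ.+ 94 ℚ′./ 1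
      k₁ = ℤ.+ 1246 ℚ′./ 1
      k₂ = ℤ.+ 896 ℚ′./ 1

      -- As vᵖ ≈ -1, 2 s(q)² ≈ 1 + c(1), and c(1) ≥ 1 - 1 / q by chord-bound.  This
      -- leaves a margin over the required p s(q) ≥ 2 q because p = 2 q + 1 is odd.
      32q+1≤16psq : ι 32 * ι q + 1ℚ ≤ ι 16 * (ι p * s q)
      32q+1≤16psq with r , q≡1+r ← ℕ.m≤n⇒∃[o]m+o≡n 1≤q = ²-cancel-≤
        (0≤-* (0≤ι 16) (0≤-* (0≤ι p) (ℚ.<⇒≤ (0<s q 1≤q (s≤s (ℕ.m≤m+n q q))))))
        (*-cancelˡ (ι 2 * ι q) (0<-* (0<ι 2) (0<ι q {{ℕ.>-nonZero 1≤q}}))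
        (≤-by _ (0≤-+ (0≤-* (0≤-* (0≤-* (0≤ι 16) (0≤ι 16)) (0≤-* (0≤ι p) (0≤ι p)))
                         (0≤-+ (0≤-* (0≤ι q) (gap 1+c1-δ≤2s²)) (gap (chord-bound q λ j 0<j j≤2q → 0<s j 0<j (s≤s j≤2q)))))
                  (0≤-+ (0≤-* (0≤-* (0≤ι 32) (0≤ι q)) (gap 8ppδ≤1))
                        (0≤-+ (ℚ.nonNegative⁻¹ k₀) (0≤-+ (0≤-* (ℚ.nonNegative⁻¹ k₁) (0≤ι r)) (0≤-* (ℚ.nonNegative⁻¹ k₂) (0≤-* (0≤ι r) (0≤ι r)))))))
          (identity (ι r) (ι q) (ι p) (c 1) (s q) δ (cong ι (sym q≡1+r)) ιp)))
        where
        eq : ∀ r c s d → let q = 1ℚ + r ; p = 1ℚ + (q + q) in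
          ι 2 * q * ((ι 32 * q + 1ℚ) * (ι 32 * q + 1ℚ))
          + (ι 16 * ι 16 * (p * p) * (q * (ι 2 * (s * s) - (1ℚ + c - d)) + (1ℚ - q * (1ℚ - c)))
            + (ι 32 * q * (1ℚ - ι 8 * (p * p) * d) + (k₀ + (k₁ * r + k₂ * (r * r)))))
          ≡ ι 2 * q * (ι 16 * (p * s) * (ι 16 * (p * s)))
        eq = solve-∀ ℚ-ring
        identity : ∀ r q p c s d → q ≡ 1ℚ + r → p ≡ 1ℚ + (q + q) →
          ι 2 * q * ((ι 32 * q + 1ℚ) * (ι 32 * q + 1ℚ))
          + (ι 16 * ι 16 * (p * p) * (q * (ι 2 * (s * s) - (1ℚ + c - d)) + (1ℚ - q * (1ℚ - c)))
            + (ι 32 * q * (1ℚ - ι 8 * (p * p) * d) + (k₀ + (k₁ * r + k₂ * (r * r)))))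
          ≡ ι 2 * q * (ι 16 * (p * s) * (ι 16 * (p * s)))
        identity r _ _ c s d refl refl = eq r c s d

      -- Concavity gives `p s(r) ≥ (r / q) p s(q) ≥ 2 r + r / (16 q)`. As `r ≥
      -- 1`, the surplus is at least `1 / (16 q)`, which covers `p Y δ`.
      2r+pYδ≤psr : ∀ r → 1 ℕ.≤ r → r ℕ.≤ q → ι 2 * ι r + ι p * (ι Y * δ) ≤ ι p * s r
      2r+pYδ≤psr r 1≤r r≤q = *-cancelˡ (ι 16 * ι q) (0<-* (0<ι 16) (0<ι q {{ℕ.>-nonZero 1≤q}}))
        (≤-by _ (0≤-+ (0≤-* (0≤-* (0≤ι 16) (0≤ι p)) (gap slope))
          (0≤-+ (0≤-* (0≤ι r) (gap 32q+1≤16psq)) (0≤-+ (gap (ι-mono 1≤r)) (gap 16qpYδ≤1))))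
          (eq (ι q) (ι p) (ι r) (s q) (s r) (ι Y) δ))
        where
        slope : ι r * s q ≤ ι q * s r
        slope = concave⇒slope-decreasing s q ℚ.≤-refl
          (λ j j<q → s-concave j (ℚ.<⇒≤ (0<s (suc j) (s≤s z≤n) (ℕ.<-trans j<q (s≤s (ℕ.m≤m+n q q)))))) r r≤q
        eq : ∀ q p r a b y d → ι 16 * q * (ι 2 * r + p * (y * d))
          + (ι 16 * p * (q * b - r * a) + (r * (ι 16 * (p * a) - (ι 32 * q + 1ℚ)) + (r - ι 1 + (1ℚ - ι 16 * (q * (p * y)) * d))))
          ≡ ι 16 * q * (p * b)
        eq = solve-∀ ℚ-ring

      ∣sp∣≡δ : ∣ s p ∣ ≡ δ
      ∣sp∣≡δ = trans (sym (ℚ.∣-p∣≡∣p∣ (s p))) (ℚ.0≤p⇒∣p∣≡p 0≤δ)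

    D∣sp∣≤1 : ι D * ∣ s p ∣ ≤ 1ℚ
    D∣sp∣≤1 = subst (λ x → ι D * x ≤ 1ℚ) (sym ∣sp∣≡δ) Dδ≤1

    -- Replacing `α` by its distance `r` from the multiple `m * p` changes the absolute sine by at
    -- most `m δ ≤ Y δ`, for which `2r+pYδ≤psr` has room.
    sine-bound : ∀ α r m → 1 ℕ.≤ r → r ℕ.≤ q → m ℕ.≤ Y → r ℕ.+ m ℕ.* p ≡ α ⊎ r ℕ.+ α ≡ m ℕ.* p →
                 ι 2 * ι r ≤ ι p * ∣ s α ∣
    sine-bound α r m 1≤r r≤q m≤Y α≡±r = ≤-by _
      (0≤-+ (gap (2r+pYδ≤psr r 1≤r r≤q)) (0≤-* (0≤ι p) (0≤-+ (gap ∣sr∣≤) (0≤-* (gap (ι-mono m≤Y)) 0≤δ))))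
      (trans (cong (λ x → ι 2 * ι r + (ι p * s r - (ι 2 * ι r + ι p * (ι Y * δ)) + ι p * ((∣ s α ∣ + ι m * δ - x) + (ι Y - ι m) * δ)))
          (ℚ.0≤p⇒∣p∣≡p (ℚ.<⇒≤ 0<sr)))
        (eq (ι p) (ι r) (ι m) (ι Y) (s r) ∣ s α ∣ δ))
      where
      0<sr : 0ℚ < s r
      0<sr = 0<s r 1≤r (ℕ.≤-<-trans r≤q (s≤s (ℕ.m≤m+n q q)))
      ∣smp∣≤ : ∣ s (m ℕ.* p) ∣ ≤ ι m * δ
      ∣smp∣≤ = subst (λ x → ∣ s (m ℕ.* p) ∣ ≤ ι m * x) ∣sp∣≡δ (∣s∣-* m p)
      both : r ℕ.+ m ℕ.* p ≡ α ⊎ r ℕ.+ α ≡ m ℕ.* p → ∣ s r ∣ ≤ ∣ s α ∣ + ∣ s (m ℕ.* p) ∣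
      both (inj₁ refl) = ∣s∣-back r (m ℕ.* p)
      both (inj₂ eq)   = ℚ.≤-trans (∣s∣-back r α) (ℚ.≤-reflexive
        (trans (ℚ.+-comm ∣ s (r ℕ.+ α) ∣ ∣ s α ∣) (cong (λ k → ∣ s α ∣ + ∣ s k ∣) eq)))
      ∣sr∣≤ : ∣ s r ∣ ≤ ∣ s α ∣ + ι m * δ
      ∣sr∣≤ = ℚ.≤-trans (both α≡±r) (ℚ.+-monoʳ-≤ ∣ s α ∣ ∣smp∣≤)
      eq : ∀ p r m y a b d → ι 2 * r + (p * a - (ι 2 * r + p * (y * d)) + p * ((b + m * d - a) + (y - m) * d)) ≡ p * b
      eq = solve-∀ ℚ-ring

  -- All that the counting uses of the rotation: `Y` bounds the multiples of `p` that may be dropped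
  -- from an index, and `1 / D` the distance of `v ^ p` from the real axis.
  record SineTable (q Y D : ℕ) : Set where
    private
      p = suc (q ℕ.+ q)
    field
      v    : ℂ
      unit : nsq v ≡ 1ℚ
    open Powers v unit public
    field
      D∣sp∣≤1    : ι D * ∣ s p ∣ ≤ 1ℚ
      sine-bound : ∀ α r m → 1 ℕ.≤ r → r ℕ.≤ q → m ℕ.≤ Y → r ℕ.+ m ℕ.* p ≡ α ⊎ r ℕ.+ α ≡ m ℕ.* p →
                   ι 2 * ι r ≤ ι p * ∣ s α ∣

  opaque
    sineTable : ∀ q Y D → 1 ℕ.≤ q → SineTable q Y D
    sineTable q Y D 1≤q = record
      { v = v ; unit = unit
      ; D∣sp∣≤1 = ℚ.≤-trans (*-monoˡ ∣ s p ∣ (ℚ.0≤∣p∣ (s p)) (ι-mono (ℕ.≤-trans (ℕ.m≤m+n D A) (ℕ.m≤m+n (D ℕ.+ A) B)))) T.D∣sp∣≤1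
      ; sine-bound = T.sine-bound
      }
      where
      p A B : ℕ
      p = suc (q ℕ.+ q)
      A = 8 ℕ.* (p ℕ.* p)
      B = 16 ℕ.* (q ℕ.* (p ℕ.* Y))
      -- `A` and `B` are the accuracies that the sine bound itself demands, `D` the one demanded by
      -- the count.
      H : HalfTurn p (D ℕ.+ A ℕ.+ B)
      H = halfTurn p (D ℕ.+ A ℕ.+ B)
      open HalfTurn H
      module T = SineBound q Y (D ℕ.+ A ℕ.+ B) 1≤q H (ℕ.≤-trans (ℕ.m≤n+m A D) (ℕ.m≤m+n (D ℕ.+ A) B)) (ℕ.m≤n+m B (D ℕ.+ A))

  -- Bounds for sums

  open import Algebra.Properties.Semiring.Sum (CommutativeRing.semiring ℂ-ring)
    using (sum; ∑-comm; *-distribˡ-sum; *-distribʳ-sum; sum-cong-≗)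
  open import Algebra.Properties.CommutativeSemiring.Exp (CommutativeRing.commutativeSemiring ℂ-ring) using (^-distrib-*)
  open import Algebra.Properties.CommutativeSemiring.Exp (CommutativeRing.commutativeSemiring ℚ.+-*-commutativeRing)
    public using () renaming (_^_ to _^ℚ_; ^-distrib-* to ^ℚ-distrib-*; ^-assocʳ to ^ℚ-assocʳ)
  open CommutativeRing ℂ-ring using () renaming
    (*-assoc to ⊗-assoc; *-comm to ⊗-comm; *-identityʳ to ⊗-identityʳ; +-assoc to ⊕-assoc; distribˡ to ⊗-distribˡ)

  ι-^ : ∀ m n → ι (m ℕ.^ n) ≡ ι m ^ℚ n
  ι-^ m zero    = ℚ.+-identityʳ 1ℚ
  ι-^ m (suc n) = trans (ι-* m (m ℕ.^ n)) (cong (ι m *_) (ι-^ m n))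

  0≤-^ : ∀ {x} → 0ℚ ≤ x → ∀ n → 0ℚ ≤ x ^ℚ n
  0≤-^ 0≤x zero    = ℚ.<⇒≤ 0<1
  0≤-^ 0≤x (suc n) = 0≤-* 0≤x (0≤-^ 0≤x n)

  ^-mono : ∀ {x y} → 0ℚ ≤ x → x ≤ y → ∀ n → x ^ℚ n ≤ y ^ℚ n
  ^-mono 0≤x x≤y zero    = ℚ.≤-refl
  ^-mono 0≤x x≤y (suc n) = *-mono (0≤-^ 0≤x n) (ℚ.≤-trans 0≤x x≤y) x≤y (^-mono 0≤x x≤y n)

  -- The absolute value of w is at most B, without square roots.
  infix 4 _⊑_
  record _⊑_ (w : ℂ) (B : ℚ) : Set where
    constructor mk⊑
    field
      0≤bound : 0ℚ ≤ B
      nsq≤    : nsq w ≤ B * B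
  open _⊑_ public

  ⊑-weaken : ∀ {w A B} → w ⊑ A → A ≤ B → w ⊑ B
  ⊑-weaken {A = A} (mk⊑ 0≤A le) A≤B = mk⊑ (ℚ.≤-trans 0≤A A≤B) (ℚ.≤-trans le (*-mono 0≤A (ℚ.≤-trans 0≤A A≤B) A≤B A≤B))

  0ℂ⊑0 : 0ℂ ⊑ 0ℚ
  0ℂ⊑0 = mk⊑ ℚ.≤-refl ℚ.≤-refl

  ⊑-neg : ∀ {w B} → w ⊑ B → neg w ⊑ B
  ⊑-neg {w} {B} (mk⊑ 0≤B le) = mk⊑ 0≤B (subst (_≤ B * B) (sym (eq (re w) (im w))) le)
    where
    eq : ∀ a b → - a * - a + - b * - b ≡ a * a + b * b
    eq = solve-∀ ℚ-ring

  ⊑-* : ∀ {w z A B} → w ⊑ A → z ⊑ B → w ⊗ z ⊑ A * B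
  ⊑-* {w} {z} {A} {B} (mk⊑ 0≤A w≤) (mk⊑ 0≤B z≤) = mk⊑ (0≤-* 0≤A 0≤B)
    (subst₂ _≤_ (sym (nsq-* w z)) (eq A B) (*-mono (0≤-+ (0≤-² (re z)) (0≤-² (im z))) (0≤-² A) w≤ z≤))
    where
    eq : ∀ a b → a * a * (b * b) ≡ a * b * (a * b)
    eq = solve-∀ ℚ-ring

  ⊑-+ : ∀ {w z A B} → w ⊑ A → z ⊑ B → w ⊕ z ⊑ A + B
  ⊑-+ {w} {z} {A} {B} w⊑A@(mk⊑ 0≤A w≤) z⊑B@(mk⊑ 0≤B z≤) = mk⊑ (0≤-+ 0≤A 0≤B)
    (≤-by _ (0≤-+ (gap w≤) (0≤-+ (gap z≤) (0≤-* (0≤ι 2) (gap dot≤)))) (eq₁ (re w) (im w) (re z) (im z) A B))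
    where
    dot = re w * re z + im w * im z
    -- The Cauchy-Schwarz inequality; `re w * im z - im w * re z` is the remaining square in
    -- Lagrange's identity.
    dot≤ : dot ≤ A * B
    dot≤ = ²-cancel-≤ (0≤-* 0≤A 0≤B) (≤-by _
      (0≤-+ (0≤-² (re w * im z - im w * re z)) (gap (subst (_≤ A * B * (A * B)) (nsq-* w z) (nsq≤ (⊑-* w⊑A z⊑B)))))
      (eq₂ (re w) (im w) (re z) (im z) (A * B)))
      where
      eq₂ : ∀ a b c d e → (a * c + b * d) * (a * c + b * d) +
              ((a * d - b * c) * (a * d - b * c) + (e * e - (a * a + b * b) * (c * c + d * d))) ≡ e * e
      eq₂ = solve-∀ ℚ-ring
    eq₁ : ∀ a b c d e f → (a + c) * (a + c) + (b + d) * (b + d) +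
            ((e * e - (a * a + b * b)) + ((f * f - (c * c + d * d)) + ι 2 * (e * f - (a * c + b * d)))) ≡ (e + f) * (e + f)
    eq₁ = solve-∀ ℚ-ring

  ⊑-^ : ∀ {w A} → w ⊑ A → ∀ n → w ^ n ⊑ A ^ℚ n
  ⊑-^ w⊑A zero    = mk⊑ (ℚ.<⇒≤ 0<1) ℚ.≤-refl
  ⊑-^ w⊑A (suc n) = ⊑-* w⊑A (⊑-^ w⊑A n)

  unit⊑1 : ∀ w → nsq w ≡ 1ℚ → w ⊑ 1ℚ
  unit⊑1 w eq = mk⊑ (ℚ.<⇒≤ 0<1) (ℚ.≤-reflexive eq)

  ιℂ : ℕ → ℂ
  ιℂ n = ι n +i 0ℚ

  ιℂ⊑⇒≤ : ∀ n {B} → ιℂ n ⊑ B → ι n ≤ B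
  ιℂ⊑⇒≤ n (mk⊑ 0≤B le) = ²-cancel-≤ 0≤B (subst (_≤ _) (eq (ι n)) le)
    where
    eq : ∀ a → a * a + 0ℚ * 0ℚ ≡ a * a
    eq = solve-∀ ℚ-ring

  ιℂ-* : ∀ m n → ιℂ (m ℕ.* n) ≡ ιℂ m ⊗ ιℂ n
  ιℂ-* m n = cong₂ _+i_ (trans (ι-* m n) (eq₁ (ι m) (ι n))) (eq₂ (ι m) (ι n))
    where
    eq₁ : ∀ a b → a * b ≡ a * b - 0ℚ * 0ℚ
    eq₁ = solve-∀ ℚ-ring
    eq₂ : ∀ a b → 0ℚ ≡ a * 0ℚ + 0ℚ * b
    eq₂ = solve-∀ ℚ-ring

  ιℂ-^ : ∀ m n → ιℂ (m ℕ.^ n) ≡ ιℂ m ^ n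
  ιℂ-^ m zero    = cong (_+i 0ℚ) (ℚ.+-identityʳ 1ℚ)
  ιℂ-^ m (suc n) = trans (ιℂ-* m (m ℕ.^ n)) (cong (ιℂ m ⊗_) (ιℂ-^ m n))

  sum-⊑ : ∀ {m B} (f : Fin m → ℂ) → 0ℚ ≤ B → (∀ i → f i ⊑ B) → sum f ⊑ ι m * B
  sum-⊑ {zero}  {B} f 0≤B f⊑ = subst (0ℂ ⊑_) (sym (ℚ.*-zeroˡ B)) 0ℂ⊑0
  sum-⊑ {suc m} {B} f 0≤B f⊑ = subst (sum f ⊑_) (eq B (ι m))
    (⊑-+ (f⊑ Fin.zero) (sum-⊑ (λ i → f (Fin.suc i)) 0≤B (λ i → f⊑ (Fin.suc i))))
    where
    eq : ∀ b m → b + m * b ≡ (1ℚ + m) * b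
    eq = solve-∀ ℚ-ring

  -- boxSum M k φ is the sum of φ (u₁ + ⋯ + uₖ) over all u in {0, …, M}ᵏ.
  module _ (M : ℕ) where

    boxSum : ℕ → (ℕ → ℂ) → ℂ
    boxSum zero    φ = φ 0
    boxSum (suc k) φ = sum {suc M} λ j → boxSum k λ x → φ (toℕ j ℕ.+ x)

    boxSum-cong : ∀ k {φ ψ} → (∀ x → φ x ≡ ψ x) → boxSum k φ ≡ boxSum k ψ
    boxSum-cong zero    φ≗ψ = φ≗ψ 0
    boxSum-cong (suc k) φ≗ψ = sum-cong-≗ {suc M} λ j → boxSum-cong k λ x → φ≗ψ (toℕ j ℕ.+ x)

    boxSum-*ˡ : ∀ k a φ → boxSum k (λ x → a ⊗ φ x) ≡ a ⊗ boxSum k φ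
    boxSum-*ˡ zero    a φ = refl
    boxSum-*ˡ (suc k) a φ = trans (sum-cong-≗ {suc M} λ j → boxSum-*ˡ k a (λ x → φ (toℕ j ℕ.+ x)))
      (sym (*-distribˡ-sum {suc M} a (λ j → boxSum k λ x → φ (toℕ j ℕ.+ x))))

    boxSum-sum : ∀ k {m} (φ : Fin m → ℕ → ℂ) → sum (λ b → boxSum k (φ b)) ≡ boxSum k (λ x → sum λ b → φ b x)
    boxSum-sum zero    φ = refl
    boxSum-sum (suc k) {m} φ = trans (∑-comm {m} {suc M} λ b j → boxSum k λ x → φ b (toℕ j ℕ.+ x))
      (sum-cong-≗ {suc M} λ j → boxSum-sum k λ b x → φ b (toℕ j ℕ.+ x))

    boxSum-⊑ : ∀ k {φ B} → 0ℚ ≤ B → (∀ x → x ℕ.≤ k ℕ.* M → φ x ⊑ B) → boxSum k φ ⊑ ι (suc M ℕ.^ k) * B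
    boxSum-⊑ zero    {φ} {B} 0≤B φ⊑ = subst (φ 0 ⊑_) (sym (trans (cong (_* B) (ℚ.+-identityʳ 1ℚ)) (ℚ.*-identityˡ B))) (φ⊑ 0 z≤n)
    boxSum-⊑ (suc k) {φ} {B} 0≤B φ⊑ = subst (boxSum (suc k) φ ⊑_)
      (trans (sym (ℚ.*-assoc (ι (suc M)) _ B)) (cong (_* B) (sym (ι-* (suc M) (suc M ℕ.^ k)))))
      (sum-⊑ {suc M} _ (0≤-* (0≤ι (suc M ℕ.^ k)) 0≤B) λ j → boxSum-⊑ k 0≤B λ x x≤ → φ⊑ _ (ℕ.+-mono-≤ (Fin.toℕ≤pred[n] j) x≤))

    -- Only the zero vector of the box has sum 0, so the exceptional bound `A` is counted once: in
    -- each coordinate `j = 0` leads to the recursive case and `j > 0` makes the total positive.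
    boxSum-⊑-0 : ∀ k {φ A B} → 0ℚ ≤ B → φ 0 ⊑ A → (∀ x → 0 ℕ.< x → x ℕ.≤ k ℕ.* M → φ x ⊑ B) →
                 boxSum k φ ⊑ A + ι (suc M ℕ.^ k) * B
    boxSum-⊑-0 zero    {φ} {A} {B} 0≤B φ0⊑ φ⊑ = ⊑-weaken φ0⊑ (≤-by _ (0≤-* (0≤ι 1) 0≤B) refl)
    boxSum-⊑-0 (suc k) {φ} {A} {B} 0≤B φ0⊑ φ⊑ = subst (boxSum (suc k) φ ⊑_)
      (trans (eq A (ι M) (ι (suc M ℕ.^ k)) B) (cong (λ x → A + x * B) (sym (ι-* (suc M) (suc M ℕ.^ k)))))
      (⊑-+ (boxSum-⊑-0 k 0≤B φ0⊑ λ x 0<x x≤ → φ⊑ x 0<x (ℕ.≤-trans x≤ (ℕ.m≤n+m (k ℕ.* M) M)))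
           (sum-⊑ {M} _ (0≤-* (0≤ι (suc M ℕ.^ k)) 0≤B) λ j → boxSum-⊑ k 0≤B λ x x≤ →
              φ⊑ _ (s≤s z≤n) (ℕ.+-mono-≤ (Fin.toℕ<n j) x≤)))
      where
      eq : ∀ a m y b → a + y * b + m * (y * b) ≡ a + (1ℚ + m) * y * b
      eq = solve-∀ ℚ-ring

    -- Characters turn sums into products, so the sum over the box factors into equal geometric
    -- sums.
    boxSum-geometric : ∀ k z α → boxSum k (λ x → z ^ (α ℕ.* x)) ≡ sum {suc M} (λ j → z ^ (α ℕ.* toℕ j)) ^ k
    boxSum-geometric zero    z α = cong (z ^_) (ℕ.*-zeroʳ α)
    boxSum-geometric (suc k) z α = begin
      sum {suc M} (λ j → boxSum k λ x → z ^ (α ℕ.* (toℕ j ℕ.+ x)))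
        ≡⟨ sum-cong-≗ {suc M} (λ j → trans (boxSum-cong k λ x → trans (cong (z ^_) (ℕ.*-distribˡ-+ α (toℕ j) x)) (^-homo-* z (α ℕ.* toℕ j) (α ℕ.* x)))
             (boxSum-*ˡ k (z ^ (α ℕ.* toℕ j)) (λ x → z ^ (α ℕ.* x)))) ⟩
      sum {suc M} (λ j → z ^ (α ℕ.* toℕ j) ⊗ boxSum k (λ x → z ^ (α ℕ.* x)))
        ≡⟨ *-distribʳ-sum {suc M} (boxSum k (λ x → z ^ (α ℕ.* x))) (λ j → z ^ (α ℕ.* toℕ j)) ⟨
      sum {suc M} (λ j → z ^ (α ℕ.* toℕ j)) ⊗ boxSum k (λ x → z ^ (α ℕ.* x))
        ≡⟨ cong (sum {suc M} (λ j → z ^ (α ℕ.* toℕ j)) ⊗_) (boxSum-geometric k z α) ⟩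
      sum {suc M} (λ j → z ^ (α ℕ.* toℕ j)) ^ suc k ∎
      where open ≡-Reasoning

  -- Sums of products over vectors

  module _ {p : ℕ} where

    vecSum : ∀ n → (Vec (Fin p) n → ℂ) → ℂ
    vecSum zero    g = g []
    vecSum (suc n) g = sum λ b → vecSum n λ β → g (b ∷ β)

    vecSum-cong : ∀ n {f g} → (∀ β → f β ≡ g β) → vecSum n f ≡ vecSum n g
    vecSum-cong zero    f≗g = f≗g []
    vecSum-cong (suc n) f≗g = sum-cong-≗ λ b → vecSum-cong n λ β → f≗g (b ∷ β)

    vecSum-*ˡ : ∀ n a g → vecSum n (λ β → a ⊗ g β) ≡ a ⊗ vecSum n g
    vecSum-*ˡ zero    a g = refl
    vecSum-*ˡ (suc n) a g = trans (sum-cong-≗ λ b → vecSum-*ˡ n a (λ β → g (b ∷ β)))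
      (sym (*-distribˡ-sum a (λ b → vecSum n λ β → g (b ∷ β))))

    vecSum-boxSum : ∀ M k n (φ : Vec (Fin p) n → ℕ → ℂ) →
                    vecSum n (λ β → boxSum M k (φ β)) ≡ boxSum M k (λ x → vecSum n λ β → φ β x)
    vecSum-boxSum M k zero    φ = refl
    vecSum-boxSum M k (suc n) φ = trans (sum-cong-≗ λ b → vecSum-boxSum M k n (λ β → φ (b ∷ β)))
      (boxSum-sum M k λ b x → vecSum n λ β → φ (b ∷ β) x)

    module _ {A : Set} (w : A → Fin p → ℂ) where

      vecProd : ∀ {n} → Vec A n → Vec (Fin p) n → ℂ
      vecProd []       []      = 1ℂ
      vecProd (t ∷ ts) (b ∷ β) = w t b ⊗ vecProd ts β

      prodSum : ∀ {n} → Vec A n → ℂ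
      prodSum []       = 1ℂ
      prodSum (t ∷ ts) = sum (w t) ⊗ prodSum ts

      vecSum-vecProd : ∀ {n} (ts : Vec A n) → vecSum n (vecProd ts) ≡ prodSum ts
      vecSum-vecProd []       = refl
      vecSum-vecProd (t ∷ ts) = trans
        (sum-cong-≗ λ b → trans (vecSum-*ˡ _ (w t b) (vecProd ts)) (cong (w t b ⊗_) (vecSum-vecProd ts)))
        (sym (*-distribʳ-sum (prodSum ts) (w t)))

      prodSum-⊑ : ∀ {n B} (ts : Vec A n) → (∀ t → sum (w t) ⊑ B) → prodSum ts ⊑ B ^ℚ n
      prodSum-⊑ []       w⊑ = mk⊑ (ℚ.<⇒≤ 0<1) ℚ.≤-refl
      prodSum-⊑ (t ∷ ts) w⊑ = ⊑-* (w⊑ t) (prodSum-⊑ ts w⊑)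

      prodSum-⊑-any : ∀ {n B ε} (ts : Vec A n) → (∀ t → sum (w t) ⊑ B) →
                      Any (λ t → sum (w t) ⊑ B * ε) ts → prodSum ts ⊑ B ^ℚ n * ε
      prodSum-⊑-any {suc n} {B} {ε} (t ∷ ts) w⊑ (here t⊑) = subst (_ ⊑_) (eq B ε (B ^ℚ n)) (⊑-* t⊑ (prodSum-⊑ ts w⊑))
        where
        eq : ∀ b e x → b * e * x ≡ b * x * e
        eq = solve-∀ ℚ-ring
      prodSum-⊑-any {suc n} {B} {ε} (t ∷ ts) w⊑ (there any) = subst (_ ⊑_) (sym (ℚ.*-assoc B (B ^ℚ n) ε))
        (⊑-* (w⊑ t) (prodSum-⊑-any ts w⊑ any))

  -- The exact number `pⁿ - 1` of remaining terms matters: with `pⁿ` instead, their bound could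
  -- equal the whole main term and `point-count` would be vacuous.
  vecSum-split : ∀ {p-1} n (g : Vec (Fin (suc p-1)) n → ℂ) {B} → 0ℚ ≤ B →
                 (∀ β → ¬ All (λ b → toℕ b ≡ 0) β → g β ⊑ B) →
                 ∃[ rest ] vecSum n g ≡ g (Vec.replicate n Fin.zero) ⊕ rest × rest ⊑ (ι (suc p-1) ^ℚ n - 1ℚ) * B
  vecSum-split zero g {B} 0≤B g⊑ = 0ℂ , sym (CommutativeRing.+-identityʳ ℂ-ring (g [])) ,
    subst (0ℂ ⊑_) (eq B) 0ℂ⊑0
    where
    eq : ∀ b → 0ℚ ≡ (1ℚ - 1ℚ) * b
    eq = solve-∀ ℚ-ring
  vecSum-split {p-1} (suc n) g {B} 0≤B g⊑
    with rest , eq , rest⊑ ← vecSum-split n (λ β → g (Fin.zero ∷ β)) 0≤B (λ β β≢0 → g⊑ (Fin.zero ∷ β) λ { (_ ∷ β≡0) → β≢0 β≡0 })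
    = rest ⊕ others , trans (cong (_⊕ others) eq) (CommutativeRing.+-assoc ℂ-ring (g (Fin.zero ∷ Vec.replicate n Fin.zero)) rest others) ,
      subst (rest ⊕ others ⊑_) (eq′ (ι p-1) (ι (suc p-1) ^ℚ n) B)
        (⊑-+ rest⊑ (sum-⊑ _ (0≤-* (0≤-^ (0≤ι (suc p-1)) n) 0≤B) λ b → vecSum-⊑ n _ λ β → g⊑ (Fin.suc b ∷ β) λ { (() ∷ _) }))
    where
    others = sum λ b → vecSum n λ β → g (Fin.suc b ∷ β)
    vecSum-⊑ : ∀ m (f : Vec (Fin (suc p-1)) m → ℂ) → (∀ β → f β ⊑ B) → vecSum m f ⊑ ι (suc p-1) ^ℚ m * B
    vecSum-⊑ zero    f f⊑ = subst (f [] ⊑_) (sym (ℚ.*-identityˡ B)) (f⊑ [])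
    vecSum-⊑ (suc m) f f⊑ = subst (vecSum (suc m) f ⊑_) (sym (ℚ.*-assoc (ι (suc p-1)) _ B))
      (sum-⊑ _ (0≤-* (0≤-^ (0≤ι (suc p-1)) m) 0≤B) λ b → vecSum-⊑ m _ λ β → f⊑ (b ∷ β))
    eq′ : ∀ m x b → (x - 1ℚ) * b + m * (x * b) ≡ ((1ℚ + m) * x - 1ℚ) * b
    eq′ = solve-∀ ℚ-ring

  -- Geometric sums of roots of unity

  geometric : ∀ w L → sum {L} (λ j → w ^ toℕ j) ⊕ w ^ L ≡ 1ℂ ⊕ w ⊗ sum {L} (λ j → w ^ toℕ j)
  geometric w zero    = eq w
    where
    eq : ∀ w → 0ℂ ⊕ 1ℂ ≡ 1ℂ ⊕ w ⊗ 0ℂ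
    eq w = cong₂ _+i_ (re-eq (re w) (im w)) (im-eq (re w) (im w))
      where
      re-eq : ∀ a b → 0ℚ + 1ℚ ≡ 1ℚ + (a * 0ℚ - b * 0ℚ)
      re-eq = solve-∀ ℚ-ring
      im-eq : ∀ a b → 0ℚ + 0ℚ ≡ 0ℚ + (a * 0ℚ + b * 0ℚ)
      im-eq = solve-∀ ℚ-ring
  geometric w (suc L) = begin
    1ℂ ⊕ sum {L} (λ j → w ⊗ w ^ toℕ j) ⊕ w ⊗ w ^ L       ≡⟨ cong (λ x → 1ℂ ⊕ x ⊕ w ⊗ w ^ L) shift ⟩
    1ℂ ⊕ w ⊗ S ⊕ w ⊗ w ^ L                           ≡⟨ ⊕-assoc 1ℂ (w ⊗ S) (w ⊗ w ^ L) ⟩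
    1ℂ ⊕ (w ⊗ S ⊕ w ⊗ w ^ L)                         ≡⟨ cong (1ℂ ⊕_) (⊗-distribˡ w S (w ^ L)) ⟨
    1ℂ ⊕ w ⊗ (S ⊕ w ^ L)                             ≡⟨ cong (λ x → 1ℂ ⊕ w ⊗ x) (geometric w L) ⟩
    1ℂ ⊕ w ⊗ (1ℂ ⊕ w ⊗ S)                            ≡⟨ cong (λ x → 1ℂ ⊕ w ⊗ (1ℂ ⊕ x)) shift ⟨
    1ℂ ⊕ w ⊗ (1ℂ ⊕ sum {L} (λ j → w ⊗ w ^ toℕ j))        ∎
    where
    open ≡-Reasoning
    S = sum {L} (λ j → w ^ toℕ j)
    shift : sum {L} (λ j → w ⊗ w ^ toℕ j) ≡ w ⊗ S
    shift = sym (*-distribˡ-sum {L} w (λ j → w ^ toℕ j))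

  ∣x∣²≡x² : ∀ x → ∣ x ∣ * ∣ x ∣ ≡ x * x
  ∣x∣²≡x² x = trans (sym (ℚ.∣p*q∣≡∣p∣*∣q∣ x x)) (ℚ.0≤p⇒∣p∣≡p (0≤-² x))

  dist : ∀ p .{{_ : ℕ.NonZero p}} → ℕ → ℕ
  dist p α = α % p ℕ.⊓ (p ℕ.∸ α % p)

  0<dist⇒%≢0 : ∀ p .{{_ : ℕ.NonZero p}} α → 0 ℕ.< dist p α → α % p ≢ 0
  0<dist⇒%≢0 p α 0<d α%p≡0 = ℕ.n≮0 (ℕ.<-≤-trans 0<d (ℕ.≤-trans (ℕ.m⊓n≤m (α % p) _) (ℕ.≤-reflexive α%p≡0)))

  %≢0⇒0<dist : ∀ p .{{_ : ℕ.NonZero p}} α → α % p ≢ 0 → 0 ℕ.< dist p α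
  %≢0⇒0<dist p α α%p≢0 = ℕ.⊓-glb (ℕ.n≢0⇒n>0 α%p≢0) (ℕ.m<n⇒0<n∸m (m%n<n α p))

  module GeometricSums {q Y D : ℕ} (T : SineTable q Y D) where

    open SineTable T

    private
      p = suc (q ℕ.+ q)

    -- Nearly exp(2πi / p). Its square root `v` is kept because `∣ 1 - z ^ α ∣` is twice the
    -- absolute sine `∣ s α ∣`.
    z : ℂ
    z = v ⊗ v

    S : ℕ → ℕ → ℂ
    S α L = sum {L} λ j → z ^ (α ℕ.* toℕ j)

    nsq-z^ : ∀ m → nsq (z ^ m) ≡ 1ℚ
    nsq-z^ = nsq-^ z (trans (nsq-* v v) (trans (cong₂ _*_ unit unit) (ℚ.*-identityˡ 1ℚ)))

    S⊑L : ∀ α L → S α L ⊑ ι L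
    S⊑L α L = subst (S α L ⊑_) (ℚ.*-identityʳ (ι L))
      (sum-⊑ {L} _ (ℚ.<⇒≤ 0<1) λ j → unit⊑1 _ (nsq-z^ (α ℕ.* toℕ j)))

    S0 : ∀ L → S 0 L ≡ ιℂ L
    S0 zero    = refl
    S0 (suc L) = trans (cong (1ℂ ⊕_) (S0 L)) (cong ((1ℚ + ι L) +i_) (ℚ.+-identityʳ 0ℚ))

    nsq[1-z^α] : ∀ α → nsq (1ℂ ⊕ neg (z ^ α)) ≡ ι 4 * (s α * s α)
    nsq[1-z^α] α = trans (cong (λ w → nsq (1ℂ ⊕ neg w)) (^-distrib-* v v α))
      (eq (c α) (s α) (c²+s²≡1 α))
      where
      eq₁ : ∀ a b → (1ℚ + - (a * a - b * b)) * (1ℚ + - (a * a - b * b)) + (0ℚ + - (a * b + b * a)) * (0ℚ + - (a * b + b * a))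
                  ≡ 1ℚ - ι 2 * (a * a) + ι 2 * (b * b) + (a * a + b * b) * (a * a + b * b)
      eq₁ = solve-∀ ℚ-ring
      eq₂ : ∀ a b → 1ℚ - ι 2 * (a * a) + ι 2 * (b * b) + 1ℚ * 1ℚ ≡ ι 2 * (1ℚ - (a * a + b * b)) + ι 4 * (b * b)
      eq₂ = solve-∀ ℚ-ring
      eq₃ : ∀ x → ι 2 * (1ℚ - 1ℚ) + x ≡ x
      eq₃ = solve-∀ ℚ-ring
      eq : ∀ a b → a * a + b * b ≡ 1ℚ →
           nsq (1ℂ ⊕ neg ((a +i b) ⊗ (a +i b))) ≡ ι 4 * (b * b)
      eq a b u = trans (eq₁ a b) (trans (cong (λ x → 1ℚ - ι 2 * (a * a) + ι 2 * (b * b) + x * x) u)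
        (trans (eq₂ a b) (trans (cong (λ x → ι 2 * (1ℚ - x) + ι 4 * (b * b)) u) (eq₃ (ι 4 * (b * b))))))

    -- The Dirichlet kernel, squared and cleared of its denominator: it comes from the telescoping
    -- product of `1 - z ^ α` with the geometric sum.
    s²-nsq-S : ∀ α L → s α * s α * nsq (S α L) ≡ s (α ℕ.* L) * s (α ℕ.* L)
    s²-nsq-S α L = ℚ.≤-antisym (*-cancelˡ (ι 4) (0<ι 4) (ℚ.≤-reflexive eq)) (*-cancelˡ (ι 4) (0<ι 4) (ℚ.≤-reflexive (sym eq)))
      where
      S≡ : S α L ≡ sum {L} (λ j → (z ^ α) ^ toℕ j)
      S≡ = sum-cong-≗ {L} λ j → sym (^-assocʳ z α (toℕ j))
      telescope : (1ℂ ⊕ neg (z ^ α)) ⊗ S α L ≡ 1ℂ ⊕ neg (z ^ (α ℕ.* L))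
      telescope = trans (cong ((1ℂ ⊕ neg (z ^ α)) ⊗_) S≡) (trans (rearrange (z ^ α) _ ((z ^ α) ^ L) (geometric (z ^ α) L))
        (cong (λ x → 1ℂ ⊕ neg x) (^-assocʳ z α L)))
        where
        rearrange : ∀ w s x → s ⊕ x ≡ 1ℂ ⊕ w ⊗ s → (1ℂ ⊕ neg w) ⊗ s ≡ 1ℂ ⊕ neg x
        rearrange w s x eq = cong₂ _+i_
          (trans (re₁ (re w) (im w) (re s) (im s) (re x))
            (trans (cong (λ y → re y - re x - (re w * re s - im w * im s)) eq) (re₂ (re w * re s - im w * im s) (re x))))
          (trans (im₁ (re w) (im w) (re s) (im s) (im x))
            (trans (cong (λ y → im y - im x - (re w * im s + im w * re s)) eq) (im₂ (re w * im s + im w * re s) (im x))))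
          where
          re₁ : ∀ a b c d e → (1ℚ + - a) * c - (0ℚ + - b) * d ≡ c + e - e - (a * c - b * d)
          re₁ = solve-∀ ℚ-ring
          re₂ : ∀ a b → 1ℚ + a - b - a ≡ 1ℚ + - b
          re₂ = solve-∀ ℚ-ring
          im₁ : ∀ a b c d e → (1ℚ + - a) * d + (0ℚ + - b) * c ≡ d + e - e - (a * d + b * c)
          im₁ = solve-∀ ℚ-ring
          im₂ : ∀ a b → 0ℚ + a - b - a ≡ 0ℚ + - b
          im₂ = solve-∀ ℚ-ring
      eq : ι 4 * (s α * s α * nsq (S α L)) ≡ ι 4 * (s (α ℕ.* L) * s (α ℕ.* L))
      eq = begin
        ι 4 * (s α * s α * nsq (S α L))              ≡⟨ ℚ.*-assoc (ι 4) (s α * s α) (nsq (S α L)) ⟨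
        ι 4 * (s α * s α) * nsq (S α L)              ≡⟨ cong (_* nsq (S α L)) (nsq[1-z^α] α) ⟨
        nsq (1ℂ ⊕ neg (z ^ α)) * nsq (S α L)         ≡⟨ nsq-* (1ℂ ⊕ neg (z ^ α)) (S α L) ⟨
        nsq ((1ℂ ⊕ neg (z ^ α)) ⊗ S α L)             ≡⟨ cong nsq telescope ⟩
        nsq (1ℂ ⊕ neg (z ^ (α ℕ.* L)))               ≡⟨ nsq[1-z^α] (α ℕ.* L) ⟩
        ι 4 * (s (α ℕ.* L) * s (α ℕ.* L))            ∎
        where open ≡-Reasoning

    half : ∀ r → r ℕ.+ r ℕ.≤ p → r ℕ.≤ q
    half r 2r≤p = ℕ.≮⇒≥ λ q<r → ℕ.1+n≰n (ℕ.≤-trans (ℕ.≤-reflexive (cong suc (sym (ℕ.+-suc q q)))) (ℕ.≤-trans (ℕ.+-mono-≤ q<r q<r) 2r≤p))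

    -- The multiple of `p` nearest to `α` is `α / p` times `p` or the next one. The second case
    -- accounts for the form `suc α ≤ Y` of the hypothesis.
    dist-sine : ∀ α → suc α ℕ.≤ Y → α % p ≢ 0 → ι 2 * ι (dist p α) ≤ ι p * ∣ s α ∣
    dist-sine α α<Y α%p≢0 with ℕ.≤-total (α % p) (p ℕ.∸ α % p)
    ... | inj₁ x≤p-x = sine-bound α (dist p α) (α / p) (%≢0⇒0<dist p α α%p≢0)
            (subst (ℕ._≤ q) (sym dist≡) (half (α % p) (ℕ.m≤o∸n⇒m+n≤o (α % p) (ℕ.<⇒≤ (m%n<n α p)) x≤p-x)))
            (ℕ.≤-trans (ℕ.m/n≤m α p) (ℕ.<⇒≤ α<Y))
            (inj₁ (trans (cong (ℕ._+ α / p ℕ.* p) dist≡) (sym (m≡m%n+[m/n]*n α p))))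
      where
      dist≡ : dist p α ≡ α % p
      dist≡ = ℕ.m≤n⇒m⊓n≡m x≤p-x
    ... | inj₂ p-x≤x = sine-bound α (dist p α) (suc (α / p)) (%≢0⇒0<dist p α α%p≢0)
            (subst (ℕ._≤ q) (sym dist≡) (half (p ℕ.∸ α % p)
              (ℕ.≤-trans (ℕ.+-monoʳ-≤ (p ℕ.∸ α % p) p-x≤x) (ℕ.≤-reflexive (ℕ.m∸n+n≡m (ℕ.<⇒≤ (m%n<n α p)))))))
            (ℕ.≤-trans (s≤s (ℕ.m/n≤m α p)) α<Y)
            (inj₂ (begin
              dist p α ℕ.+ α                                     ≡⟨ cong₂ ℕ._+_ dist≡ (m≡m%n+[m/n]*n α p) ⟩
              p ℕ.∸ α % p ℕ.+ (α % p ℕ.+ α / p ℕ.* p)            ≡⟨ ℕ.+-assoc (p ℕ.∸ α % p) (α % p) _ ⟨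
              p ℕ.∸ α % p ℕ.+ α % p ℕ.+ α / p ℕ.* p              ≡⟨ cong (ℕ._+ α / p ℕ.* p) (ℕ.m∸n+n≡m (ℕ.<⇒≤ (m%n<n α p))) ⟩
              p ℕ.+ α / p ℕ.* p                                  ∎))
      where
      open ≡-Reasoning
      dist≡ : dist p α ≡ p ℕ.∸ α % p
      dist≡ = ℕ.m≥n⇒m⊓n≡n p-x≤x

    private
      scale-sine : ∀ α L → ι p * ∣ s α ∣ * (ι p * ∣ s α ∣) * nsq (S α L) ≡ ι p * ∣ s (α ℕ.* L) ∣ * (ι p * ∣ s (α ℕ.* L) ∣)
      scale-sine α L = trans (eq₁ (ι p) ∣ s α ∣ (nsq (S α L))) (trans (cong (λ x → ι p * ι p * (x * nsq (S α L))) (∣x∣²≡x² (s α)))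
        (trans (cong (ι p * ι p *_) (trans (s²-nsq-S α L) (sym (∣x∣²≡x² (s (α ℕ.* L)))))) (eq₂ (ι p) ∣ s (α ℕ.* L) ∣)))
        where
        eq₁ : ∀ p s n → p * s * (p * s) * n ≡ p * p * (s * s * n)
        eq₁ = solve-∀ ℚ-ring
        eq₂ : ∀ p s → p * p * (s * s) ≡ p * s * (p * s)
        eq₂ = solve-∀ ℚ-ring

      0≤nsq : ∀ w → 0ℚ ≤ nsq w
      0≤nsq w = 0≤-+ (0≤-² (re w)) (0≤-² (im w))

    -- The numerator of the kernel is at most 1 and its denominator at least `2 H / p`. The equation
    -- for `ρ` characterises `p / 2 H` without a division.
    S-far : ∀ α L H {ρ} → suc α ℕ.≤ Y → 0 ℕ.< H → H ℕ.≤ dist p α → 0ℚ ≤ ρ → ρ * (ι 2 * ι H) ≡ ι p → S α L ⊑ ρ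
    S-far α L H {ρ} α<Y 0<H H≤d 0≤ρ ρ2H≡p = mk⊑ 0≤ρ (*-cancelˡ (h * h) (0<-* 0<h 0<h) (begin
      h * h * nsq (S α L)
        ≤⟨ *-monoˡ (nsq (S α L)) (0≤nsq (S α L)) (*-mono (ℚ.<⇒≤ 0<h) (ℚ.≤-trans (ℚ.<⇒≤ 0<h) h≤) h≤ h≤) ⟩
      ι p * ∣ s α ∣ * (ι p * ∣ s α ∣) * nsq (S α L)             ≡⟨ scale-sine α L ⟩
      ι p * ∣ s (α ℕ.* L) ∣ * (ι p * ∣ s (α ℕ.* L) ∣)           ≤⟨ *-mono 0≤ps (0≤ι p) ps≤p ps≤p ⟩
      ι p * ι p                                                 ≡⟨ cong₂ _*_ ρ2H≡p ρ2H≡p ⟨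
      ρ * h * (ρ * h)                                           ≡⟨ eq ρ h ⟩
      h * h * (ρ * ρ)                                           ∎))
      where
      open ℚ.≤-Reasoning
      h = ι 2 * ι H
      0<h : 0ℚ < h
      0<h = 0<-* (0<ι 2) (0<ι H {{ℕ.>-nonZero 0<H}})
      h≤ : h ≤ ι p * ∣ s α ∣
      h≤ = ℚ.≤-trans (*-monoʳ (ι 2) (0≤ι 2) (ι-mono H≤d))
        (dist-sine α α<Y (0<dist⇒%≢0 p α (ℕ.<-≤-trans 0<H H≤d)))
      0≤ps : 0ℚ ≤ ι p * ∣ s (α ℕ.* L) ∣
      0≤ps = 0≤-* (0≤ι p) (ℚ.0≤∣p∣ (s (α ℕ.* L)))
      ps≤p : ι p * ∣ s (α ℕ.* L) ∣ ≤ ι p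
      ps≤p = subst (ι p * ∣ s (α ℕ.* L) ∣ ≤_) (ℚ.*-identityʳ (ι p)) (*-monoʳ (ι p) (0≤ι p)
        (²-cancel-≤ (ℚ.<⇒≤ 0<1) (≤-by (c (α ℕ.* L) * c (α ℕ.* L)) (0≤-² (c (α ℕ.* L)))
          (trans (cong (_+ c (α ℕ.* L) * c (α ℕ.* L)) (∣x∣²≡x² (s (α ℕ.* L))))
            (trans (ℚ.+-comm (s (α ℕ.* L) * s (α ℕ.* L)) _) (c²+s²≡1 (α ℕ.* L)))))))
      eq : ∀ a b → a * b * (a * b) ≡ b * b * (a * a)
      eq = solve-∀ ℚ-ring

    -- For an exact p-th root of unity this sum would vanish. Here the numerator of the kernel is
    -- `∣ s (y * p) ∣ ≤ Y ∣ s p ∣`, and for the denominator the crude `p ∣ s y ∣ ≥ 1` is enough.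
    S-nonmultiple : ∀ y → suc y ℕ.≤ Y → y % p ≢ 0 → S y p ⊑ ι p * (ι Y * ∣ s p ∣)
    S-nonmultiple y y<Y y%p≢0 = mk⊑ 0≤η (begin
      nsq (S y p)                                               ≡⟨ ℚ.*-identityˡ (nsq (S y p)) ⟨
      1ℚ * 1ℚ * nsq (S y p)
        ≤⟨ *-monoˡ (nsq (S y p)) (0≤nsq (S y p)) (*-mono (ℚ.<⇒≤ 0<1) (ℚ.≤-trans (ℚ.<⇒≤ 0<1) 1≤) 1≤ 1≤) ⟩
      ι p * ∣ s y ∣ * (ι p * ∣ s y ∣) * nsq (S y p)             ≡⟨ scale-sine y p ⟩
      ι p * ∣ s (y ℕ.* p) ∣ * (ι p * ∣ s (y ℕ.* p) ∣)           ≤⟨ *-mono (0≤-* (0≤ι p) (ℚ.0≤∣p∣ (s (y ℕ.* p)))) 0≤η le le ⟩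
      ι p * (ι Y * ∣ s p ∣) * (ι p * (ι Y * ∣ s p ∣))           ∎)
      where
      open ℚ.≤-Reasoning
      0≤η : 0ℚ ≤ ι p * (ι Y * ∣ s p ∣)
      0≤η = 0≤-* (0≤ι p) (0≤-* (0≤ι Y) (ℚ.0≤∣p∣ (s p)))
      1≤ : 1ℚ ≤ ι p * ∣ s y ∣
      1≤ = ℚ.≤-trans (ℚ.≤-trans (ℚ.≤-trans (ι-mono {1} {2} (s≤s z≤n)) (ℚ.≤-reflexive (sym (ℚ.*-identityʳ (ι 2)))))
        (*-monoʳ (ι 2) (0≤ι 2) (ι-mono (%≢0⇒0<dist p y y%p≢0)))) (dist-sine y y<Y y%p≢0)
      le : ι p * ∣ s (y ℕ.* p) ∣ ≤ ι p * (ι Y * ∣ s p ∣)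
      le = *-monoʳ (ι p) (0≤ι p) (ℚ.≤-trans (∣s∣-* y p) (*-monoˡ ∣ s p ∣ (ℚ.0≤∣p∣ (s p)) (ι-mono (ℕ.<⇒≤ y<Y))))

  -- Counting lattice points

  module _ {p : ℕ} where

    -- The last coordinate that completes β to a relation of ⟨ t ,1⟩.
    lastCoord : ∀ {n} → Vec (Fin p) n → Vec (Fin p) n → ℕ
    lastCoord []       []      = 0
    lastCoord (t ∷ ts) (b ∷ β) = toℕ b ℕ.* (p ℕ.∸ toℕ t) ℕ.+ lastCoord ts β

    lastCoord-≤ : ∀ {n} (t β : Vec (Fin p) n) → lastCoord t β ℕ.≤ n ℕ.* (p ℕ.* p)
    lastCoord-≤ []       []      = z≤n
    lastCoord-≤ (t ∷ ts) (b ∷ β) = ℕ.+-mono-≤ (ℕ.*-mono-≤ (ℕ.<⇒≤ (Fin.toℕ<n b)) (ℕ.m∸n≤m p (toℕ t))) (lastCoord-≤ ts β)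

  lastCoord-0 : ∀ {p-1 n} (t : Vec (Fin (suc p-1)) n) → lastCoord t (Vec.replicate n Fin.zero) ≡ 0
  lastCoord-0 []       = refl
  lastCoord-0 (t ∷ ts) = lastCoord-0 ts

  module _ {p : ℕ} {A : Set} (w : A → Fin p → ℂ) {B : ℚ} where

    vecProd-⊑ : (∀ t b → w t b ⊑ B) → ∀ {n} (ts : Vec A n) β → vecProd w ts β ⊑ B ^ℚ n
    vecProd-⊑ w⊑ []       []      = mk⊑ (ℚ.<⇒≤ 0<1) ℚ.≤-refl
    vecProd-⊑ w⊑ (t ∷ ts) (b ∷ β) = ⊑-* (w⊑ t b) (vecProd-⊑ w⊑ ts β)

    vecProd-⊑-any : ∀ {R u} → (∀ t b → w t b ⊑ B) → u ⊑ B → ∀ {n} (ts : Vec A n) β → Any (λ b → ∀ t → w t b ⊑ R) β →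
                    vecProd w ts β ⊗ u ⊑ B ^ℚ n * R
    vecProd-⊑-any {R} {u} w⊑ u⊑ {suc n} (t ∷ ts) (b ∷ β) (here b⊑) =
      subst (vecProd w (t ∷ ts) (b ∷ β) ⊗ u ⊑_) (eq R (B ^ℚ n) B) (⊑-* (⊑-* (b⊑ t) (vecProd-⊑ w⊑ ts β)) u⊑)
      where
      eq : ∀ r x b → r * x * b ≡ b * x * r
      eq = solve-∀ ℚ-ring
    vecProd-⊑-any {R} {u} w⊑ u⊑ {suc n} (t ∷ ts) (b ∷ β) (there any) =
      subst₂ _⊑_ (sym (⊗-assoc (w t b) (vecProd w ts β) u)) (sym (ℚ.*-assoc B (B ^ℚ n) R))
        (⊑-* (w⊑ t b) (vecProd-⊑-any w⊑ u⊑ ts β any))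

  -- Poisson summation and the point count

  module Fourier (q : ℕ) (1≤q : 1 ℕ.≤ q) (n : ℕ) (t : Vec (Fin (suc (q ℕ.+ q))) n) (k′ M H : ℕ) where

    private
      p = suc (q ℕ.+ q)
      K = k′ ℕ.* M
      X = suc M ℕ.^ k′
      -- Exceeds every character index that occurs: coordinates below `p`, completing coordinates up
      -- to `n p²`, and `x′ + (p - tᵢ) x` up to `K + p K`.
      Y = suc (p ℕ.+ n ℕ.* (p ℕ.* p) ℕ.+ (K ℕ.+ p ℕ.* K))
      -- Chosen to make `X (X p)ⁿ η ≤ 1`: the outer box sum has `X` terms, each with an error of at
      -- most `(X p)ⁿ η`.
      D = X ℕ.* ((X ℕ.* p) ℕ.^ n ℕ.* (p ℕ.* Y))

      T : SineTable q Y D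
      T = sineTable q Y D 1≤q

    open SineTable T using (D∣sp∣≤1; s)
    open GeometricSums T

    private
      η : ℚ
      η = ι p * (ι Y * ∣ s p ∣)

      0≤η : 0ℚ ≤ η
      0≤η = 0≤-* (0≤ι p) (0≤-* (0≤ι Y) (ℚ.0≤∣p∣ (s p)))

      1≤X : 1 ℕ.≤ X
      1≤X = ℕ.m^n>0 (suc M) k′

      1≤ι : ∀ {m} → 1 ℕ.≤ m → 1ℚ ≤ ι m
      1≤ι {m} 1≤m = ℚ.≤-trans (ℚ.≤-reflexive (sym (ℚ.+-identityʳ 1ℚ))) (ι-mono 1≤m)

      X[Xp]ⁿη≤1 : ι X * ((ι X * ι p) ^ℚ n * η) ≤ 1ℚ
      X[Xp]ⁿη≤1 = subst (_≤ 1ℚ) (trans (cong (_* ∣ s p ∣) (trans (ι-* X _) (cong (ι X *_)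
          (trans (ι-* ((X ℕ.* p) ℕ.^ n) _) (cong₂ _*_ (trans (ι-^ (X ℕ.* p) n) (cong (_^ℚ n) (ι-* X p))) (ι-* p Y))))))
        (eq (ι X) ((ι X * ι p) ^ℚ n) (ι p) (ι Y) ∣ s p ∣)) D∣sp∣≤1
        where
        eq : ∀ x z p y s → x * (z * (p * y)) * s ≡ x * (z * (p * (y * s)))
        eq = solve-∀ ℚ-ring

      1≤[Xp]ⁿ : 1ℚ ≤ (ι X * ι p) ^ℚ n
      1≤[Xp]ⁿ = subst (1ℚ ≤_) (trans (ι-^ (X ℕ.* p) n) (cong (_^ℚ n) (ι-* X p))) (1≤ι (ℕ.m^n>0 (X ℕ.* p) {{ℕ.m*n≢0 X p {{ℕ.>-nonZero 1≤X}}}} n))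

      Xη≤1 : ι X * η ≤ 1ℚ
      Xη≤1 = ℚ.≤-trans (*-monoʳ (ι X) (0≤ι X) (subst (_≤ (ι X * ι p) ^ℚ n * η) (ℚ.*-identityˡ η) (*-monoˡ η 0≤η 1≤[Xp]ⁿ))) X[Xp]ⁿη≤1

      -- The Fourier transform of the distribution of sums of `k′` elements of `{0, …, M}`.
      P : ℕ → ℂ
      P α = S α (suc M) ^ k′

      P⊑X : ∀ α → P α ⊑ ι X
      P⊑X α = subst (P α ⊑_) (sym (ι-^ (suc M) k′)) (⊑-^ (S⊑L α (suc M)) k′)

      w : ℕ → Fin p → Fin p → ℂ
      w x t b = P (toℕ b) ⊗ z ^ (toℕ b ℕ.* (p ℕ.∸ toℕ t) ℕ.* x)

      g : Vec (Fin p) n → ℂ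
      g β = vecProd (λ _ b → P (toℕ b)) t β ⊗ P (lastCoord t β)

      absorb : ∀ x {m} (t β : Vec (Fin p) m) → z ^ (lastCoord t β ℕ.* x) ⊗ vecProd (λ _ b → P (toℕ b)) t β ≡ vecProd (w x) t β
      absorb x []       []      = ⊗-identityʳ 1ℂ
      absorb x (t ∷ ts) (b ∷ β) = begin
        z ^ ((e ℕ.+ lastCoord ts β) ℕ.* x) ⊗ (P (toℕ b) ⊗ V)
          ≡⟨ cong (_⊗ (P (toℕ b) ⊗ V)) (trans (cong (z ^_) (ℕ.*-distribʳ-+ x e (lastCoord ts β))) (^-homo-* z (e ℕ.* x) (lastCoord ts β ℕ.* x))) ⟩
        (z ^ (e ℕ.* x) ⊗ z ^ (lastCoord ts β ℕ.* x)) ⊗ (P (toℕ b) ⊗ V)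
          ≡⟨ shuffle (z ^ (e ℕ.* x)) (z ^ (lastCoord ts β ℕ.* x)) (P (toℕ b)) V ⟩
        (P (toℕ b) ⊗ z ^ (e ℕ.* x)) ⊗ (z ^ (lastCoord ts β ℕ.* x) ⊗ V)
          ≡⟨ cong (w x t b ⊗_) (absorb x ts β) ⟩
        w x t b ⊗ vecProd (w x) ts β ∎
        where
        open ≡-Reasoning
        e = toℕ b ℕ.* (p ℕ.∸ toℕ t)
        V = vecProd (λ _ b → P (toℕ b)) ts β
        shuffle : ∀ a b c d → (a ⊗ b) ⊗ (c ⊗ d) ≡ (c ⊗ a) ⊗ (b ⊗ d)
        shuffle a b c d = trans (⊗-assoc a b (c ⊗ d)) (trans (cong (a ⊗_)
          (trans (sym (⊗-assoc b c d)) (trans (cong (_⊗ d) (⊗-comm b c)) (⊗-assoc c b d))))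
          (trans (sym (⊗-assoc a c (b ⊗ d))) (cong (_⊗ (b ⊗ d)) (⊗-comm a c))))

      -- Summing over β first turns the sum into one over the lattice points
      -- with coordinates in {0, …, K}, up to the error η.
      poisson : vecSum n g ≡ boxSum M k′ (λ x → prodSum (w x) t)
      poisson = begin
        vecSum n g
          ≡⟨ vecSum-cong n (λ β → trans (cong (vecProd (λ _ b → P (toℕ b)) t β ⊗_) (sym (boxSum-geometric M k′ z (lastCoord t β))))
               (trans (sym (boxSum-*ˡ M k′ (vecProd (λ _ b → P (toℕ b)) t β) (λ x → z ^ (lastCoord t β ℕ.* x))))
                 (boxSum-cong M k′ λ x → trans (⊗-comm (vecProd (λ _ b → P (toℕ b)) t β) (z ^ (lastCoord t β ℕ.* x))) (absorb x t β)))) ⟩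
        vecSum n (λ β → boxSum M k′ λ x → vecProd (w x) t β)
          ≡⟨ vecSum-boxSum M k′ n (λ β x → vecProd (w x) t β) ⟩
        boxSum M k′ (λ x → vecSum n (vecProd (w x) t))
          ≡⟨ boxSum-cong M k′ (λ x → vecSum-vecProd (w x) t) ⟩
        boxSum M k′ (λ x → prodSum (w x) t) ∎
        where open ≡-Reasoning

      -- Orthogonality in one coordinate. With `x` the multiplier of a lattice point and `p ∸ toℕ t`
      -- in place of `- t`, the index `x′ + (p - t) x` is a multiple of `p` just when `x′` is
      -- congruent to `t x`; otherwise the inner sum is mere error.
      sum-w : ∀ x t → sum {p} (w x t) ≡ boxSum M k′ (λ x′ → S (x′ ℕ.+ (p ℕ.∸ toℕ t) ℕ.* x) p)
      sum-w x t = begin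
        sum {p} (w x t)
          ≡⟨ sum-cong-≗ {p} (λ b → trans (⊗-comm (P (toℕ b)) (z ^ (toℕ b ℕ.* t′ ℕ.* x)))
             (trans (cong (z ^ (toℕ b ℕ.* t′ ℕ.* x) ⊗_) (sym (boxSum-geometric M k′ z (toℕ b))))
               (trans (sym (boxSum-*ˡ M k′ (z ^ (toℕ b ℕ.* t′ ℕ.* x)) (λ x′ → z ^ (toℕ b ℕ.* x′))))
                 (boxSum-cong M k′ λ x′ → trans (sym (^-homo-* z (toℕ b ℕ.* t′ ℕ.* x) (toℕ b ℕ.* x′))) (cong (z ^_) (exponent (toℕ b) t′ x x′)))))) ⟩
        sum {p} (λ b → boxSum M k′ λ x′ → z ^ ((x′ ℕ.+ t′ ℕ.* x) ℕ.* toℕ b))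
          ≡⟨ boxSum-sum M k′ {p} (λ b x′ → z ^ ((x′ ℕ.+ t′ ℕ.* x) ℕ.* toℕ b)) ⟩
        boxSum M k′ (λ x′ → S (x′ ℕ.+ t′ ℕ.* x) p) ∎
        where
        open ≡-Reasoning
        t′ = p ℕ.∸ toℕ t
        exponent : ∀ b t x y → b ℕ.* t ℕ.* x ℕ.+ b ℕ.* y ≡ (y ℕ.+ t ℕ.* x) ℕ.* b
        exponent b t x y = trans (cong (ℕ._+ b ℕ.* y) (ℕ.*-assoc b t x)) (trans (sym (ℕ.*-distribˡ-+ b (t ℕ.* x) y))
          (trans (ℕ.*-comm b _) (cong (ℕ._* b) (ℕ.+-comm (t ℕ.* x) y))))

    module _ (K<p : K ℕ.< p)
             (noPoint : ∀ a → 0 ℕ.< a → a ℕ.≤ K →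
               Any (λ tᵢ → ∀ x → x ℕ.≤ K → (x ℕ.+ (p ℕ.∸ toℕ tᵢ) ℕ.* a) % p ≢ 0) t) where

      private
        y<Y : ∀ x x′ (t : Fin p) → x ℕ.≤ K → x′ ℕ.≤ K → suc (x′ ℕ.+ (p ℕ.∸ toℕ t) ℕ.* x) ℕ.≤ Y
        y<Y x x′ t x≤K x′≤K = s≤s (ℕ.≤-trans (ℕ.+-mono-≤ x′≤K (ℕ.*-mono-≤ (ℕ.m∸n≤m p (toℕ t)) x≤K))
          (ℕ.m≤n+m _ (p ℕ.+ n ℕ.* (p ℕ.* p))))

        sum-w⊑ : ∀ x t → sum {p} (w x t) ⊑ ι X * ι p
        sum-w⊑ x t = subst (_⊑ ι X * ι p) (sym (sum-w x t)) (boxSum-⊑ M k′ (0≤ι p) λ x′ _ → S⊑L (x′ ℕ.+ (p ℕ.∸ toℕ t) ℕ.* x) p)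

        sum-w⊑η : ∀ x t → x ℕ.≤ K → (∀ x′ → x′ ℕ.≤ K → (x′ ℕ.+ (p ℕ.∸ toℕ t) ℕ.* x) % p ≢ 0) → sum {p} (w x t) ⊑ ι X * ι p * η
        sum-w⊑η x t x≤K none = ⊑-weaken (subst (_⊑ ι X * η) (sym (sum-w x t))
          (boxSum-⊑ M k′ 0≤η λ x′ x′≤K → S-nonmultiple (x′ ℕ.+ (p ℕ.∸ toℕ t) ℕ.* x) (y<Y x x′ t x≤K x′≤K) (none x′ x′≤K)))
          (*-monoˡ η 0≤η (subst (_≤ ι X * ι p) (ℚ.*-identityʳ (ι X)) (*-monoʳ (ι X) (0≤ι X) (1≤ι {p} (s≤s z≤n)))))

        -- For the multiplier 0 only `x′ = 0` solves the congruence, as `x′ ≤ K < p`. It contributes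
        -- at most `p`, and all the errors together at most 1.
        sum-w0⊑ : ∀ t → sum {p} (w 0 t) ⊑ ι (suc p)
        sum-w0⊑ t = ⊑-weaken (subst (_⊑ ι p + ι X * η) (sym (sum-w 0 t))
          (boxSum-⊑-0 M k′ 0≤η (S⊑L (0 ℕ.+ (p ℕ.∸ toℕ t) ℕ.* 0) p) λ x 0<x x≤K → S-nonmultiple (x ℕ.+ (p ℕ.∸ toℕ t) ℕ.* 0) (y<Y 0 x t z≤n x≤K)
            λ eq → ℕ.<⇒≢ 0<x (sym (trans (sym (ℕ.m<n⇒m%n≡m (ℕ.≤-<-trans x≤K K<p))) (trans (cong (_% p) (x≡ x)) eq)))))
          (ℚ.≤-trans (ℚ.+-monoʳ-≤ (ι p) Xη≤1) (ℚ.≤-reflexive (ℚ.+-comm (ι p) 1ℚ)))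
          where
          x≡ : ∀ x → x ≡ x ℕ.+ (p ℕ.∸ toℕ t) ℕ.* 0
          x≡ x = sym (trans (cong (x ℕ.+_) (ℕ.*-zeroʳ (p ℕ.∸ toℕ t))) (ℕ.+-identityʳ x))

      -- By `noPoint` every multiplier other than 0 has a coordinate whose sum is mere error, and
      -- this supplies the factor `η`.
      vecSum-g⊑ : vecSum n g ⊑ ι (suc p) ^ℚ n + 1ℚ
      vecSum-g⊑ = ⊑-weaken (subst (_⊑ ι (suc p) ^ℚ n + ι X * ((ι X * ι p) ^ℚ n * η)) (sym poisson)
        (boxSum-⊑-0 M k′ (0≤-* (0≤-^ (0≤-* (0≤ι X) (0≤ι p)) n) 0≤η) (prodSum-⊑ (w 0) t sum-w0⊑)
          λ x 0<x x≤K → prodSum-⊑-any (w x) t (sum-w⊑ x) (Any.map (λ {tᵢ} → sum-w⊑η x tᵢ x≤K) (noPoint x 0<x x≤K))))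
        (ℚ.+-monoʳ-≤ (ι (suc p) ^ℚ n) X[Xp]ⁿη≤1)

      module _ (noRelation : ∀ β → ¬ All (λ b → toℕ b ≡ 0) β →
                  Any (λ b → H ℕ.≤ dist p (toℕ b)) β ⊎ H ℕ.≤ dist p (lastCoord t β))
               (0<H : 0 ℕ.< H) (ρ : ℚ) (0≤ρ : 0ℚ ≤ ρ) (ρ2H≡p : ρ * (ι 2 * ι H) ≡ ι p)
               (ρ-small : ρ ^ℚ k′ * ι p ^ℚ n ≤ ι X) where

        private
          R : ℚ
          R = ρ ^ℚ k′

          P⊑R : ∀ α → suc α ℕ.≤ Y → H ℕ.≤ dist p α → P α ⊑ R
          P⊑R α α<Y H≤d = ⊑-^ (S-far α (suc M) H α<Y 0<H H≤d 0≤ρ ρ2H≡p) k′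

          g⊑ : ∀ β → ¬ All (λ b → toℕ b ≡ 0) β → g β ⊑ ι X ^ℚ n * R
          g⊑ β β≢0 with noRelation β β≢0
          ... | inj₁ any = vecProd-⊑-any (λ _ b → P (toℕ b)) (λ _ b → P⊑X (toℕ b)) (P⊑X (lastCoord t β)) t β
                  (Any.map (λ {b} H≤d _ → P⊑R (toℕ b) (s≤s (ℕ.≤-trans (ℕ.<⇒≤ (Fin.toℕ<n b)) (ℕ.≤-trans (ℕ.m≤m+n p _) (ℕ.m≤m+n _ _)))) H≤d) any)
          ... | inj₂ H≤d = ⊑-* (vecProd-⊑ (λ _ b → P (toℕ b)) (λ _ b → P⊑X (toℕ b)) t β)
                  (P⊑R (lastCoord t β) (s≤s (ℕ.≤-trans (lastCoord-≤ t β) (ℕ.≤-trans (ℕ.m≤n+m _ p) (ℕ.m≤m+n _ _)))) H≤d)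

          P0 : P 0 ≡ ιℂ X
          P0 = trans (cong (_^ k′) (S0 (suc M))) (sym (ιℂ-^ (suc M) k′))

          g0 : g (Vec.replicate n Fin.zero) ≡ ιℂ (X ℕ.^ n ℕ.* X)
          g0 = trans (cong₂ _⊗_ (prod0 t) (trans (cong P (lastCoord-0 t)) P0)) (sym (ιℂ-* (X ℕ.^ n) X))
            where
            prod0 : ∀ {m} (t : Vec (Fin p) m) → vecProd (λ _ b → P (toℕ b)) t (Vec.replicate m Fin.zero) ≡ ιℂ (X ℕ.^ m)
            prod0 []       = cong (_+i 0ℚ) (sym (ℚ.+-identityʳ 1ℚ))
            prod0 {suc m} (_ ∷ ts) = trans (cong₂ _⊗_ P0 (prod0 ts)) (sym (ιℂ-* X (X ℕ.^ m)))

          Z : ℚ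
          Z = ι (X ℕ.^ n ℕ.* X)

          0≤XⁿR : 0ℚ ≤ ι X ^ℚ n * R
          0≤XⁿR = 0≤-* (0≤-^ (0≤ι X) n) (0≤-^ 0≤ρ k′)

          Z≤ : Z ≤ ι (suc p) ^ℚ n + 1ℚ + (ι p ^ℚ n - 1ℚ) * (ι X ^ℚ n * R)
          Z≤ with rest , eq , rest⊑ ← vecSum-split n g 0≤XⁿR g⊑ =
            ιℂ⊑⇒≤ (X ℕ.^ n ℕ.* X) (subst (_⊑ ι (suc p) ^ℚ n + 1ℚ + (ι p ^ℚ n - 1ℚ) * (ι X ^ℚ n * R))
              (trans (cong (_⊕ neg rest) eq) (trans (cancel (g (Vec.replicate n Fin.zero)) rest) g0))
              (⊑-+ vecSum-g⊑ (⊑-neg rest⊑)))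
            where
            cancel : ∀ a b → (a ⊕ b) ⊕ neg b ≡ a
            cancel a b = trans (⊕-assoc a b (neg b))
              (trans (cong (a ⊕_) (CommutativeRing.-‿inverseʳ ℂ-ring b)) (CommutativeRing.+-identityʳ ℂ-ring a))

        -- The bound `Z≤` is multiplied by `pⁿ`. Since `pⁿ R ≤ X`, its last term is at most
        -- `(pⁿ - 1) Xⁿ X`, which cancels all but one of the `pⁿ` copies of `Xⁿ X` on the left.
        point-count : X ℕ.^ n ℕ.* X ℕ.≤ p ℕ.^ n ℕ.* suc (suc p ℕ.^ n)
        point-count = ι-cancel (subst (Z ≤_) (sym (trans (ι-* (p ℕ.^ n) _) (cong₂ _*_ (ι-^ p n) (cong (1ℚ +_) (ι-^ (suc p) n)))))
          (≤-by _ (0≤-+ (0≤-* (0≤-^ (0≤ι p) n) (gap Z≤)) (0≤-* (0≤-* (gap 1≤pⁿ) (0≤-^ (0≤ι X) n)) (gap ρ-small)))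
            (trans (cong (λ z → z + (ι p ^ℚ n * (ι (suc p) ^ℚ n + 1ℚ + (ι p ^ℚ n - 1ℚ) * (ι X ^ℚ n * R) - z)
                + (ι p ^ℚ n - 1ℚ) * ι X ^ℚ n * (ι X - R * ι p ^ℚ n))) Z≡)
              (eq (ι X ^ℚ n) (ι X) (ι p ^ℚ n) (ι (suc p) ^ℚ n) R))))
          where
          Z≡ : Z ≡ ι X ^ℚ n * ι X
          Z≡ = trans (ι-* (X ℕ.^ n) X) (cong (_* ι X) (ι-^ X n))
          1≤pⁿ : 1ℚ ≤ ι p ^ℚ n
          1≤pⁿ = subst (1ℚ ≤_) (ι-^ p n) (1≤ι (ℕ.m^n>0 p n))
          eq : ∀ y x a b r → y * x + (a * (b + 1ℚ + (a - 1ℚ) * (y * r) - y * x) + (a - 1ℚ) * y * (x - r * a)) ≡ a * (1ℚ + b)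
          eq = solve-∀ ℚ-ring

-- From heights to relations and lattice points

module HeightBound where

  open CharacterSums using (ι; 0<1; 0<ι; 0≤ι; 0<-*; 0≤-*; *-cancelˡ; ι-*; ι-mono; ι-^; _^ℚ_;
    ^-mono; ^ℚ-distrib-*; ^ℚ-assocʳ; 0≤-^; dist; lastCoord; module Fourier)
  open import Defs using (⟨_,1⟩; maxResidue; height; _⊙_; IsZero; ∥_∥; ∥_∥∞; allVecs; IsRelation; isRelation?; dualHeight; dualHeight-nonZero)
  open import Data.Empty using (⊥)
  open import Data.Fin.Base using (Fin; toℕ)
  import Data.Fin.Properties as Fin
  import Data.List.Extrema.Nat as Extrema
  import Data.List.Relation.Unary.Any as ListAny
  open import Data.List.Membership.Propositional using (_∈_; lose)
  open import Data.List.Membership.Propositional.Properties using (∈-cartesianProductWith⁺; ∈-filter⁺; ∈-map⁺; ∈-upTo⁺; ∈-allFin)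
  open import Data.Nat.Base
  open import Data.Nat.DivMod
  open import Data.Nat.Divisibility using (_∣_; divides; ∣m∣n⇒∣m+n; ∣m+n∣m⇒∣n; n∣m*n; m%n≡0⇒n∣m)
  open import Data.Nat.Primality using (Prime; prime⇒irreducible; prime⇒nonTrivial)
  open import Data.Nat.Properties
  open import Data.Product.Base using (_×_; _,_; ∃-syntax)
  open import Data.Rational.Base as ℚ using (ℚ)
  import Data.Rational.Properties as ℚ
  open import Data.Sum.Base using (_⊎_; inj₁; inj₂)
  open import Data.Vec.Base as Vec using (Vec; []; _∷_; _∷ʳ_)
  open import Data.Vec.Relation.Unary.All as All using (All; []; _∷_)
  import Data.Vec.Relation.Unary.All.Properties as All
  open import Data.Vec.Relation.Unary.Any as Any using (Any; here; there)
  open import Relation.Binary.PropositionalEquality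
  open import Relation.Nullary.Negation using (¬_; contradiction)

  ^-distribʳ-* : ∀ k a b → (a * b) ^ k ≡ a ^ k * b ^ k
  ^-distribʳ-* zero    a b = refl
  ^-distribʳ-* (suc k) a b = trans (cong (a * b *_) (^-distribʳ-* k a b)) ([m*n]*[o*p]≡[m*o]*[n*p] a b (a ^ k) (b ^ k))

  any-∷ʳ : ∀ {A : Set} {P : A → Set} {n} (xs : Vec A n) {x} → Any P (xs ∷ʳ x) → Any P xs ⊎ P x
  any-∷ʳ []       (here Px)   = inj₂ Px
  any-∷ʳ (y ∷ ys) (here Py)   = inj₁ (here Py)
  any-∷ʳ (y ∷ ys) (there any) with any-∷ʳ ys any
  ... | inj₁ any′ = inj₁ (there any′)
  ... | inj₂ Px   = inj₂ Px

  all-∷ʳ⁻ : ∀ {A : Set} {P : A → Set} {n} (xs : Vec A n) {x} → All P (xs ∷ʳ x) → All P xs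
  all-∷ʳ⁻ []       _          = []
  all-∷ʳ⁻ (y ∷ ys) (Py ∷ all) = Py ∷ all-∷ʳ⁻ ys all

  module _ {p : ℕ} .{{_ : NonZero p}} where

    height≤maxResidue : ∀ {n} (t : Vec (Fin p) n) a → 0 < a → a < p → height t ≤ maxResidue t a
    height≤maxResidue t (suc a) _ a<p = Extrema.min≤v⁺ p _
      (inj₂ (lose (∈-map⁺ (maxResidue t) (∈-map⁺ suc (∈-upTo⁺ (<⇒<pred a<p)))) ≤-refl))
      where
      <⇒<pred : ∀ {m} → suc a < m → a < m ∸ 1
      <⇒<pred (s≤s lt) = lt

    maxResidue≤ : ∀ {n} (t : Vec (Fin p) n) a K → a ≤ K → All (λ x → (a * toℕ x) % p ≤ K) t → maxResidue t a ≤ K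
    maxResidue≤ t a K a≤K all = Extrema.max≤v⁺ a≤K (All.toList⁺ (All.map⁺ all))

    height<p : ∀ {n} (t : Vec (Fin p) n) → 1 < p → height t ≤ p ∸ 1
    height<p t 1<p = ≤-trans (height≤maxResidue t 1 (s≤s z≤n) 1<p)
      (maxResidue≤ t 1 (p ∸ 1) (∸-monoˡ-≤ 1 1<p) (All.universal (λ x → <⇒≤pred′ (m%n<n (1 * toℕ x) p)) t))
      where
      <⇒≤pred′ : ∀ {m k} → m < k → m ≤ k ∸ 1
      <⇒≤pred′ (s≤s le) = le

    -- If `x + (p - tᵢ) a ≡ 0` with `x ≤ K < p`, then `x` is the residue of `a tᵢ`. A multiplier
    -- admitting such an `x` in every coordinate would witness a height of at most `K`.
    height-escape : ∀ {n} (t : Vec (Fin p) n) K → K < p → K < height t → ∀ a → 0 < a → a ≤ K →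
                    Any (λ tᵢ → ∀ x → x ≤ K → (x + (p ∸ toℕ tᵢ) * a) % p ≢ 0) t
    height-escape t K K<p K<h a 0<a a≤K
      with All.decide (λ tᵢ → ≤-<-connex ((a * toℕ tᵢ) % p) K) t
    ... | inj₂ any = Any.map (λ {tᵢ} → escape tᵢ) any
      where
      escape : ∀ tᵢ → K < (a * toℕ tᵢ) % p → ∀ x → x ≤ K → (x + (p ∸ toℕ tᵢ) * a) % p ≢ 0
      escape tᵢ K< x x≤K ≡0 = <⇒≱ K< (≤-trans (≤-reflexive (begin
        (a * toℕ tᵢ) % p                                         ≡⟨ cong (_% p) (*-comm a (toℕ tᵢ)) ⟩
        (toℕ tᵢ * a) % p                                         ≡⟨ %-remove-+ˡ (toℕ tᵢ * a) (m%n≡0⇒n∣m _ p ≡0) ⟨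
        (x + (p ∸ toℕ tᵢ) * a + toℕ tᵢ * a) % p
          ≡⟨ cong (_% p) (trans (+-assoc x _ _)
            (cong (x +_) (trans (sym (*-distribʳ-+ a (p ∸ toℕ tᵢ) (toℕ tᵢ))) (cong (_* a) (m∸n+n≡m (<⇒≤ (Fin.toℕ<n tᵢ))))))) ⟩
        (x + p * a) % p
          ≡⟨ trans (cong (λ y → (x + y) % p) (*-comm p a)) ([m+kn]%n≡m%n x a p) ⟩
        x % p                                                    ≡⟨ m<n⇒m%n≡m (≤-<-trans x≤K K<p) ⟩
        x                                                        ∎)) x≤K)
        where open ≡-Reasoning
    ... | inj₁ all = contradiction (≤-trans (height≤maxResidue t a 0<a (≤-<-trans a≤K K<p)) (maxResidue≤ t a K a≤K all)) (<⇒≱ K<h)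

    ∥∥≡dist : ∀ x → ∥ x ∥ ≡ dist p (toℕ x)
    ∥∥≡dist x = cong (λ k → k ⊓ (p ∸ k)) (sym (m<n⇒m%n≡m (Fin.toℕ<n x)))

    ∥mod∥≡dist : ∀ α → ∥ α mod p ∥ ≡ dist p α
    ∥mod∥≡dist α = cong (λ k → k ⊓ (p ∸ k)) (Fin.toℕ-fromℕ< (m%n<n α p))

    ∈-allVecs : ∀ {n} (α : Vec (Fin p) n) → α ∈ allVecs n
    ∈-allVecs []      = ListAny.here refl
    ∈-allVecs (x ∷ α) = ∈-cartesianProductWith⁺ _∷_ (∈-allFin x) (∈-allVecs α)

    dualHeight≤ : ∀ {n} (t α : Vec (Fin p) n) → IsRelation t α → dualHeight t ≤ ∥ α ∥∞
    dualHeight≤ t α rel = Extrema.min≤v⁺ p _ (inj₂ (lose (∈-map⁺ ∥_∥∞ (∈-filter⁺ (isRelation? t) (∈-allVecs α) rel)) ≤-refl))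

    -- Coordinatewise `b t + b (p - t) = b p`, so `β ⊙ t + lastCoord t β` is a multiple of `p`;
    -- reducing the last coordinate removes another multiple.
    lastCoord-relation : ∀ {n} (t β : Vec (Fin p) n) → ¬ IsZero β → 1 < p → IsRelation ⟨ t ,1⟩ (β ∷ʳ (lastCoord t β mod p))
    lastCoord-relation t β β≢0 1<p = (λ α≡0 → β≢0 (all-∷ʳ⁻ β α≡0)) ,
      ∣m+n∣m⇒∣n (subst (p ∣_) split (divisible t β)) (n∣m*n (A / p))
      where
      A = lastCoord t β
      ⊙-∷ʳ : ∀ {m} (α u : Vec (Fin p) m) {x y} → (α ∷ʳ x) ⊙ (u ∷ʳ y) ≡ α ⊙ u + toℕ x * toℕ y
      ⊙-∷ʳ []      []      = +-identityʳ _
      ⊙-∷ʳ (a ∷ α) (b ∷ u) = trans (cong (toℕ a * toℕ b +_) (⊙-∷ʳ α u)) (sym (+-assoc (toℕ a * toℕ b) _ _))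
      split : β ⊙ t + A ≡ A / p * p + (β ∷ʳ (A mod p)) ⊙ ⟨ t ,1⟩
      split = begin
        β ⊙ t + A                              ≡⟨ cong (β ⊙ t +_) (trans (m≡m%n+[m/n]*n A p) (+-comm (A % p) _)) ⟩
        β ⊙ t + (A / p * p + A % p)            ≡⟨ +-assoc (β ⊙ t) (A / p * p) (A % p) ⟨
        β ⊙ t + A / p * p + A % p              ≡⟨ cong (_+ A % p) (+-comm (β ⊙ t) (A / p * p)) ⟩
        A / p * p + β ⊙ t + A % p              ≡⟨ +-assoc (A / p * p) (β ⊙ t) (A % p) ⟩
        A / p * p + (β ⊙ t + A % p)            ≡⟨ cong (λ x → A / p * p + (β ⊙ t + x)) (*-identityʳ (A % p)) ⟨
        A / p * p + (β ⊙ t + A % p * 1)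
          ≡⟨ cong (λ x → A / p * p + (β ⊙ t + x)) (cong₂ _*_ (Fin.toℕ-fromℕ< (m%n<n A p))
            (trans (Fin.toℕ-fromℕ< (m%n<n 1 p)) (m<n⇒m%n≡m 1<p))) ⟨
        A / p * p + (β ⊙ t + toℕ (A mod p) * toℕ (1 mod p))   ≡⟨ cong (A / p * p +_) (⊙-∷ʳ β t) ⟨
        A / p * p + (β ∷ʳ (A mod p)) ⊙ ⟨ t ,1⟩   ∎
        where open ≡-Reasoning
      divisible : ∀ {m} (u β : Vec (Fin p) m) → p ∣ β ⊙ u + lastCoord u β
      divisible []      []      = divides 0 refl
      divisible (x ∷ u) (b ∷ β) = subst (p ∣_) (begin
        toℕ b * p + (β ⊙ u + lastCoord u β)
          ≡⟨ cong (λ k → toℕ b * k + (β ⊙ u + lastCoord u β)) (m+[n∸m]≡n (<⇒≤ (Fin.toℕ<n x))) ⟨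
        toℕ b * (toℕ x + (p ∸ toℕ x)) + (β ⊙ u + lastCoord u β)
          ≡⟨ cong (_+ (β ⊙ u + lastCoord u β)) (*-distribˡ-+ (toℕ b) (toℕ x) (p ∸ toℕ x)) ⟩
        toℕ b * toℕ x + toℕ b * (p ∸ toℕ x) + (β ⊙ u + lastCoord u β)
          ≡⟨ [m+n]+[o+p]≡[m+o]+[n+p] (toℕ b * toℕ x) _ (β ⊙ u) _ ⟩
        toℕ b * toℕ x + β ⊙ u + (toℕ b * (p ∸ toℕ x) + lastCoord u β) ∎)
        (∣m∣n⇒∣m+n (n∣m*n (toℕ b)) (divisible u β))
        where
        open ≡-Reasoning
        open import Algebra.Properties.CommutativeSemigroup +-commutativeSemigroup using () renaming (interchange to [m+n]+[o+p]≡[m+o]+[n+p])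

    dualHeight-escape : ∀ {n} (t : Vec (Fin p) n) → 1 < p → ∀ β → ¬ IsZero β → let H = dualHeight ⟨ t ,1⟩ in
                        Any (λ b → H ≤ dist p (toℕ b)) β ⊎ H ≤ dist p (lastCoord t β)
    dualHeight-escape t 1<p β β≢0 with All.decide (λ x → <-≤-connex ∥ x ∥ (dualHeight ⟨ t ,1⟩)) (β ∷ʳ (lastCoord t β mod p))
    ... | inj₁ all = contradiction
      -- The default value 0 of the maximum is also below the dual height, which is positive.
      (Extrema.max<v⁺ (>-nonZero⁻¹ _ {{dualHeight-nonZero ⟨ t ,1⟩}}) (All.toList⁺ (All.map⁺ all)))
      (≤⇒≯ (dualHeight≤ ⟨ t ,1⟩ _ (lastCoord-relation t β β≢0 1<p)))
    ... | inj₂ any with any-∷ʳ β any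
    ...   | inj₁ any′ = inj₁ (Any.map (λ {b} → subst (dualHeight ⟨ t ,1⟩ ≤_) (∥∥≡dist b)) any′)
    ...   | inj₂ H≤   = inj₂ (subst (dualHeight ⟨ t ,1⟩ ≤_) (∥mod∥≡dist (lastCoord t β)) H≤)

    -- Twice `∥ x ∥` is at most `p` for every `x`, so any nonzero relation will do; the vector of
    -- ones is completed to one.
    2*dualHeight≤p : ∀ {n} (t : Vec (Fin p) (suc n)) → 1 < p → 2 * dualHeight ⟨ t ,1⟩ ≤ p
    2*dualHeight≤p {n} t 1<p = ≤-trans (*-monoʳ-≤ 2 (≤-trans (dualHeight≤ ⟨ t ,1⟩ _ (lastCoord-relation t β β≢0 1<p))
        (Extrema.max≤v⁺ z≤n (All.toList⁺ (All.map⁺ (All.universal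
          (λ x → subst (_≤ p / 2) (m*n/n≡m ∥ x ∥ 2) (/-monoˡ-≤ 2 (small x))) (β ∷ʳ (lastCoord t β mod p))))))))
        (≤-trans (≤-reflexive (*-comm 2 (p / 2))) (m/n*n≤m p 2))
      where
      β : Vec (Fin p) (suc n)
      β = Vec.replicate (suc n) (1 mod p)
      β≢0 : ¬ IsZero β
      β≢0 (1≡0 ∷ _) = contradiction (trans (sym (trans (Fin.toℕ-fromℕ< (m%n<n 1 p)) (m<n⇒m%n≡m 1<p))) 1≡0) (λ ())
      small : ∀ x → ∥ x ∥ * 2 ≤ p
      small x = ≤-trans (≤-reflexive (trans (*-comm ∥ x ∥ 2) (cong (∥ x ∥ +_) (+-identityʳ ∥ x ∥))))
        (≤-trans (+-mono-≤ (m⊓n≤m (toℕ x) (p ∸ toℕ x)) (m⊓n≤n (toℕ x) (p ∸ toℕ x))) (≤-reflexive (m+[n∸m]≡n (<⇒≤ (Fin.toℕ<n x)))))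

  -- Here the dimension `d > 2` enters: `Xⁿ X ≥ X³ ≥ pⁿ p²ⁿ`, and `p²ⁿ > 1 + (p + 1)ⁿ` because
  -- `p² ≥ 2 (p + 1)` for `p ≥ 3`.
  point-bound : ∀ n q X → 2 ≤ n → 1 ≤ q → let p = suc (q + q) in p ^ n ≤ X → ¬ (X ^ n * X ≤ p ^ n * suc (suc p ^ n))
  point-bound n q X 2≤n 1≤q pⁿ≤X le = <⇒≱ gap-ineq (*-cancelˡ-≤ (p ^ n) {{m^n≢0 p n}} (begin
    p ^ n * (p * p) ^ n            ≡⟨ cong (p ^ n *_) (^-distribʳ-* n p p) ⟩
    p ^ n * (p ^ n * p ^ n)        ≤⟨ *-mono-≤ pⁿ≤X (*-mono-≤ pⁿ≤X pⁿ≤X) ⟩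
    X * (X * X)                    ≡⟨ trans (*-comm X (X * X)) (cong (_* X) (cong (X *_) (sym (*-identityʳ X)))) ⟩
    X ^ 2 * X                      ≤⟨ *-monoˡ-≤ X (^-monoʳ-≤ X {{>-nonZero (≤-trans (m^n>0 p n) pⁿ≤X)}} 2≤n) ⟩
    X ^ n * X                      ≤⟨ le ⟩
    p ^ n * suc (suc p ^ n)        ∎))
    where
    open ≤-Reasoning
    p = suc (q + q)
    2≤p : 2 ≤ p
    2≤p = s≤s (≤-trans 1≤q (m≤m+n q q))
    2[p+1]≤pp : 2 * suc p ≤ p * p
    2[p+1]≤pp with r , refl ← m≤n⇒∃[o]m+o≡n 1≤q = begin
      2 * suc p                                        ≤⟨ m≤m+n (2 * suc p) (suc (4 * r * r + 8 * r)) ⟩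
      2 * suc p + suc (4 * r * r + 8 * r)              ≡⟨ eq r ⟩
      p * p                                            ∎
      where
      open import Data.Nat.Tactic.RingSolver using (solve-∀)
      eq : ∀ r → 2 * (2 + ((1 + r) + (1 + r))) + suc (4 * r * r + 8 * r) ≡ (1 + ((1 + r) + (1 + r))) * (1 + ((1 + r) + (1 + r)))
      eq = solve-∀
    gap-ineq : suc (suc p ^ n) < (p * p) ^ n
    gap-ineq = begin-strict
      suc (suc p ^ n)              <⟨ +-monoˡ-< (suc p ^ n) (^-monoʳ-< (suc p) (s≤s (s≤s z≤n)) (≤-trans (s≤s z≤n) 2≤n)) ⟩
      suc p ^ n + suc p ^ n        ≡⟨ cong (suc p ^ n +_) (+-identityʳ (suc p ^ n)) ⟨
      2 * suc p ^ n                ≤⟨ *-monoˡ-≤ (suc p ^ n) (^-monoʳ-≤ 2 (≤-trans (s≤s z≤n) 2≤n)) ⟩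
      2 ^ n * suc p ^ n            ≡⟨ ^-distribʳ-* n 2 (suc p) ⟨
      (2 * suc p) ^ n              ≤⟨ ^-monoˡ-≤ n 2[p+1]≤pp ⟩
      (p * p) ^ n                  ∎

  even⊎odd : ∀ m → (∃[ q ] m ≡ q + q) ⊎ (∃[ q ] m ≡ suc (q + q))
  even⊎odd zero    = inj₁ (0 , refl)
  even⊎odd (suc m) with even⊎odd m
  ... | inj₁ (q , eq) = inj₂ (q , cong suc eq)
  ... | inj₂ (q , eq) = inj₁ (suc q , trans (cong suc eq) (cong suc (sym (+-suc q q))))

  prime⇒2⊎odd : ∀ {p} → Prime p → p ≡ 2 ⊎ ∃[ q ] 1 ≤ q × p ≡ suc (q + q)
  prime⇒2⊎odd {p} pr with even⊎odd p
  ... | inj₁ (q , refl) with prime⇒irreducible pr (divides q (trans (cong (q +_) (sym (+-identityʳ q))) (*-comm 2 q)))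
  ...   | inj₁ ()
  ...   | inj₂ 2≡p = inj₁ (sym 2≡p)
  prime⇒2⊎odd {p} pr | inj₂ (zero , refl)  = contradiction (nonTrivial⇒n>1 1 {{prime⇒nonTrivial pr}}) λ { (s≤s ()) }
  prime⇒2⊎odd {p} pr | inj₂ (suc q , refl) = inj₂ (suc q , s≤s z≤n , refl)

  -- The hypothesis is `ρᵏ p ≤ (M + 1)ᵏ` for `ρ = p / 2 H`, cleared of denominators; its n-th power
  -- is the smallness that the count requires.
  ratio-bound : ∀ p H .{{_ : NonZero H}} k M n → p ^ suc k ≤ (suc M * (2 * H)) ^ k →
                ∃[ ρ ] ℚ.0ℚ ℚ.≤ ρ × ρ ℚ.* (ι 2 ℚ.* ι H) ≡ ι p × ρ ^ℚ (k * n) ℚ.* ι p ^ℚ n ℚ.≤ ι (suc M ^ (k * n))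
  ratio-bound p H k M n large = ρ , 0≤ρ , ρ2H≡p , ρ-small
    where
    open ≡-Reasoning
    h : ℚ
    h = ι 2 ℚ.* ι H
    0<h : ℚ.0ℚ ℚ.< h
    0<h = 0<-* (0<ι 2) (0<ι H )
    instance
      h-pos = ℚ.positive 0<h
      h-nz = ℚ.pos⇒nonZero h
    ρ : ℚ
    ρ = ι p ℚ.* ℚ.1/ h
    0≤ρ : ℚ.0ℚ ℚ.≤ ρ
    0≤ρ = 0≤-* (0≤ι p) (ℚ.<⇒≤ (ℚ.positive⁻¹ (ℚ.1/ h) {{ℚ.1/pos⇒pos h}}))
    ρ2H≡p : ρ ℚ.* h ≡ ι p
    ρ2H≡p = trans (ℚ.*-assoc (ι p) (ℚ.1/ h) h) (trans (cong (ι p ℚ.*_) (ℚ.*-inverseˡ h)) (ℚ.*-identityʳ (ι p)))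
    ρᵏp≤ : ρ ^ℚ k ℚ.* ι p ℚ.≤ ι (suc M ^ k)
    ρᵏp≤ = *-cancelˡ (h ^ℚ k) (0<^ k) (ℚ.≤-trans (ℚ.≤-reflexive (begin
      h ^ℚ k ℚ.* (ρ ^ℚ k ℚ.* ι p)        ≡⟨ ℚ.*-assoc (h ^ℚ k) (ρ ^ℚ k) (ι p) ⟨
      h ^ℚ k ℚ.* ρ ^ℚ k ℚ.* ι p
        ≡⟨ cong (ℚ._* ι p) (trans (sym (^ℚ-distrib-* h ρ k)) (cong (_^ℚ k) (trans (ℚ.*-comm h ρ) ρ2H≡p))) ⟩
      ι p ^ℚ k ℚ.* ι p                   ≡⟨ trans (ℚ.*-comm (ι p ^ℚ k) (ι p)) (sym (ι-^ p (suc k))) ⟩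
      ι (p ^ suc k)                      ∎)) (ℚ.≤-trans (ι-mono large) (ℚ.≤-reflexive (begin
      ι ((suc M * (2 * H)) ^ k)          ≡⟨ cong ι (trans (^-distribʳ-* k (suc M) (2 * H)) (*-comm (suc M ^ k) _)) ⟩
      ι ((2 * H) ^ k * suc M ^ k)
        ≡⟨ trans (ι-* ((2 * H) ^ k) (suc M ^ k)) (cong (ℚ._* ι (suc M ^ k)) (trans (ι-^ (2 * H) k) (cong (_^ℚ k) (ι-* 2 H)))) ⟩
      h ^ℚ k ℚ.* ι (suc M ^ k)           ∎))))
      where
      0<^ : ∀ k → ℚ.0ℚ ℚ.< h ^ℚ k
      0<^ zero    = 0<1
      0<^ (suc k) = 0<-* 0<h (0<^ k)
    ρ-small : ρ ^ℚ (k * n) ℚ.* ι p ^ℚ n ℚ.≤ ι (suc M ^ (k * n))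
    ρ-small = ℚ.≤-trans (ℚ.≤-reflexive (trans (cong (ℚ._* ι p ^ℚ n) (sym (^ℚ-assocʳ ρ k n))) (sym (^ℚ-distrib-* (ρ ^ℚ k) (ι p) n))))
      (ℚ.≤-trans (^-mono (0≤-* (0≤-^ 0≤ρ k) (0≤ι p)) ρᵏp≤ n)
        (ℚ.≤-reflexive (trans (sym (ι-^ (suc M ^ k) n)) (cong ι (^-*-assoc (suc M) k n)))))

  module _ {p : ℕ} .{{_ : NonZero p}} (pr : Prime p) {n : ℕ} (2≤n : 2 ≤ n) (t : Vec (Fin p) n) where

    private
      H = dualHeight ⟨ t ,1⟩

      0<H : 0 < H
      0<H = >-nonZero⁻¹ H {{dualHeight-nonZero ⟨ t ,1⟩}}

      1<p : 1 < p
      1<p = nonTrivial⇒n>1 p {{prime⇒nonTrivial pr}}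

      2H≤p : 2 * H ≤ p
      2H≤p = go 2≤n t
        where
        go : ∀ {n} → 2 ≤ n → (t : Vec (Fin p) n) → 2 * dualHeight ⟨ t ,1⟩ ≤ p
        go (s≤s _) t = 2*dualHeight≤p t 1<p

    -- By contradiction: `K < height t` supplies both the absence of lattice points and, through
    -- `height t < p`, the inequality `K < p` that keeps the residues up to `K` distinct. The prime
    -- 2 is outside the reach of the sine bound.
    height-bound : ∀ k M → p ^ suc k ≤ (suc M * (2 * H)) ^ k → height t ≤ k * n * M
    height-bound k M large = ≮⇒≥ λ K<h → escape K<h (prime⇒2⊎odd pr)
      where
      open ≤-Reasoning
      K = k * n * M
      p≤[1+M]ᵏ : p ≤ suc M ^ k
      p≤[1+M]ᵏ = *-cancelʳ-≤ p (suc M ^ k) (p ^ k) {{m^n≢0 p k}} (begin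
        p ^ suc k                    ≤⟨ large ⟩
        (suc M * (2 * H)) ^ k        ≤⟨ ^-monoˡ-≤ k (*-monoʳ-≤ (suc M) 2H≤p) ⟩
        (suc M * p) ^ k              ≡⟨ ^-distribʳ-* k (suc M) p ⟩
        suc M ^ k * p ^ k            ∎)
      escape : K < height t → p ≡ 2 ⊎ ∃[ q ] 1 ≤ q × p ≡ suc (q + q) → ⊥
      -- Here `height t ≤ 1`, while `2 ≤ (M + 1)ᵏ` forces `k ≥ 1` and `M ≥ 1`, hence `1 ≤ K`.
      escape K<h (inj₁ refl) = <⇒≱ K<h (≤-trans (height<p t 1<p) (*-mono-≤ (*-mono-≤ (0<k k p≤[1+M]ᵏ) (≤-trans (s≤s z≤n) 2≤n)) (0<M M p≤[1+M]ᵏ)))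
        where
        0<k : ∀ k → 2 ≤ suc M ^ k → 1 ≤ k
        0<k zero    (s≤s ())
        0<k (suc k) _ = s≤s z≤n
        0<M : ∀ M → 2 ≤ suc M ^ k → 1 ≤ M
        0<M zero    le = contradiction (subst (2 ≤_) (^-zeroˡ k) le) λ { (s≤s ()) }
        0<M (suc M) _  = s≤s z≤n
      escape K<h (inj₂ (q , 1≤q , refl)) = finish (ratio-bound p H {{>-nonZero 0<H}} k M n large)
        where
        module F = Fourier q 1≤q n t (k * n) M H
        K<p : K < p
        K<p = <-≤-trans K<h (≤-trans (height<p t 1<p) (n≤1+n _))
        pⁿ≤X : p ^ n ≤ suc M ^ (k * n)
        pⁿ≤X = ≤-trans (^-monoˡ-≤ n p≤[1+M]ᵏ) (≤-reflexive (^-*-assoc (suc M) k n))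
        finish : ∃[ ρ ] ℚ.0ℚ ℚ.≤ ρ × ρ ℚ.* (ι 2 ℚ.* ι H) ≡ ι p × ρ ^ℚ (k * n) ℚ.* ι p ^ℚ n ℚ.≤ ι (suc M ^ (k * n)) → ⊥
        finish (ρ , 0≤ρ , ρ2H≡p , ρ-small) = point-bound n q (suc M ^ (k * n)) 2≤n 1≤q pⁿ≤X
          (F.point-count K<p (height-escape t K K<p K<h) (dualHeight-escape t 1<p) 0<H ρ 0≤ρ ρ2H≡p ρ-small)

-- Powers of 1 + 1 / T against e and the logarithm, in natural numbers

module Exponential where

  open HeightBound using (^-distribʳ-*)
  open import Data.Nat.Base
  open import Data.Nat.Divisibility using (_∣_; ∣-trans; m∣m*n; m≤n⇒m!∣n!)
  open import Data.Nat.DivMod using (_/_; m/n*n≡m)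
  open import Data.Nat.Properties
  open import Data.Nat.Tactic.RingSolver using (solve-∀)
  open import Data.Product.Base using (_,_; ∃-syntax)
  open import Relation.Binary.PropositionalEquality

  -- expSum T m j is Tᵐ m! times the m-th partial sum of the series of exp (j / T).
  expSum : ℕ → ℕ → ℕ → ℕ
  expSum T zero    j = 1
  expSum T (suc m) j = suc m * (T * expSum T m j) + j ^ suc m

  -- The two leading terms of the binomial expansion.
  ^-suc-≥ : ∀ j m → j ^ suc m + suc m * j ^ m ≤ suc j ^ suc m
  ^-suc-≥ j zero    = ≤-reflexive (eq j)
    where
    eq : ∀ j → j * 1 + 1 * 1 ≡ suc j * 1
    eq = solve-∀
  ^-suc-≥ j (suc m) = begin
    j * j ^ suc m + suc (suc m) * (j * j ^ m)                      ≤⟨ m≤m+n _ (suc m * j ^ m) ⟩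
    j * j ^ suc m + suc (suc m) * (j * j ^ m) + suc m * j ^ m      ≡⟨ eq j m (j ^ m) ⟩
    suc j * (j ^ suc m + suc m * j ^ m)                            ≤⟨ *-monoʳ-≤ (suc j) (^-suc-≥ j m) ⟩
    suc j ^ suc (suc m)                                            ∎
    where
    open ≤-Reasoning
    eq : ∀ j m x → j * (j * x) + suc (suc m) * (j * x) + suc m * x ≡ suc j * (j * x + suc m * x)
    eq = solve-∀

  -- Writing `Eₘ` for the m-th partial sum of exp, this is `Eₘ₊₁((j + 1) / T) ≥ Eₘ₊₁(j / T) + Eₘ(j /
  -- T) / T`: the derivative of `Eₘ₊₁` is `Eₘ`, and the function lies above its tangent.
  expSum-suc : ∀ T m j → expSum T (suc m) j + suc m * expSum T m j ≤ expSum T (suc m) (suc j)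
  expSum-suc T zero    j = ≤-reflexive (eq T j)
    where
    eq : ∀ T j → 1 * (T * 1) + j * 1 + 1 * 1 ≡ 1 * (T * 1) + suc j * 1
    eq = solve-∀
  expSum-suc T (suc m) j = begin
    suc (suc m) * (T * (E₁ j)) + j ^ suc (suc m) + suc (suc m) * (suc m * (T * E₀) + j ^ suc m)
      ≡⟨ eq T m (E₁ j) E₀ (j ^ suc (suc m)) (j ^ suc m) ⟩
    suc (suc m) * (T * (E₁ j + suc m * E₀)) + (j ^ suc (suc m) + suc (suc m) * j ^ suc m)
      ≤⟨ +-mono-≤ (*-monoʳ-≤ (suc (suc m)) (*-monoʳ-≤ T (expSum-suc T m j))) (^-suc-≥ j (suc m)) ⟩
    suc (suc m) * (T * E₁ (suc j)) + suc j ^ suc (suc m) ∎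
    where
    open ≤-Reasoning
    E₁ = expSum T (suc m)
    E₀ = expSum T m j
    eq : ∀ T m x y a b → suc (suc m) * (T * x) + a + suc (suc m) * (suc m * (T * y) + b) ≡ suc (suc m) * (T * (x + suc m * y)) + (a + suc (suc m) * b)
    eq = solve-∀

  -- Induction on `j`, multiplying by `1 + 1 / T` and applying `expSum-suc`. Each step lowers the
  -- order of one partial sum by one, hence `j ≤ m`.
  [1+1/T]^j≤expSum : ∀ T j m → j ≤ m → suc T ^ j * (T ^ m * m !) ≤ T ^ j * expSum T m j
  [1+1/T]^j≤expSum T zero    zero    _ = ≤-refl
  [1+1/T]^j≤expSum T zero    (suc m) _ = begin
    1 * (T * T ^ m * (suc m * m !))        ≡⟨ eq₁ T m (T ^ m) (m !) ⟩
    suc m * (T * (1 * (T ^ m * m !)))      ≤⟨ *-monoʳ-≤ (suc m) (*-monoʳ-≤ T ([1+1/T]^j≤expSum T zero m z≤n)) ⟩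
    suc m * (T * (1 * expSum T m 0))       ≡⟨ eq₂ T m (expSum T m 0) ⟩
    1 * (suc m * (T * expSum T m 0) + 0)   ∎
    where
    open ≤-Reasoning
    eq₁ : ∀ T m x y → 1 * (T * x * (suc m * y)) ≡ suc m * (T * (1 * (x * y)))
    eq₁ = solve-∀
    eq₂ : ∀ T m x → suc m * (T * (1 * x)) ≡ 1 * (suc m * (T * x) + 0)
    eq₂ = solve-∀
  [1+1/T]^j≤expSum T (suc j) (suc m) (s≤s j≤m) = begin
    suc T * suc T ^ j * (T * T ^ m * (suc m * m !))
      ≡⟨ eq₁ T m (suc T ^ j) (T ^ m) (m !) ⟩
    T * (suc T ^ j * (T * T ^ m * (suc m * m !))) + T * suc m * (suc T ^ j * (T ^ m * m !))
      ≤⟨ +-mono-≤ (*-monoʳ-≤ T ([1+1/T]^j≤expSum T j (suc m) (m≤n⇒m≤1+n j≤m))) (*-monoʳ-≤ (T * suc m) ([1+1/T]^j≤expSum T j m j≤m)) ⟩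
    T * (T ^ j * expSum T (suc m) j) + T * suc m * (T ^ j * expSum T m j)
      ≡⟨ eq₂ T m (T ^ j) (expSum T (suc m) j) (expSum T m j) ⟩
    T * T ^ j * (expSum T (suc m) j + suc m * expSum T m j)
      ≤⟨ *-monoʳ-≤ (T * T ^ j) (expSum-suc T m j) ⟩
    T * T ^ j * expSum T (suc m) (suc j) ∎
    where
    open ≤-Reasoning
    eq₁ : ∀ T m a b c → suc T * a * (T * b * (suc m * c)) ≡ T * (a * (T * b * (suc m * c))) + T * suc m * (a * (b * c))
    eq₁ = solve-∀
    eq₂ : ∀ T m a x y → T * (a * x) + T * suc m * (a * y) ≡ T * a * (x + suc m * y)
    eq₂ = solve-∀

  -- m! times the m-th partial sum of the series of e
  eNum : ℕ → ℕ
  eNum zero    = 1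
  eNum (suc m) = suc m * eNum m + 1

  expSum-T : ∀ T m → expSum T m T ≡ T ^ m * eNum m
  expSum-T T zero    = refl
  expSum-T T (suc m) = trans (cong (λ x → suc m * (T * x) + T ^ suc m) (expSum-T T m)) (eq T m (T ^ m) (eNum m))
    where
    eq : ∀ T m x y → suc m * (T * (x * y)) + T * x ≡ T * x * (suc m * y + 1)
    eq = solve-∀

  [1+1/T]^T≤e : ∀ T .{{_ : NonZero T}} m → T ≤ m → suc T ^ T * m ! ≤ T ^ T * eNum m
  [1+1/T]^T≤e T m T≤m = *-cancelʳ-≤ _ _ (T ^ m) {{m^n≢0 T m}} (begin
    suc T ^ T * m ! * T ^ m          ≡⟨ trans (*-assoc (suc T ^ T) (m !) _) (cong (suc T ^ T *_) (*-comm (m !) (T ^ m))) ⟩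
    suc T ^ T * (T ^ m * m !)        ≤⟨ [1+1/T]^j≤expSum T T m T≤m ⟩
    T ^ T * expSum T m T             ≡⟨ cong (T ^ T *_) (expSum-T T m) ⟩
    T ^ T * (T ^ m * eNum m)         ≡⟨ trans (cong (T ^ T *_) (*-comm (T ^ m) _)) (sym (*-assoc (T ^ T) (eNum m) _)) ⟩
    T ^ T * eNum m * T ^ m           ∎)
    where open ≤-Reasoning

  bernoulli : ∀ T c → T ^ c * (T + c) ≤ T * suc T ^ c
  bernoulli T zero    = ≤-reflexive (eq T)
    where
    eq : ∀ T → 1 * (T + 0) ≡ T * 1
    eq = solve-∀
  bernoulli T (suc c) = begin
    T * T ^ c * (T + suc c)               ≤⟨ m≤m+n _ (T ^ c * c) ⟩
    T * T ^ c * (T + suc c) + T ^ c * c   ≡⟨ eq₁ T c (T ^ c) ⟩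
    suc T * (T ^ c * (T + c))             ≤⟨ *-monoʳ-≤ (suc T) (bernoulli T c) ⟩
    suc T * (T * suc T ^ c)               ≡⟨ eq₂ T (suc T ^ c) ⟩
    T * (suc T * suc T ^ c)               ∎
    where
    open ≤-Reasoning
    eq₁ : ∀ T c x → T * x * (T + suc c) + x * c ≡ suc T * (x * (T + c))
    eq₁ = solve-∀
    eq₂ : ∀ T x → suc T * (T * x) ≡ T * (suc T * x)
    eq₂ = solve-∀

  -- This is (T / (T + 1)) ^ r ≥ 1 - r / (T + 1).
  bernoulli⁻ : ∀ T r → suc T ^ r * suc T ≤ T ^ r * suc T + r * suc T ^ r
  bernoulli⁻ T zero    = m≤m+n _ 0
  bernoulli⁻ T (suc r) = begin
    suc T * V * suc T                                      ≡⟨ *-assoc (suc T) V (suc T) ⟩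
    suc T * (V * suc T)                                    ≤⟨ *-monoʳ-≤ (suc T) (bernoulli⁻ T r) ⟩
    suc T * (T ^ r * suc T + r * V)                        ≡⟨ eq₁ T r (T ^ r) V ⟩
    T * T ^ r * suc T + r * (suc T * V) + suc T * T ^ r
      ≤⟨ +-monoʳ-≤ (T * T ^ r * suc T + r * (suc T * V)) (*-monoʳ-≤ (suc T) (^-monoˡ-≤ r (n≤1+n T))) ⟩
    T * T ^ r * suc T + r * (suc T * V) + suc T * V        ≡⟨ eq₂ T r (T ^ r) V ⟩
    T * T ^ r * suc T + suc r * (suc T * V)                ∎
    where
    open ≤-Reasoning
    V = suc T ^ r
    eq₁ : ∀ T r x v → suc T * (x * suc T + r * v) ≡ T * x * suc T + r * (suc T * v) + suc T * x
    eq₁ = solve-∀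
    eq₂ : ∀ T r x v → T * x * suc T + r * (suc T * v) + suc T * v ≡ T * x * suc T + suc r * (suc T * v)
    eq₂ = solve-∀

  -- Used for common multiples T of the denominators, where no division rounds.
  scaledHarmonic : ℕ → ℕ → ℕ → ℕ
  scaledHarmonic T N zero    = 0
  scaledHarmonic T N (suc L) = scaledHarmonic T N L + T / suc (N + L)

  -- The product of the 1 + 1 / d for N < d ≤ N + L telescopes.
  harmonic-product : ∀ T .{{_ : NonZero T}} N L → (∀ d → 0 < d → d ≤ N + L → d ∣ T) →
                     let c = scaledHarmonic T N L in suc (N + L) * T ^ c ≤ suc N * suc T ^ c
  harmonic-product T N zero    ∣T = ≤-reflexive (cong (λ x → suc x * 1) (+-identityʳ N))
  harmonic-product T N (suc L) ∣T = *-cancelˡ-≤ (d * T) {{m*n≢0 d T}} (begin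
    d * T * (suc (N + suc L) * T ^ (c₀ + c))      ≡⟨ cong₂ (λ x y → d * T * (suc x * y)) (+-suc N L) (^-distribˡ-+-* T c₀ c) ⟩
    d * T * (suc d * (T ^ c₀ * T ^ c))            ≡⟨ eq₁ d T (T ^ c₀) (T ^ c) ⟩
    d * T ^ c₀ * (T ^ c * (d * T + T))            ≡⟨ cong (λ x → d * T ^ c₀ * (T ^ c * (d * T + x))) cd≡T ⟨
    d * T ^ c₀ * (T ^ c * (d * T + c * d))        ≡⟨ eq₂ d T (T ^ c₀) (T ^ c) c ⟩
    d * T ^ c₀ * (d * (T ^ c * (T + c)))
      ≤⟨ *-mono-≤ (harmonic-product T N L λ e 0<e e≤ → ∣T e 0<e (≤-trans e≤ (+-monoʳ-≤ N (n≤1+n L)))) (*-monoʳ-≤ d (bernoulli T c)) ⟩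
    suc N * suc T ^ c₀ * (d * (T * suc T ^ c))    ≡⟨ eq₃ d T (suc N) (suc T ^ c₀) (suc T ^ c) ⟩
    d * T * (suc N * (suc T ^ c₀ * suc T ^ c))    ≡⟨ cong (λ x → d * T * (suc N * x)) (^-distribˡ-+-* (suc T) c₀ c) ⟨
    d * T * (suc N * suc T ^ (c₀ + c))            ∎)
    where
    open ≤-Reasoning
    d = suc (N + L)
    c₀ = scaledHarmonic T N L
    c = T / d
    cd≡T : c * d ≡ T
    cd≡T = m/n*n≡m (∣T d (s≤s z≤n) (≤-reflexive (sym (+-suc N L))))
    eq₁ : ∀ d T x y → d * T * (suc d * (x * y)) ≡ d * x * (y * (d * T + T))
    eq₁ = solve-∀
    eq₂ : ∀ d T x y c → d * x * (y * (d * T + c * d)) ≡ d * x * (d * (y * (T + c)))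
    eq₂ = solve-∀
    eq₃ : ∀ d T n x y → n * x * (d * (T * y)) ≡ d * T * (n * (x * y))
    eq₃ = solve-∀

  d∣n! : ∀ d n → 0 < d → d ≤ n → d ∣ n !
  d∣n! (suc d) n _ d≤n = ∣-trans (m∣m*n (d !)) (m≤n⇒m!∣n! d≤n)

  -- If c / T ≈ log p is at most k + 1 / (S + 1), and aᵏ < p bᵏ, then a / b ≤ (1 + 1 / T) ^ T.
  module _ (p N S T k a b c : ℕ) .{{_ : NonZero T}}
           (product : suc (p * N) * T ^ c ≤ suc N * suc T ^ c)
           (log≤ : c * suc S ≤ (k * suc S + 1) * T)
           (aᵏ< : a ^ k < p * b ^ k) (S≡ : S ≡ suc (3 * a ^ k)) (S≤N : S ≤ N) where

    private
      open ≤-Reasoning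
      A = a ^ k
      -- The excess of `c / T` over `k`, in units of `1 / T`; as a fraction it is at most
      -- `1 / (S + 1)`.
      r = c ∸ k * T
      V = suc T ^ r
      W = T ^ r

      instance
        W≢0 : NonZero W
        W≢0 = m^n≢0 T r

      Rr≤T : r * suc S ≤ T
      Rr≤T = begin
        (c ∸ k * T) * suc S                        ≡⟨ *-distribʳ-∸ (suc S) c (k * T) ⟩
        c * suc S ∸ k * T * suc S                  ≤⟨ ∸-monoˡ-≤ (k * T * suc S) log≤ ⟩
        (k * suc S + 1) * T ∸ k * T * suc S        ≡⟨ cong (_∸ k * T * suc S) (eq k S T) ⟩
        k * T * suc S + T ∸ k * T * suc S          ≡⟨ m+n∸m≡n (k * T * suc S) T ⟩
        T                                          ∎
        where
        eq : ∀ k S T → (k * suc S + 1) * T ≡ k * T * suc S + T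
        eq = solve-∀

      product′ : suc (p * N) * (T ^ (k * T) * W) ≤ suc N * (suc T ^ (k * T) * V)
      product′ = subst₂ (λ x y → suc (p * N) * x ≤ suc N * y) (^-distribˡ-+-* T (k * T) r) (^-distribˡ-+-* (suc T) (k * T) r)
        (lift (m≤n⇒∃[o]m+o≡n (m≤n+m∸n c (k * T))))
        where
        -- `k * T + r` is the larger of `c` and `k * T`; enlarging the exponent preserves `product`
        -- because `T ≤ suc T`.
        lift : ∃[ o ] c + o ≡ k * T + r → suc (p * N) * T ^ (k * T + r) ≤ suc N * suc T ^ (k * T + r)
        lift (o , eq) = subst (λ x → suc (p * N) * T ^ x ≤ suc N * suc T ^ x) eq (begin
          suc (p * N) * T ^ (c + o)               ≡⟨ cong (suc (p * N) *_) (^-distribˡ-+-* T c o) ⟩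
          suc (p * N) * (T ^ c * T ^ o)           ≡⟨ *-assoc (suc (p * N)) (T ^ c) (T ^ o) ⟨
          suc (p * N) * T ^ c * T ^ o             ≤⟨ *-mono-≤ product (^-monoˡ-≤ o (n≤1+n T)) ⟩
          suc N * suc T ^ c * suc T ^ o           ≡⟨ *-assoc (suc N) (suc T ^ c) (suc T ^ o) ⟩
          suc N * (suc T ^ c * suc T ^ o)         ≡⟨ cong (suc N *_) (^-distribˡ-+-* (suc T) c o) ⟨
          suc N * suc T ^ (c + o)                 ∎)

      -- `(T / (T + 1))^r ≥ 1 - r / (T + 1) ≥ S / (S + 1)`, the latter from `r (S + 1) ≤ T`.
      SV≤ : S * V ≤ suc S * W
      SV≤ = *-cancelˡ-≤ (suc T) (+-cancelʳ-≤ (suc T * V) _ _ (begin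
        suc T * (S * V) + suc T * V               ≡⟨ eq₁ (suc T) S V ⟩
        suc S * (V * suc T)                       ≤⟨ *-monoʳ-≤ (suc S) (bernoulli⁻ T r) ⟩
        suc S * (W * suc T + r * V)               ≡⟨ eq₂ (suc T) S V W r ⟩
        suc T * (suc S * W) + r * suc S * V       ≤⟨ +-monoʳ-≤ (suc T * (suc S * W)) (*-monoˡ-≤ V (≤-trans Rr≤T (n≤1+n T))) ⟩
        suc T * (suc S * W) + suc T * V           ∎))
        where
        eq₁ : ∀ t s v → t * (s * v) + t * v ≡ suc s * (v * t)
        eq₁ = solve-∀
        eq₂ : ∀ t s v w r → suc s * (w * t + r * v) ≡ t * (suc s * w) + r * suc s * v
        eq₂ = solve-∀

    log≤⇒≤exp : a * T ^ T ≤ b * suc T ^ T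
    log≤⇒≤exp = ≮⇒≥ λ exp< → <⇒≱ contradictory (impossible (step exp<))
      where
      step : b * suc T ^ T < a * T ^ T → b ^ k * suc (p * N) * W ≤ suc N * V * A
      step exp< = *-cancelʳ-≤ _ _ (T ^ (k * T)) {{m^n≢0 T (k * T)}} (begin
        b ^ k * suc (p * N) * W * T ^ (k * T)                ≡⟨ eq₁ (b ^ k) (suc (p * N)) W (T ^ (k * T)) ⟩
        b ^ k * (suc (p * N) * (T ^ (k * T) * W))            ≤⟨ *-monoʳ-≤ (b ^ k) product′ ⟩
        b ^ k * (suc N * (suc T ^ (k * T) * V))              ≡⟨ eq₂ (b ^ k) (suc N) (suc T ^ (k * T)) V ⟩
        suc N * V * (b ^ k * suc T ^ (k * T))                ≤⟨ *-monoʳ-≤ (suc N * V) powers ⟩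
        suc N * V * (A * T ^ (k * T))                        ≡⟨ *-assoc (suc N * V) A _ ⟨
        suc N * V * A * T ^ (k * T)                          ∎)
        where
        eq₁ : ∀ b n w t → b * n * w * t ≡ b * (n * (t * w))
        eq₁ = solve-∀
        eq₂ : ∀ b n t v → b * (n * (t * v)) ≡ n * v * (b * t)
        eq₂ = solve-∀
        power : ∀ x y → (x * y ^ T) ^ k ≡ x ^ k * y ^ (k * T)
        power x y = trans (^-distribʳ-* k x (y ^ T)) (cong (x ^ k *_) (trans (^-*-assoc y T k) (cong (y ^_) (*-comm T k))))
        powers : b ^ k * suc T ^ (k * T) ≤ A * T ^ (k * T)
        powers = subst₂ _≤_ (power b (suc T)) (power a T) (^-monoˡ-≤ k (<⇒≤ exp<))
      -- Integrality enters here: `aᵏ < p bᵏ` means `aᵏ + 1 ≤ p bᵏ`, and this gap of one is what the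
      -- errors have to stay below.
      impossible : b ^ k * suc (p * N) * W ≤ suc N * V * A → S * (N * (A + 1)) ≤ suc N * suc S * A
      impossible le = *-cancelʳ-≤ _ _ W (begin
        S * (N * (A + 1)) * W                     ≤⟨ *-monoˡ-≤ W (*-monoʳ-≤ S (begin
          N * (A + 1)                               ≤⟨ *-monoʳ-≤ N (≤-trans (≤-reflexive (+-comm A 1)) aᵏ<) ⟩
          N * (p * b ^ k)                           ≡⟨ eq₀ N p (b ^ k) ⟩
          b ^ k * (p * N)                           ≤⟨ *-monoʳ-≤ (b ^ k) (n≤1+n (p * N)) ⟩
          b ^ k * suc (p * N)                       ∎)) ⟩
        S * (b ^ k * suc (p * N)) * W             ≡⟨ *-assoc S _ W ⟩
        S * (b ^ k * suc (p * N) * W)             ≤⟨ *-monoʳ-≤ S le ⟩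
        S * (suc N * V * A)                       ≡⟨ eq₁ S (suc N) V A ⟩
        suc N * A * (S * V)                       ≤⟨ *-monoʳ-≤ (suc N * A) SV≤ ⟩
        suc N * A * (suc S * W)                   ≡⟨ eq₂ (suc S) (suc N) W A ⟩
        suc N * suc S * A * W                     ∎)
        where
        eq₀ : ∀ n p b → n * (p * b) ≡ b * (p * n)
        eq₀ = solve-∀
        eq₁ : ∀ s n v a → s * (n * v * a) ≡ n * a * (s * v)
        eq₁ = solve-∀
        eq₂ : ∀ s n w a → n * a * (s * w) ≡ n * s * a * w
        eq₂ = solve-∀
      -- The errors have relative sizes `1 / N` and `1 / S`. The choice `S = 3 aᵏ + 1 ≤ N` keeps
      -- them below the gap: `(S + N + 1) A ≤ 3 N A < N S`.
      contradictory : suc N * suc S * A < S * (N * (A + 1))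
      contradictory = begin-strict
        suc N * suc S * A                                 ≡⟨ eq₁ N S A ⟩
        S * N * A + (S + N + 1) * A
          ≤⟨ +-monoʳ-≤ (S * N * A) (*-monoˡ-≤ A (+-mono-≤ (+-monoˡ-≤ N S≤N) 1≤N)) ⟩
        S * N * A + (N + N + N) * A                       <⟨ +-monoʳ-< (S * N * A) (begin-strict
          (N + N + N) * A                                   ≡⟨ eq₂ N A ⟩
          N * (3 * A)                                       <⟨ *-monoʳ-< N {{>-nonZero 1≤N}} (≤-reflexive (sym S≡)) ⟩
          N * S                                             ∎) ⟩
        S * N * A + N * S                                 ≡⟨ eq₃ N S A ⟩
        S * (N * (A + 1))                                 ∎
        where
        1≤N : 1 ≤ N
        1≤N = ≤-trans (subst (1 ≤_) (sym S≡) (s≤s z≤n)) S≤N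
        eq₁ : ∀ n s a → suc n * suc s * a ≡ s * n * a + (s + n + 1) * a
        eq₁ = solve-∀
        eq₂ : ∀ n a → (n + n + n) * a ≡ n * (3 * a)
        eq₂ = solve-∀
        eq₃ : ∀ n s a → s * n * a + n * s ≡ s * (n * (a + 1))
        eq₃ = solve-∀

-- Passage to the real numbers and the two bounds

open import Data.Fin.Base using (Fin)
open import Data.Integer.Base as ℤ using (ℤ; +_)
open import Data.Nat.Base hiding (_/_)
open import Data.Nat.Primality using (Prime; prime⇒nonTrivial)
open import Data.Product.Base using (_×_; _,_; ∃-syntax; proj₁; proj₂)
open import Data.Rational.Unnormalised.Base as ℚ using (ℚᵘ; 0ℚᵘ; _/_)
open import Data.Vec.Base using (Vec)
open import Defs

open CharacterSums using (leastBelow)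
open HeightBound using (^-distribʳ-*; height-bound)
open Exponential
import Data.Integer.Properties as ℤ
open import Data.Nat.Divisibility using (_∣_)
open import Data.Nat.DivMod as ℕ using (m/n*n≤m; m≡m%n+[m/n]*n; m%n<n; m/n*n≡m)
open import Data.Nat.Properties
open import Data.Nat.Tactic.RingSolver using (solve-∀)
import Data.Rational.Unnormalised.Properties as ℚ
open import Data.Sum.Base using (inj₁; inj₂)
open import Relation.Binary.PropositionalEquality
open import Relation.Nullary.Negation using (¬_; contradiction)

/-≤⁻ : ∀ a b c d .{{_ : NonZero b}} .{{_ : NonZero d}} → + a / b ℚ.≤ + c / d → a * d ≤ c * b
/-≤⁻ a (suc b) c (suc d) (ℚ.*≤* le) = ℤ.drop‿+≤+ (subst₂ ℤ._≤_ (sym (ℤ.pos-* a (suc d))) (sym (ℤ.pos-* c (suc b))) le)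

≤-/*/ : ∀ x y a b c d .{{_ : NonZero y}} .{{_ : NonZero b}} .{{_ : NonZero d}} →
        x * (b * d) ≤ a * c * y → + x / y ℚ.≤ + a / b ℚ.* (+ c / d)
≤-/*/ x y a (suc b) c (suc d) le =
  subst (λ z → + x / y ℚ.≤ z / (suc b * suc d)) (ℤ.pos-* a c) (/-≤ x y (a * c) (suc b * suc d) le)

eNum/m!≤eSeq : ∀ m → (+ eNum m / (m !)) {{m !≢0}} ℚ.≤ eSeq m
eNum/m!≤eSeq zero    = ℚ.≤-reflexive (ℚ.≃-sym (ℚ.+-identityˡ (+ 1 / 1)))
eNum/m!≤eSeq (suc m) = begin
  + (suc m * eNum m + 1) / (suc m !)                             ≃⟨ /-+ (suc m * eNum m) 1 (suc m !) ⟨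
  + (suc m * eNum m) / (suc m !) ℚ.+ + 1 / (suc m !)
    ≤⟨ ℚ.+-monoˡ-≤ (+ 1 / (suc m !)) (/-≤ (suc m * eNum m) (suc m !) (eNum m) (m !) (≤-reflexive (eq (eNum m) m (m !)))) ⟩
  + eNum m / (m !) ℚ.+ + 1 / (suc m !)                           ≤⟨ ℚ.+-monoˡ-≤ (+ 1 / (suc m !)) (eNum/m!≤eSeq m) ⟩
  eSeq (suc m)                                                   ∎
  where
  open ℚ.≤-Reasoning
  instance
    m!≢0 = m !≢0
    [1+m]!≢0 = suc m !≢0
  eq : ∀ x m y → suc m * x * y ≡ x * (suc m * y)
  eq = solve-∀

scaledHarmonic≤logSeq : ∀ T .{{_ : NonZero T}} n L → (∀ d → 0 < d → d ≤ suc n + L → d ∣ T) →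
                        + scaledHarmonic T (suc n) L / T ℚ.≤ sum (λ i → + 1 / (suc n + suc i)) L
scaledHarmonic≤logSeq T n zero    ∣T = /-≤ 0 T 0 1 z≤n
scaledHarmonic≤logSeq T n (suc L) ∣T = begin
  + (c₀ + c) / T                              ≃⟨ /-+ c₀ c T ⟨
  + c₀ / T ℚ.+ + c / T
    ≤⟨ ℚ.+-mono-≤ (scaledHarmonic≤logSeq T n L λ d 0<d d≤ → ∣T d 0<d (≤-trans d≤ (+-monoʳ-≤ (suc n) (n≤1+n L))))
           (/-≤ c T 1 (suc n + suc L) (≤-reflexive (trans (cong (c *_) (+-suc (suc n) L))
             (trans (m/n*n≡m (∣T (suc (suc n + L)) (s≤s z≤n) (≤-reflexive (sym (+-suc (suc n) L))))) (sym (*-identityˡ T)))))) ⟩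
  sum (λ i → + 1 / (suc n + suc i)) (suc L)   ∎
  where
  open ℚ.≤-Reasoning
  c₀ = scaledHarmonic T (suc n) L
  c = T ℕ./ suc (suc n + L)

-- The power `(1 + 1 / T)^T` lies between `a / b` and the late partial sums of e. The strict
-- hypothesis is what gives a conclusion for these partial sums themselves, without an error term.
log≤⇒power< : ∀ p .{{_ : NonZero p}} k a b → log p ≤ᵣ fromℤ (+ k) → a ^ k < p * b ^ k →
              ∃[ T ] ∀ m → T ≤ m → a * m ! ≤ b * eNum m
log≤⇒power< p@(suc p-1) k a b log≤k aᵏ< = T , λ m T≤m → *-cancelˡ-≤ (T ^ T) {{m^n≢0 T T}} (begin
  T ^ T * (a * m !)                ≡⟨ eq₁ (T ^ T) a (m !) ⟩
  a * T ^ T * m !                  ≤⟨ *-monoˡ-≤ (m !) a/b≤ ⟩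
  b * suc T ^ T * m !              ≡⟨ *-assoc b (suc T ^ T) (m !) ⟩
  b * (suc T ^ T * m !)            ≤⟨ *-monoʳ-≤ b ([1+1/T]^T≤e T m T≤m) ⟩
  b * (T ^ T * eNum m)             ≡⟨ eq₂ (T ^ T) b (eNum m) ⟩
  T ^ T * (b * eNum m)             ∎)
  where
  open ≤-Reasoning
  S = suc (3 * a ^ k)
  n₀ = proj₁ (log≤k (+ 1 / suc S) (ℚ.positive⁻¹ (+ 1 / suc S)))
  -- Late enough for the Riemann sum of log p to be at most `k + 1 / (S + 1)`, and at least `S` as
  -- `log≤⇒≤exp` requires of `N`.
  n = n₀ + S
  N = suc n
  -- A multiple of every denominator up to `p * N`, so that the divisions in `scaledHarmonic` are
  -- exact.
  T = (p * N) !
  L = p-1 * N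
  c = scaledHarmonic T N L
  instance
    T≢0 : NonZero T
    T≢0 = (p * N) !≢0
  ∣T : ∀ d → 0 < d → d ≤ N + L → d ∣ T
  ∣T d 0<d d≤ = d∣n! d (p * N) 0<d d≤
  log≤ : c * suc S ≤ (k * suc S + 1) * T
  log≤ = /-≤⁻ c T (k * suc S + 1) (suc S) (ℚ.≤-trans (scaledHarmonic≤logSeq T n L ∣T)
    (ℚ.≤-trans (proj₂ (log≤k (+ 1 / suc S) (ℚ.positive⁻¹ (+ 1 / suc S))) n (m≤m+n n₀ S))
    (ℚ.≤-trans (ℚ.+-monoˡ-≤ (+ 1 / suc S) (/-≤ k 1 (k * suc S) (suc S) (≤-reflexive (sym (*-identityʳ (k * suc S))))))
      (ℚ.≤-reflexive (/-+ (k * suc S) 1 (suc S))))))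
  a/b≤ : a * T ^ T ≤ b * suc T ^ T
  a/b≤ = log≤⇒≤exp p N S T k a b c (harmonic-product T N L ∣T) log≤ aᵏ< refl (≤-trans (m≤n+m S n₀) (n≤1+n n))
  eq₁ : ∀ t a m → t * (a * m) ≡ a * t * m
  eq₁ = solve-∀
  eq₂ : ∀ t b m → b * (t * m) ≡ t * (b * m)
  eq₂ = solve-∀

sum-mono-length : ∀ {f} → (∀ i → 0ℚᵘ ℚ.≤ f i) → ∀ {m n} → m ≤ n → sum f m ℚ.≤ sum f n
sum-mono-length {f} 0≤f {m} m≤n with o , refl ← m≤n⇒∃[o]m+o≡n m≤n = go o
  where
  go : ∀ o → sum f m ℚ.≤ sum f (m + o)
  go zero    = ℚ.≤-reflexive (ℚ.≃-reflexive (cong (sum f) (sym (+-identityʳ m))))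
  go (suc o) rewrite +-suc m o = ℚ.≤-trans (go o)
    (ℚ.≤-trans (ℚ.≤-reflexive (ℚ.≃-sym (ℚ.+-identityʳ (sum f (m + o))))) (ℚ.+-monoʳ-≤ (sum f (m + o)) (0≤f (m + o))))

-- Each doubling from `2ⁱ` to `2ⁱ⁺¹` adds `2ⁱ N` terms, none smaller than `1 / (2ⁱ⁺¹ N)`. This holds
-- for every Riemann sum and not only in the limit.
log₂-bound : ∀ i m n → 2 ^ i ≤ m → + i / 2 ℚ.≤ logSeq m n
log₂-bound i m n 2ⁱ≤m = ℚ.≤-trans (dyadic i)
  (sum-mono-length (λ j → 0≤/ 1 (suc n + suc j)) (*-monoˡ-≤ (suc n) (∸-monoˡ-≤ 1 2ⁱ≤m)))
  where
  open ℚ.≤-Reasoning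
  N = suc n
  f : ℕ → ℚᵘ
  f j = + 1 / (N + suc j)
  dyadic : ∀ i → + i / 2 ℚ.≤ sum f ((2 ^ i ∸ 1) * N)
  dyadic zero    = /-≤ 0 2 0 1 z≤n
  dyadic (suc i) = begin
    + suc i / 2                                    ≡⟨ cong (λ k → + k / 2) (+-comm 1 i) ⟩
    + (i + 1) / 2                                  ≃⟨ /-+ i 1 2 ⟨
    + i / 2 ℚ.+ + 1 / 2
      ≤⟨ ℚ.+-mono-≤ (dyadic i) (ℚ.≤-trans (/-≤ 1 2 (M * N) (M * N + M * N) (≤-reflexive (eq (M * N))))
           (sum-≥ (λ j → f (A + j)) (M * N + M * N) (M * N) λ j j< → /-≤ 1 (M * N + M * N) 1 (N + suc (A + j)) (*-monoʳ-≤ 1 (bound j j<)))) ⟩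
    sum f A ℚ.+ sum (λ j → f (A + j)) (M * N)      ≃⟨ sum-+ f A (M * N) ⟨
    sum f (A + M * N)                              ≡⟨ cong (sum f) length≡ ⟩
    sum f ((2 ^ suc i ∸ 1) * N)                    ∎
    where
    M = 2 ^ i
    instance
      M≢0 : NonZero M
      M≢0 = m^n≢0 2 i
      MN≢0 : NonZero (M * N + M * N)
      MN≢0 = >-nonZero (≤-trans (≤-trans (s≤s z≤n) (m≤n*m N M)) (m≤m+n (M * N) (M * N)))
    A = (M ∸ 1) * N
    N+A : N + A ≡ M * N
    N+A = trans (cong (_+ A) (sym (*-identityˡ N))) (trans (sym (*-distribʳ-+ N 1 (M ∸ 1))) (cong (_* N) (m+[n∸m]≡n (>-nonZero⁻¹ M))))
    bound : ∀ j → j < M * N → N + suc (A + j) ≤ M * N + M * N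
    bound j j< = ≤-trans (≤-reflexive (trans (cong (λ x → N + x) (sym (+-suc A j)))
      (trans (sym (+-assoc N A (suc j))) (cong (_+ suc j) N+A)))) (+-monoʳ-≤ (M * N) j<)
    length≡ : A + M * N ≡ (2 * M ∸ 1) * N
    length≡ = trans (sym (*-distribʳ-+ N (M ∸ 1) M)) (cong (_* N) (trans (+-comm (M ∸ 1) M)
      (trans (sym (+-∸-assoc M (>-nonZero⁻¹ M))) (cong (λ x → M + x ∸ 1) (sym (+-identityʳ M))))))
    eq : ∀ x → 1 * (x + x) ≡ x * 2
    eq = solve-∀

-- Every Riemann sum is at least 1 / 2, so the tolerance 1 / 4 already gives a contradiction. This
-- excludes integer bounds that cannot serve as the exponent `k`.
log≰0 : ∀ p .{{_ : NonZero p}} → 2 ≤ p → ∀ k → fromℤ k .seq 0 ℚ.≤ 0ℚᵘ → ¬ (log p ≤ᵣ fromℤ k)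
log≰0 p 2≤p k k≤0 log≤k = contradiction (/-≤⁻ 1 2 1 4 (begin
  + 1 / 2                   ≤⟨ log₂-bound 1 p n₀ 2≤p ⟩
  logSeq p n₀               ≤⟨ proj₂ (log≤k (+ 1 / 4) (ℚ.positive⁻¹ (+ 1 / 4))) n₀ ≤-refl ⟩
  k / 1 ℚ.+ + 1 / 4         ≤⟨ ℚ.+-monoˡ-≤ (+ 1 / 4) k≤0 ⟩
  0ℚᵘ ℚ.+ + 1 / 4           ≃⟨ ℚ.+-identityˡ (+ 1 / 4) ⟩
  + 1 / 4                   ∎)) λ { (s≤s (s≤s ())) }
  where
  open ℚ.≤-Reasoning
  n₀ = proj₁ (log≤k (+ 1 / 4) (ℚ.positive⁻¹ (+ 1 / 4)))

-- `M = p²` satisfies the first inequality since `k ≥ 1`, and minimality gives the second. If the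
-- least `M` is 0, the second holds because `0ᵏ = 0`.
leastSide : ∀ p H k .{{_ : NonZero p}} .{{_ : NonZero H}} .{{_ : NonZero k}} →
            ∃[ M ] p ^ suc k ≤ (suc M * (2 * H)) ^ k × (M * (2 * H)) ^ k < p ^ suc k
leastSide p H k@(suc _) with leastBelow (λ M → p ^ suc k ≤? (suc M * (2 * H)) ^ k) (suc (p * p))
... | inj₁ (zero , Pm , _)     = 0 , Pm , >-nonZero⁻¹ (p ^ suc k) {{m^n≢0 p (suc k)}}
... | inj₁ (suc M , Pm , min)  = suc M , Pm , ≰⇒> (min M ≤-refl)
... | inj₂ none = contradiction (begin
  p ^ suc k                          ≤⟨ ^-monoʳ-≤ p (+-monoˡ-≤ k (s≤s (z≤n {pred k}))) ⟩
  p ^ (k + k)                        ≡⟨ trans (^-distribˡ-+-* p k k) (sym (^-distribʳ-* k p p)) ⟩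
  (p * p) ^ k                        ≤⟨ ^-monoˡ-≤ k (≤-trans (n≤1+n (p * p)) (m≤m*n (suc (p * p)) (2 * H) {{m*n≢0 2 H}})) ⟩
  (suc (p * p) * (2 * H)) ^ k        ∎) (none (p * p) ≤-refl)
  where open ≤-Reasoning

module _ (n : ℕ) (2≤n : 2 ≤ n) (p : ℕ) .{{_ : NonZero p}} (pr : Prime p) (t : Vec (Fin p) n) where

  private
    H = dualHeight ⟨ t ,1⟩
    instance
      H≢0 : NonZero H
      H≢0 = dualHeight-nonZero ⟨ t ,1⟩
      2H≢0 : NonZero (2 * H)
      2H≢0 = 2*dualHeight-nonZero ⟨ t ,1⟩
    2≤p : 2 ≤ p
    2≤p = nonTrivial⇒n>1 p {{prime⇒nonTrivial pr}}

  explicit-bound : ∀ k → log p ≤ᵣ fromℤ k → fromℤ (+ height t) ≤ᵣ ((+ n ℤ.* (+ p ℤ.* k)) / (2 * H)) · e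
  explicit-bound ℤ.+0       log≤k = contradiction log≤k (log≰0 p 2≤p ℤ.+0 ℚ.≤-refl)
  explicit-bound ℤ.-[1+ k ] log≤k = contradiction log≤k (log≰0 p 2≤p ℤ.-[1+ k ] (ℚ.*≤* ℤ.-≤+))
  explicit-bound (+ k@(suc _)) log≤k ε 0<ε
    with M , large , small ← leastSide p H k
    -- The fraction is `a / b = 2 H M / p`; since `p ^ suc k` unfolds to `p * p ^ k`, `small` is
    -- exactly the hypothesis `aᵏ < p bᵏ`.
    with T , a/b≤e ← log≤⇒power< p k (M * (2 * H)) p log≤k small
    = T , λ m T≤m → bound M large m (a/b≤e m T≤m)
    where
    open ℚ.≤-Reasoning
    q : ℚᵘ
    q = (+ n ℤ.* (+ p ℤ.* + k)) / (2 * H)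
    q≡ : + (n * (p * k)) / (2 * H) ≡ q
    q≡ = cong (λ z → z / (2 * H)) (trans (ℤ.pos-* n (p * k)) (cong (+ n ℤ.*_) (ℤ.pos-* p k)))
    bound : ∀ M → p ^ suc k ≤ (suc M * (2 * H)) ^ k → ∀ m → M * (2 * H) * m ! ≤ p * eNum m →
            + height t / 1 ℚ.≤ q ℚ.* eSeq m ℚ.+ ε
    bound M large m le = begin
      + height t / 1                                             ≤⟨ ≤-/*/ (height t) 1 (n * (p * k)) (2 * H) (eNum m) (m !) nat ⟩
      + (n * (p * k)) / (2 * H) ℚ.* (+ eNum m / (m !))
        ≤⟨ ℚ.*-monoʳ-≤-nonNeg (+ (n * (p * k)) / (2 * H)) {{ℚ.nonNegative (0≤/ (n * (p * k)) (2 * H))}} (eNum/m!≤eSeq m) ⟩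
      + (n * (p * k)) / (2 * H) ℚ.* eSeq m                       ≡⟨ cong (ℚ._* eSeq m) q≡ ⟩
      q ℚ.* eSeq m                                               ≤⟨ ℚ.p≤p+q (q ℚ.* eSeq m) ε {{ℚ.nonNegative (ℚ.<⇒≤ 0<ε)}} ⟩
      q ℚ.* eSeq m ℚ.+ ε                                         ∎
      where
      instance
        m!≢0 = m !≢0
      nat : height t * (2 * H * m !) ≤ n * (p * k) * eNum m * 1
      nat = ≤-trans (*-monoˡ-≤ (2 * H * m !) (height-bound pr 2≤n t k M large))
        (≤-trans (≤-reflexive (eq₁ k n M (2 * H) (m !))) (≤-trans (*-monoʳ-≤ (k * n) le) (≤-reflexive (eq₂ k n p (eNum m)))))
        where
        eq₁ : ∀ k n M h m → k * n * M * (h * m) ≡ k * n * (M * h * m)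
        eq₁ = solve-∀
        eq₂ : ∀ k n p x → k * n * (p * x) ≡ n * (p * k) * x * 1
        eq₂ = solve-∀

  -- The factor 4 comes from `k ≤ 4 log p`: for `k ≥ 2` minimality gives `2ᵏ⁻¹ < p`, so that
  -- `log p ≥ (k - 1) / 2 ≥ k / 4`; for `k = 1` the bound `log p ≥ 1 / 2` is enough.
  log-bound : fromℤ (+ height t) ≤ᵣ ((+ (4 * n) / 1) ℚ.* (+ p / H)) · log p
  log-bound ε 0<ε with leastBelow (λ k → p ≤? 2 ^ k) (suc p)
  ... | inj₂ none = contradiction (<⇒≤ (n<2^n p)) (none p ≤-refl)
    where
    n<2^n : ∀ m → m < 2 ^ m
    n<2^n zero    = s≤s z≤n
    n<2^n (suc m) = ≤-trans (+-mono-≤ (m^n>0 2 m) (n<2^n m)) (+-monoʳ-≤ (2 ^ m) (m≤m+n (2 ^ m) 0))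
  ... | inj₁ (zero , p≤1 , _) = contradiction 2≤p (≤⇒≯ p≤1)
  ... | inj₁ (k@(suc k′) , p≤2ᵏ , min) = 0 , λ m _ → begin
    + height t / 1                                                 ≤⟨ ≤-/*/ (height t) 1 (4 * n * p) (1 * H) k 4 nat ⟩
    + (4 * n * p) / (1 * H) ℚ.* (+ k / 4)
      ≤⟨ ℚ.*-monoʳ-≤-nonNeg (+ (4 * n * p) / (1 * H)) {{ℚ.nonNegative (0≤/ (4 * n * p) (1 * H))}} (k/4≤log m) ⟩
    + (4 * n * p) / (1 * H) ℚ.* logSeq p m
      ≤⟨ ℚ.*-monoˡ-≤-nonNeg (logSeq p m) {{ℚ.nonNegative (ℚ.≤-trans (0≤/ k 4) (k/4≤log m))}} (≤-/*/ (4 * n * p) (1 * H) (4 * n) 1 p H ≤-refl) ⟩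
    + (4 * n) / 1 ℚ.* (+ p / H) ℚ.* logSeq p m                     ≤⟨ ℚ.p≤p+q _ ε {{ℚ.nonNegative (ℚ.<⇒≤ 0<ε)}} ⟩
    + (4 * n) / 1 ℚ.* (+ p / H) ℚ.* logSeq p m ℚ.+ ε               ∎
    where
    open ℚ.≤-Reasoning
    instance
      1H≢0 : NonZero (1 * H)
      1H≢0 = m*n≢0 1 H
    M = p ℕ./ H
    -- `(M + 1) H ≥ p`, so the base is at least `2 p` and its power at least `2ᵏ pᵏ ≥ pᵏ⁺¹`.
    large : p ^ suc k ≤ (suc M * (2 * H)) ^ k
    large = ≤-trans (*-monoˡ-≤ (p ^ k) p≤2ᵏ) (≤-trans (≤-reflexive (sym (^-distribʳ-* k 2 p))) (^-monoˡ-≤ k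
      (≤-trans (*-monoʳ-≤ 2 (≤-trans (≤-reflexive (m≡m%n+[m/n]*n p H)) (+-monoˡ-≤ (M * H) (<⇒≤ (m%n<n p H))))) (≤-reflexive (eq M H)))))
      where
      eq : ∀ M H → 2 * (H + M * H) ≡ suc M * (2 * H)
      eq = solve-∀
    nat : height t * (1 * H * 4) ≤ 4 * n * p * k * 1
    nat = ≤-trans (*-monoˡ-≤ (1 * H * 4) (height-bound pr 2≤n t k M large))
      (≤-trans (≤-reflexive (eq₁ k n M H)) (≤-trans (*-monoʳ-≤ (4 * (k * n)) (m/n*n≤m p H)) (≤-reflexive (eq₂ k n p))))
      where
      eq₁ : ∀ k n M h → k * n * M * (1 * h * 4) ≡ 4 * (k * n) * (M * h)
      eq₁ = solve-∀
      eq₂ : ∀ k n p → 4 * (k * n) * p ≡ 4 * n * p * k * 1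
      eq₂ = solve-∀
    k/4≤log : ∀ m → + k / 4 ℚ.≤ logSeq p m
    k/4≤log m = halves k′ refl
      where
      halves : ∀ j → j ≡ k′ → + suc j / 4 ℚ.≤ logSeq p m
      halves zero    _    = ℚ.≤-trans (/-≤ 1 4 1 2 (s≤s (s≤s z≤n))) (log₂-bound 1 p m 2≤p)
      halves (suc j) refl = ℚ.≤-trans (/-≤ (2 + j) 4 (suc j) 2 (≤-trans (m≤m+n ((2 + j) * 2) (j * 2)) (≤-reflexive (eq j))))
        (log₂-bound k′ p m (<⇒≤ (≰⇒> (min k′ ≤-refl))))
        where
        eq : ∀ j → (2 + j) * 2 + j * 2 ≡ suc j * 4
        eq = solve-∀

lemma7p4 : (n : ℕ) → let d = suc n in 2 < d →
    (∀ (p : ℕ) .{{_ : NonZero p}} → Prime p → (t : Vec (Fin p) (d ∸ 1)) →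
    (⌈log-p⌉ : ℤ) → IsCeiling (log p) ⌈log-p⌉ →
    fromℤ (+ height t) ≤ᵣ
    ((+ (d ∸ 1) ℤ.* (+ p ℤ.* ⌈log-p⌉)) / (2 * dualHeight ⟨ t ,1⟩))
    {{2*dualHeight-nonZero ⟨ t ,1⟩}} · e)
    × (∃[ C ] (0ℚᵘ ℚ.< C ×
    (∀ (p : ℕ) .{{_ : NonZero p}} → Prime p → (t : Vec (Fin p) (d ∸ 1)) →
    fromℤ (+ height t) ≤ᵣ
    (C ℚ.* (+ p / dualHeight ⟨ t ,1⟩) {{dualHeight-nonZero ⟨ t ,1⟩}}) · log p)))
lemma7p4 n (s≤s 2≤n) =
  (λ p pr t k (log≤k , _) → explicit-bound n 2≤n p pr t k log≤k) ,
  + (4 * n) / 1 ,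
  0<4n n 2≤n ,
  λ p pr t → log-bound n 2≤n p pr t
  where
  0<4n : ∀ n → 2 ≤ n → 0ℚᵘ ℚ.< + (4 * n) / 1
  0<4n (suc n) _ = ℚ.positive⁻¹ (+ (4 * suc n) / 1)
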